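{- For every integer $n\ge 1$ there exist integers $G_{10n}$ and $H_{10n}$ such that $$C_{10n}=\sum_{\substack{p\equiv 1 \bmod 5\\ p-1\mid 10n}}\frac{A_p^{10n/(p-1)}}{p}+G_{10n},$$ $$D_{10n}=\sum_{\substack{p\equiv 1 \bmod 5\\ p-1\mid 10n}}\frac{(4!^{ -1}\bmod p)\,A_p^{10n/(p-1)}}{p}+H_{10n},$$ where the sums run over prime numbers $p$ with $p\equiv 1 \pmod 5$ and $(p-1)\mid 10n$, and $$A_p=(-1)^{(p-1)/10}\binom{(p-1)/2}{(p-1)/10}.$$
   Context: Let $C$ be the (smooth projective) curve of genus $2$ defined by $y^2=x^5-1$, and let $\infty$ be its unique point at infinity. Consider the integral $u=\int_{\infty}^{(x,y)}\frac{x\,dx}{2y}$ (an integral of a differential of the first kind which does not vanish at $\infty$). Near $\infty$ the quantity $u$ is a local parameter on $C$ vanishing at $\infty$, so the coordinate functions $x$ and $y$ can be expressed, in a neighborhood of $u=0$, as Laurent series $x(u)$, $y(u)$ in $u$. They satisfy $y(u)^2=x(u)^5-1$, $x'(u)=2y(u)/x(u)$ and $x(u)^2x'(u)^2=4x(u)^5-4$. Only exponents of the following form occur, and the rational numbers $C_{10n}$, $D_{10n}$ ($n\ge 1$) are defined by $$x(u)=\frac{1}{u^2}+\sum_{n=1}^{\infty}\frac{C_{10n}}{10n}\,\frac{u^{10n-2}}{(10n-2)!},\qquad y(u)=\frac{ -1}{u^5}+\sum_{n=1}^{\infty}\frac{D_{10n}}{10n}\,\frac{u^{10n-5}}{(10n-5)!}.$$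 The symbol $(4!^{ -1}\bmod p)$ denotes an integer representing the inverse of $4!=24$ modulo $p$. (Every prime $p\equiv 1\pmod 5$ is odd, hence $p\equiv 1\pmod{10}$.) -}

module Defs where

open import Data.Bool.Base using (if_then_else_)
open import Data.Integer.Base as ℤ using (ℤ; +_; -[1+_])
open import Data.List.Base using (List; foldr; map; filter; upTo)
open import Data.Nat.Base as ℕ using (ℕ; zero; suc; _∸_; _!; _⊔_)
open import Data.Nat.Combinatorics using (_C_)
open import Data.Nat.Divisibility using (_∣_; _∣?_)
open import Data.Nat.Primality using (Prime; prime?)
open import Data.Nat.Properties using (_≟_; _!≢0)
open import Data.Product.Base using (_×_; ∃-syntax)
open import Data.Rational.Base as ℚ using (ℚ; 0ℚ; 1ℚ)
open import Relation.Binary.PropositionalEquality.Core using (_≡_; _≢_)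
open import Relation.Nullary.Decidable using (Dec; does; _×-dec_)

∑ : List ℕ → (ℕ → ℚ) → ℚ
∑ ks f = foldr ℚ._+_ 0ℚ (map f ks)

-- The formal Laurent series Σ_{k ≥ 0} (coeff k) u^{k - pole} over ℚ.
-- The number pole only bounds the order of the pole: coeff 0 may vanish,
-- so a series has several representations, identified by _≈_.
record Laurent : Set where
  constructor laurent
  field
    pole  : ℕ
    coeff : ℕ → ℚ

open Laurent public

infix 9 _⟦_⟧
_⟦_⟧ : Laurent → ℤ → ℚ
f ⟦ e ⟧ with e ℤ.+ + pole f
... | + k      = coeff f k
... | -[1+ _ ] = 0ℚ

infix 4 _≈_
_≈_ : Laurent → Laurent → Set
f ≈ g = ∀ e → f ⟦ e ⟧ ≡ g ⟦ e ⟧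

const : ℚ → Laurent
const q = laurent 0 λ where
  zero    → q
  (suc _) → 0ℚ

infixl 6 _-_
infixl 7 _·_
infixr 8 _^_

_-_ : Laurent → Laurent → Laurent
f - g = laurent p (λ k → f ⟦ + k ℤ.- + p ⟧ ℚ.- g ⟦ + k ℤ.- + p ⟧)
  where p = pole f ⊔ pole g

_·_ : Laurent → Laurent → Laurent
f · g = laurent (pole f ℕ.+ pole g)
  (λ k → ∑ (upTo (suc k)) (λ i → coeff f i ℚ.* coeff g (k ∸ i)))

_^_ : Laurent → ℕ → Laurent
f ^ zero  = const 1ℚ
f ^ suc n = f · f ^ n

-- d/du
deriv : Laurent → Laurent
deriv f = laurent (suc (pole f))
  (λ k → ((+ k ℤ.- + pole f) ℚ./ 1) ℚ.* coeff f k)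

-- x(u), y(u) are the expansions at the point ∞ of the coordinate functions
-- of y² = x⁵ - 1 in terms of u = ∫_∞ x dx / 2y.  The last condition, that x
-- has a pole at u = 0, says that u = 0 corresponds to ∞.  The three conditions
-- determine x and y; the leading terms u⁻² and -u⁻⁵ are consequences.
record IsExpansionAt∞ (x y : Laurent) : Set where
  field
    curve     : y ^ 2 ≈ x ^ 5 - const 1ℚ
    parameter : x · deriv x ≈ const (+ 2 ℚ./ 1) · y     -- du = x dx / 2y
    at-∞      : ∃[ k ] x ⟦ -[1+ k ] ⟧ ≢ 0ℚ

-- (c m / m) u^{m - r} / (m - r)!  for m = 10, 20, 30, … gives the coefficient
-- with index m of a series with pole r; all other coefficients except the
-- leading one vanish.  Only the values of c at positive multiples of 10 are
-- used, so that c (10 n) is the number written with the subscript 10n.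
hurwitzCoeff : (r : ℕ) (leading : ℚ) (c : ℕ → ℚ) → ℕ → ℚ
hurwitzCoeff r leading c zero      = leading
hurwitzCoeff r leading c m@(suc _) =
  if does (10 ∣? m)
  then c m ℚ.* (+ 1 ℚ./ m) ℚ.* ((+ 1 ℚ./ ((m ∸ r) !)) {{(m ∸ r) !≢0}})
  else 0ℚ

-- u⁻² + Σ_{n ≥ 1} (C₁₀ₙ / 10n) u^{10n-2} / (10n-2)!
xSeries : (ℕ → ℚ) → Laurent
xSeries c = laurent 2 (hurwitzCoeff 2 1ℚ c)

-- - u⁻⁵ + Σ_{n ≥ 1} (D₁₀ₙ / 10n) u^{10n-5} / (10n-5)!
ySeries : (ℕ → ℚ) → Laurent
ySeries d = laurent 5 (hurwitzCoeff 5 (ℚ.- 1ℚ) d)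

Contributes : ℕ → ℕ → Set
Contributes N p = Prime p × p ℕ.% 5 ≡ 1 × (p ∸ 1) ∣ N

contributes? : ∀ N p → Dec (Contributes N p)
contributes? N p = prime? p ×-dec (p ℕ.% 5 ≟ 1) ×-dec ((p ∸ 1) ∣? N)

-- For N > 0 the condition p - 1 ∣ N forces p < N + 2, so no prime is omitted.
contributingPrimes : ℕ → List ℕ
contributingPrimes N = filter (contributes? N) (upTo (2 ℕ.+ N))

A : ℕ → ℤ
A p = (-[1+ 0 ] ℤ.^ ((p ∸ 1) ℕ./ 10)) ℤ.* + (((p ∸ 1) ℕ./ 2) C ((p ∸ 1) ℕ./ 10))

-- a · A_p^{N/(p-1)} / p; the values at p = 0, 1 are junk.
fractionalTerm : (N : ℕ) (a : ℤ) (p : ℕ) → ℚ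
fractionalTerm N a p@(suc q@(suc _)) = (a ℤ.* A p ℤ.^ (N ℕ./ q)) ℚ./ p
fractionalTerm N a _                 = 0ℚ

{-# OPTIONS --safe #-}
module Submission where

-- Let s = x^(-1/2).  Then s′² = 1 - s¹⁰ and s″ = -5s⁹, so the coefficients of s,
-- and of every s^k/k!, with respect to uⁿ/n! are integers.  The series x + (1/s)′
-- and (6s⁻⁴ + (1/s)‴)/24, where s⁻⁴/4 = ∫ y du, have integral coefficients in the
-- same sense; hence C_N and 24 D_N are, up to N ℤ and 24N ℤ, minus the coefficient
-- of u^N/N! in u/s.  Integrating du = (1 - s¹⁰)^(-1/2) ds gives
--   u/s = Σ_k J_k/(10k + 1) · s^(10k)/(10k)!,   J_k = (10k)! binom(2k, k)/4^k ∈ ℤ.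
-- If 10k + 1 is composite, it divides J_k/24.  If p = 10k + 1 is prime, then modulo p
-- the p-th derivative is a derivation that commutes with d/du and satisfies the same
-- linear equation as d/du when applied to s; so it sends s to A s′ with a constant A.
-- It follows that the coefficients of s^(p-1)/(p-1)! are powers of A at the multiples
-- of p - 1 and 0 elsewhere.  Comparing coefficients in (1 - s¹⁰)^(-1/2) s′ = 1 gives
-- A ≡ -J_k, and this is A_p by Wilson's theorem.

-- The square root of x is never taken. `s` is constructed over the integers from s″ = -5s⁹, and x =
-- s⁻² is proved afterwards: z = s²x satisfies a nonlinear equation solved by z = 1, and the
-- difference z - 1 has no possible lowest term.
--
-- The corrected series are integral because 1 - s′ = s¹⁰/(1 + s′). The series (1 + s′)/2 has
-- integral coefficients and constant term 1, hence an integral inverse, and s¹⁰ outweighs the poles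
-- s⁻² and s⁻⁴; the remaining s⁸ and s⁶ are 8! and 6! times divided powers, which absorbs the
-- denominators.
--
-- D_N is only reached through 24 D_N, so J_k must be divided by 24 without spoiling its
-- divisibility by a composite 10k + 1. This works because J_k is 1 · 3 · 5 ⋯ (10k - 1) times a
-- cofactor containing 2 · 4 · 6 · 8 · 5: the odd product takes care of 10k + 1, the cofactor of 24.
-- A single sum `τ`, with J_k/24, then serves both formulas, C_N being recovered from 24 · (4!⁻¹ mod
-- p) ≡ 1 modulo p.
--
-- Expansions in powers of s occur only as finite truncations, exact up to the needed index.

-- Rings of formal series in the basis uⁿ/n!

module HurwitzSeries where

  open import Algebra.Bundles using (CommutativeRing)
  open import Algebra.Solver.Ring.AlmostCommutativeRing using (AlmostCommutativeRing; fromCommutativeRing; _-Raw-AlmostCommutative⟶_)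
  import Algebra.Solver.Ring
  import Algebra.Properties.Ring
  import Relation.Binary.Reasoning.Setoid
  open import Data.Maybe.Base as Maybe using (Maybe)
  open import Relation.Nullary.Decidable using (dec⇒maybe)
  open import Data.Nat.Base as ℕ using (ℕ; zero; suc; z≤n; s≤s)
  import Data.Nat.Properties as ℕ
  open import Data.Integer.Base as ℤ using (ℤ; +_)
  import Data.Integer.Properties as ℤ
  open import Data.Product.Base using (_,_)
  open import Data.Sum.Base using (inj₁; inj₂)
  open import Function.Base using (_∘_)
  open import Level using (0ℓ)
  open import Relation.Binary.PropositionalEquality as ≡ using (_≡_)

  -- A sequence f stands for the formal series Σ f(n) uⁿ/n!, whose derivative is
  -- the shift f ∘ suc; the product is determined by the Leibniz rule.  The
  -- operations are not bundled so that ℤ and ℤ/p give the same product and powers.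
  leibniz : {A : Set} (_+_ _*_ : A → A → A) → (ℕ → A) → (ℕ → A) → ℕ → A
  leibniz _+_ _*_ f g zero    = f 0 * g 0
  leibniz _+_ _*_ f g (suc n) = leibniz _+_ _*_ (f ∘ suc) g n + leibniz _+_ _*_ f (g ∘ suc) n

  scalar : {A : Set} (nil : A) → A → ℕ → A
  scalar nil a zero    = a
  scalar nil a (suc _) = nil

  power : {A : Set} (_*_ : A → A → A) (one : A) → A → ℕ → A
  power _*_ one x zero    = one
  power _*_ one x (suc k) = x * power _*_ one x k

  -- Instantiated with ℤ for integrality, with ℤ/p for the p-fold derivative and with ℚ for the
  -- expansions themselves. The map from ℤ lets the ring solver handle integer constants in all
  -- three.
  module Hurwitz
    (R : CommutativeRing 0ℓ 0ℓ)
    (ℤ⟶R : CommutativeRing.rawRing ℤ.+-*-commutativeRing -Raw-AlmostCommutative⟶ fromCommutativeRing R)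
    where

    private
      module R = CommutativeRing R
      module RP = Algebra.Properties.Ring R.ring
    open R using (Carrier) renaming (_+_ to _+ᴿ_; _*_ to _*ᴿ_; -_ to -ᴿ_; _≈_ to _≈ᴿ_; 0# to 0ᴿ; 1# to 1ᴿ)

    Series : Set
    Series = ℕ → Carrier

    infix 4 _≋_
    -- A record, so that f and g can be inferred from the type of a proof.
    record _≋_ (f g : Series) : Set where
      constructor pointwise
      field at : ∀ n → f n ≈ᴿ g n
    open _≋_ public

    D : Series → Series
    D f = f ∘ suc

    constant : Carrier → Series
    constant = scalar 0ᴿ

    infixl 6 _⊕_
    infixl 7 _⊛_
    _⊕_ _⊛_ : Series → Series → Series
    (f ⊕ g) n = f n +ᴿ g n
    _⊛_ = leibniz _+ᴿ_ _*ᴿ_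

    infixr 8 _^_
    _^_ : Series → ℕ → Series
    _^_ = power _⊛_ (constant 1ᴿ)

    ⊖_ : Series → Series
    (⊖ f) n = -ᴿ f n

    module ≈-Reasoning = Relation.Binary.Reasoning.Setoid R.setoid

    private
      ⊛-congₙ : ∀ {f f′ g g′} → f ≋ f′ → g ≋ g′ → ∀ n → (f ⊛ g) n ≈ᴿ (f′ ⊛ g′) n
      ⊛-congₙ p q zero    = R.*-cong (at p 0) (at q 0)
      ⊛-congₙ p q (suc n) = R.+-cong
        (⊛-congₙ (pointwise (at p ∘ suc)) q n) (⊛-congₙ p (pointwise (at q ∘ suc)) n)

      ⊛-commₙ : ∀ f g n → (f ⊛ g) n ≈ᴿ (g ⊛ f) n
      ⊛-commₙ f g zero    = R.*-comm _ _
      ⊛-commₙ f g (suc n) = R.trans (R.+-cong (⊛-commₙ (D f) g n) (⊛-commₙ f (D g) n)) (R.+-comm _ _)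

      interchange : ∀ a b c d → (a +ᴿ b) +ᴿ (c +ᴿ d) ≈ᴿ (a +ᴿ c) +ᴿ (b +ᴿ d)
      interchange a b c d = begin
        (a +ᴿ b) +ᴿ (c +ᴿ d)  ≈⟨ R.+-assoc a b _ ⟩
        a +ᴿ (b +ᴿ (c +ᴿ d))  ≈⟨ R.+-congˡ (R.+-assoc b c d) ⟨
        a +ᴿ ((b +ᴿ c) +ᴿ d)  ≈⟨ R.+-congˡ (R.+-congʳ (R.+-comm b c)) ⟩
        a +ᴿ ((c +ᴿ b) +ᴿ d)  ≈⟨ R.+-congˡ (R.+-assoc c b d) ⟩
        a +ᴿ (c +ᴿ (b +ᴿ d))  ≈⟨ R.+-assoc a c _ ⟨
        (a +ᴿ c) +ᴿ (b +ᴿ d)  ∎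
        where open ≈-Reasoning

      ⊛-distribˡₙ : ∀ f g h n → (f ⊛ (g ⊕ h)) n ≈ᴿ (f ⊛ g) n +ᴿ (f ⊛ h) n
      ⊛-distribˡₙ f g h zero    = R.distribˡ _ _ _
      ⊛-distribˡₙ f g h (suc n) = R.trans
        (R.+-cong (⊛-distribˡₙ (D f) g h n) (⊛-distribˡₙ f (D g) (D h) n)) (interchange _ _ _ _)

      ⊛-distribʳₙ : ∀ f g h n → ((g ⊕ h) ⊛ f) n ≈ᴿ (g ⊛ f) n +ᴿ (h ⊛ f) n
      ⊛-distribʳₙ f g h n = R.trans (⊛-commₙ (g ⊕ h) f n)
        (R.trans (⊛-distribˡₙ f g h n) (R.+-cong (⊛-commₙ f g n) (⊛-commₙ f h n)))

      -- By the Leibniz rule both sides become sums of three products with one factor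
      -- differentiated, so the induction hypothesis has to range over all series.
      ⊛-assocₙ : ∀ f g h n → ((f ⊛ g) ⊛ h) n ≈ᴿ (f ⊛ (g ⊛ h)) n
      ⊛-assocₙ f g h zero    = R.*-assoc _ _ _
      ⊛-assocₙ f g h (suc n) = begin
        ((D f ⊛ g ⊕ f ⊛ D g) ⊛ h) n +ᴿ ((f ⊛ g) ⊛ D h) n
          ≈⟨ R.+-congʳ (⊛-distribʳₙ h (D f ⊛ g) (f ⊛ D g) n) ⟩
        (((D f ⊛ g) ⊛ h) n +ᴿ ((f ⊛ D g) ⊛ h) n) +ᴿ ((f ⊛ g) ⊛ D h) n
          ≈⟨ R.+-cong (R.+-cong (⊛-assocₙ (D f) g h n) (⊛-assocₙ f (D g) h n)) (⊛-assocₙ f g (D h) n) ⟩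
        ((D f ⊛ (g ⊛ h)) n +ᴿ (f ⊛ (D g ⊛ h)) n) +ᴿ (f ⊛ (g ⊛ D h)) n
          ≈⟨ R.+-assoc _ _ _ ⟩
        (D f ⊛ (g ⊛ h)) n +ᴿ ((f ⊛ (D g ⊛ h)) n +ᴿ (f ⊛ (g ⊛ D h)) n)
          ≈⟨ R.+-congˡ (⊛-distribˡₙ f (D g ⊛ h) (g ⊛ D h) n) ⟨
        (D f ⊛ (g ⊛ h)) n +ᴿ (f ⊛ (D g ⊛ h ⊕ g ⊛ D h)) n ∎
        where open ≈-Reasoning

    ⊛-zeroˡ : ∀ {f} g n → (∀ i → f i ≈ᴿ 0ᴿ) → (f ⊛ g) n ≈ᴿ 0ᴿ
    ⊛-zeroˡ g zero    f≈0 = R.trans (R.*-congʳ (f≈0 0)) (R.zeroˡ _)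
    ⊛-zeroˡ g (suc n) f≈0 = R.trans
      (R.+-cong (⊛-zeroˡ g n (f≈0 ∘ suc)) (⊛-zeroˡ (D g) n f≈0)) (R.+-identityˡ 0ᴿ)

    constant-⊛ : ∀ a f n → (constant a ⊛ f) n ≈ᴿ a *ᴿ f n
    constant-⊛ a f zero    = R.refl
    constant-⊛ a f (suc n) = R.trans
      (R.+-cong (⊛-zeroˡ f n (λ _ → R.refl)) (constant-⊛ a (D f) n)) (R.+-identityˡ _)

    ring : CommutativeRing 0ℓ 0ℓ
    ring = record
      { Carrier = Series
      ; _≈_     = _≋_
      ; _+_     = _⊕_
      ; _*_     = _⊛_
      ; -_      = ⊖_
      ; 0#      = λ _ → 0ᴿ
      ; 1#      = constant 1ᴿ
      ; isCommutativeRing = record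
        { isRing = record
          { +-isAbelianGroup = record
            { isGroup = record
              { isMonoid = record
                { isSemigroup = record
                  { isMagma = record
                    { isEquivalence = record
                      { refl  = pointwise λ n → R.refl
                      ; sym   = λ p → pointwise λ n → R.sym (at p n)
                      ; trans = λ p q → pointwise λ n → R.trans (at p n) (at q n)
                      }
                    ; ∙-cong = λ p q → pointwise λ n → R.+-cong (at p n) (at q n)
                    }
                  ; assoc = λ f g h → pointwise λ n → R.+-assoc (f n) (g n) (h n)
                  }
                ; identity = (λ f → pointwise λ n → R.+-identityˡ (f n))
                           , (λ f → pointwise λ n → R.+-identityʳ (f n))
                }
              ; inverse = (λ f → pointwise λ n → R.-‿inverseˡ (f n))
                        , (λ f → pointwise λ n → R.-‿inverseʳ (f n))
              ; ⁻¹-cong = λ p → pointwise λ n → R.-‿cong (at p n)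
              }
            ; comm = λ f g → pointwise λ n → R.+-comm (f n) (g n)
            }
          ; *-cong     = λ p q → pointwise (⊛-congₙ p q)
          ; *-assoc    = λ f g h → pointwise (⊛-assocₙ f g h)
          ; *-identity = (λ f → pointwise λ n → R.trans (constant-⊛ 1ᴿ f n) (R.*-identityˡ _))
                       , (λ f → pointwise λ n → R.trans (⊛-commₙ f _ n)
                                                  (R.trans (constant-⊛ 1ᴿ f n) (R.*-identityˡ _)))
          ; distrib    = (λ f g h → pointwise (⊛-distribˡₙ f g h))
                       , (λ f g h → pointwise (⊛-distribʳₙ f g h))
          }
        ; *-comm = λ f g → pointwise (⊛-commₙ f g)
        }
      }

    almostRing : AlmostCommutativeRing 0ℓ 0ℓ
    almostRing = fromCommutativeRing ring

    open AlmostCommutativeRing almostRing public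
      using (refl; sym; trans)

    ⊕-cong : ∀ {f f′ g g′} → f ≋ f′ → g ≋ g′ → f ⊕ g ≋ f′ ⊕ g′
    ⊕-cong p q = AlmostCommutativeRing.+-cong almostRing p q

    ⊕-congˡ : ∀ f {g g′} → g ≋ g′ → f ⊕ g ≋ f ⊕ g′
    ⊕-congˡ f = ⊕-cong (refl {f})

    ⊕-congʳ : ∀ g {f f′} → f ≋ f′ → f ⊕ g ≋ f′ ⊕ g
    ⊕-congʳ g p = ⊕-cong p (refl {g})

    ⊛-cong : ∀ {f f′ g g′} → f ≋ f′ → g ≋ g′ → f ⊛ g ≋ f′ ⊛ g′
    ⊛-cong p q = AlmostCommutativeRing.*-cong almostRing p q

    ⊛-congˡ : ∀ {f g g′} → g ≋ g′ → f ⊛ g ≋ f ⊛ g′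
    ⊛-congˡ = ⊛-cong refl

    ⊛-congʳ : ∀ {f f′ g} → f ≋ f′ → f ⊛ g ≋ f′ ⊛ g
    ⊛-congʳ p = ⊛-cong p refl

    ⊖-cong : ∀ {f f′} → f ≋ f′ → ⊖ f ≋ ⊖ f′
    ⊖-cong = AlmostCommutativeRing.-‿cong almostRing

    ⊛-comm : ∀ f g → f ⊛ g ≋ g ⊛ f
    ⊛-comm = AlmostCommutativeRing.*-comm almostRing
    module ≋-Reasoning = Relation.Binary.Reasoning.Setoid (AlmostCommutativeRing.setoid almostRing)

    constant-cong : ∀ {a b} → a ≈ᴿ b → constant a ≋ constant b
    constant-cong p = pointwise λ { zero → p ; (suc n) → R.refl }

    constant-+ : ∀ a b → constant (a +ᴿ b) ≋ constant a ⊕ constant b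
    constant-+ a b = pointwise λ { zero → R.refl ; (suc n) → R.sym (R.+-identityˡ 0ᴿ) }

    constant-* : ∀ a b → constant (a *ᴿ b) ≋ constant a ⊛ constant b
    constant-* a b = pointwise λ n → R.sym (R.trans (constant-⊛ a (constant b) n) (times n))
      where
      times : ∀ n → a *ᴿ constant b n ≈ᴿ constant (a *ᴿ b) n
      times zero    = R.refl
      times (suc n) = R.zeroʳ a

    open _-Raw-AlmostCommutative⟶_ ℤ⟶R public using () renaming (⟦_⟧ to fromℤ; +-homo to fromℤ-+)
    private
      module ℤ⟶R = _-Raw-AlmostCommutative⟶_ ℤ⟶R

      ℤ⟶Series : CommutativeRing.rawRing ℤ.+-*-commutativeRing -Raw-AlmostCommutative⟶ almostRing
      ℤ⟶Series = record
        { ⟦_⟧    = constant ∘ fromℤ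
        ; +-homo = λ a b → trans (constant-cong (ℤ⟶R.+-homo a b)) (constant-+ _ _)
        ; *-homo = λ a b → trans (constant-cong (ℤ⟶R.*-homo a b)) (constant-* _ _)
        ; -‿homo = λ a → trans (constant-cong (ℤ⟶R.-‿homo a))
                     (pointwise λ { zero → R.refl ; (suc n) → R.sym RP.-0#≈0# })
        ; 0-homo = trans (constant-cong ℤ⟶R.0-homo) (pointwise λ { zero → R.refl ; (suc n) → R.refl })
        ; 1-homo = constant-cong ℤ⟶R.1-homo
        }

      equal? : ∀ a b → Maybe (constant (fromℤ a) ≋ constant (fromℤ b))
      equal? a b = Maybe.map (λ { ≡.refl → refl }) (dec⇒maybe (a ℤ.≟ b))

    module Solver = Algebra.Solver.Ring (CommutativeRing.rawRing ℤ.+-*-commutativeRing) almostRing ℤ⟶Series equal?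

    infixr 8 #_
    #_ : ℤ → Series
    # a = constant (fromℤ a)

    D-cong : ∀ {f g} → f ≋ g → D f ≋ D g
    D-cong p = pointwise (at p ∘ suc)

    -- `D` is a shift, so only the constant term is lost, in every characteristic. Several
    -- identities between series below are proved by this kind of integration.
    D-injective : ∀ {f g} → f 0 ≈ᴿ g 0 → D f ≋ D g → f ≋ g
    D-injective p q = pointwise λ { zero → p ; (suc n) → at q n }

    VanishBelow : ℕ → Series → Set
    VanishBelow n f = ∀ i → i ℕ.< n → f i ≈ᴿ 0ᴿ

    ⊛-vanish : ∀ f {g} n → VanishBelow n g → VanishBelow n (f ⊛ g)
    ⊛-vanish f {g} (suc n) v zero    _ = R.trans (R.*-congˡ (v 0 (s≤s z≤n))) (R.zeroʳ _)
    ⊛-vanish f {g} (suc n) v (suc i) (s≤s i<n) = R.trans (R.+-cong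
      (⊛-vanish (D f) {g} (suc n) v i (ℕ.m<n⇒m<1+n i<n))
      (⊛-vanish f {D g} n (λ j j<n → v (suc j) (s≤s j<n)) i i<n)) (R.+-identityˡ 0ᴿ)

    -- Only the term with all n derivatives on g survives, and its binomial coefficient is 1; no
    -- factor appears that could vanish modulo p.
    ⊛-leading : ∀ f {g} n → VanishBelow n g → (f ⊛ g) n ≈ᴿ f 0 *ᴿ g n
    ⊛-leading f {g} zero    v = R.refl
    ⊛-leading f {g} (suc n) v = R.trans (R.+-cong
      (⊛-vanish (D f) {g} (suc n) v n (ℕ.n<1+n n))
      (⊛-leading f {D g} n (λ j j<n → v (suc j) (s≤s j<n)))) (R.+-identityˡ _)

    vanish-extend : ∀ {f n} → VanishBelow n f → f n ≈ᴿ 0ᴿ → VanishBelow (suc n) f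
    vanish-extend v p i (s≤s i≤n) with ℕ.m≤n⇒m<n∨m≡n i≤n
    ... | inj₁ i<n = v i i<n
    ... | inj₂ ≡.refl = p

    vanish-all : ∀ {f} → (∀ n → VanishBelow n f → f n ≈ᴿ 0ᴿ) → ∀ n → f n ≈ᴿ 0ᴿ
    vanish-all {f} step n = below (suc n) n (ℕ.n<1+n n)
      where
      below : ∀ n → VanishBelow n f
      below (suc n) = vanish-extend (below n) (step n (below n))

    -- Uniqueness for a linear equation of first order: at the first index in question the right
    -- side still vanishes, while the left side is f 0 times the next coefficient of e. Cancelling f
    -- 0 suffices, so the lemma serves both ℤ and ℤ/p.
    linear-ode : ∀ {f h e} → (∀ a → f 0 *ᴿ a ≈ᴿ 0ᴿ → a ≈ᴿ 0ᴿ) → e 0 ≈ᴿ 0ᴿ →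
                 f ⊛ D e ≋ h ⊛ e → ∀ n → e n ≈ᴿ 0ᴿ
    linear-ode {f} {h} {e} cancel e₀ eq = vanish-all step
      where
      open ≈-Reasoning
      step : ∀ n → VanishBelow n e → e n ≈ᴿ 0ᴿ
      step zero    v = e₀
      step (suc n) v = cancel (e (suc n)) (begin
        f 0 *ᴿ D e n         ≈⟨ ⊛-leading f {D e} n (λ j j<n → v (suc j) (s≤s j<n)) ⟨
        (f ⊛ D e) n          ≈⟨ at eq n ⟩
        (h ⊛ e) n            ≈⟨ ⊛-vanish h {e} (suc n) v n (ℕ.n<1+n n) ⟩
        0ᴿ                   ∎)

    D-constant-⊛ : ∀ a f → D (constant a ⊛ f) ≋ constant a ⊛ D f
    D-constant-⊛ a f = pointwise λ n → R.trans
      (R.+-congʳ (⊛-zeroˡ f n (λ _ → R.refl))) (R.+-identityˡ _)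

    -- Stated for any derivation because it is applied to `D` and, modulo p, to the p-fold
    -- derivative.
    derivation-^ : (δ : Series → Series) → (∀ f g → δ (f ⊛ g) ≋ δ f ⊛ g ⊕ f ⊛ δ g) →
                   δ (constant 1ᴿ) ≋ (λ _ → 0ᴿ) →
                   ∀ f k → δ (f ^ suc k) ≋ # (+ suc k) ⊛ (f ^ k ⊛ δ f)
    derivation-^ δ δ-⊛ δ-1 f zero    = begin
      δ (f ⊛ constant 1ᴿ)
        ≈⟨ δ-⊛ f (constant 1ᴿ) ⟩
      δ f ⊛ constant 1ᴿ ⊕ f ⊛ δ (constant 1ᴿ)
        ≈⟨ ⊕-congˡ _ (trans (⊛-congˡ δ-1) (AlmostCommutativeRing.zeroʳ almostRing f)) ⟩
      δ f ⊛ constant 1ᴿ ⊕ (λ _ → 0ᴿ)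
        ≈⟨ ⊕-congʳ _ (⊛-congˡ (constant-cong ℤ⟶R.1-homo)) ⟨
      δ f ⊛ # (+ 1) ⊕ (λ _ → 0ᴿ)
        ≈⟨ AlmostCommutativeRing.+-identityʳ almostRing _ ⟩
      δ f ⊛ # (+ 1)
        ≈⟨ solve 1 (λ d → d :* con (+ 1) := con (+ 1) :* (con (+ 1) :* d)) refl (δ f) ⟩
      # (+ 1) ⊛ (# (+ 1) ⊛ δ f)
        ≈⟨ ⊛-congˡ (⊛-congʳ (constant-cong ℤ⟶R.1-homo)) ⟩
      # (+ 1) ⊛ (constant 1ᴿ ⊛ δ f) ∎
      where
      open ≋-Reasoning
      open Solver
    derivation-^ δ δ-⊛ δ-1 f (suc k) = begin
      δ (f ⊛ f ^ suc k)
        ≈⟨ δ-⊛ f (f ^ suc k) ⟩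
      δ f ⊛ f ^ suc k ⊕ f ⊛ δ (f ^ suc k)
        ≈⟨ ⊕-congˡ _ (⊛-congˡ (derivation-^ δ δ-⊛ δ-1 f k)) ⟩
      δ f ⊛ f ^ suc k ⊕ f ⊛ (# c ⊛ (f ^ k ⊛ δ f))
        ≈⟨ solve 4 (λ f p d c → d :* (f :* p) :+ f :* (c :* (p :* d)) := (con (+ 1) :+ c) :* (f :* p :* d))
             refl f (f ^ k) (δ f) (# c) ⟩
      (# (+ 1) ⊕ # c) ⊛ (f ^ suc k ⊛ δ f)
        ≈⟨ ⊛-congʳ (trans (constant-cong (fromℤ-+ (+ 1) c)) (constant-+ _ _)) ⟨
      # (+ suc (suc k)) ⊛ (f ^ suc k ⊛ δ f) ∎
      where
      open ≋-Reasoning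
      open Solver
      c = + suc k

    D-^ : ∀ f k → D (f ^ suc k) ≋ # (+ suc k) ⊛ (f ^ k ⊛ D f)
    D-^ = derivation-^ D (λ _ _ → refl) refl

    ⊛-local : ∀ {f f′ g g′} n → (∀ i → i ℕ.≤ n → f i ≈ᴿ f′ i) → (∀ i → i ℕ.≤ n → g i ≈ᴿ g′ i) →
              (f ⊛ g) n ≈ᴿ (f′ ⊛ g′) n
    ⊛-local zero    p q = R.*-cong (p 0 z≤n) (q 0 z≤n)
    ⊛-local (suc n) p q = R.+-cong
      (⊛-local n (λ i i≤n → p (suc i) (s≤s i≤n)) (λ i i≤n → q i (ℕ.m≤n⇒m≤1+n i≤n)))
      (⊛-local n (λ i i≤n → p i (ℕ.m≤n⇒m≤1+n i≤n)) (λ i i≤n → q (suc i) (s≤s i≤n)))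

    ^-local : ∀ {f f′} k n → (∀ i → i ℕ.≤ n → f i ≈ᴿ f′ i) → (f ^ k) n ≈ᴿ (f′ ^ k) n
    ^-local zero    n p = R.refl
    ^-local (suc k) n p = ⊛-local n p (λ i i≤n → ^-local k i (λ j j≤i → p j (ℕ.≤-trans j≤i i≤n)))

    -- A map whose n-th coefficient depends only on the coefficients below n has
    -- a fixed point: iterating n + 1 times settles the n-th coefficient.
    module FixedPoint (Φ : Series → Series)
      (causal : ∀ n {f g} → (∀ i → i ℕ.< n → f i ≈ᴿ g i) → Φ f n ≈ᴿ Φ g n) where

      private
        iterate : ℕ → Series
        iterate zero    = λ _ → 0ᴿ
        iterate (suc k) = Φ (iterate k)

      fixed : Series
      fixed n = iterate (suc n) n

      private
        -- The bound b drives the induction: two iterates past stage n apply Φ to arguments that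
        -- already agree below n.
        settled : ∀ b n → n ℕ.< b → ∀ k → n ℕ.< k → iterate k n ≈ᴿ fixed n
        settled (suc b) n (s≤s n≤b) (suc k) (s≤s n≤k) = causal n λ i i<n → R.trans
          (settled b i (ℕ.<-≤-trans i<n n≤b) k (ℕ.<-≤-trans i<n n≤k))
          (R.sym (settled b i (ℕ.<-≤-trans i<n n≤b) n i<n))

      isFixed : ∀ n → fixed n ≈ᴿ Φ fixed n
      isFixed n = causal n λ i i<n → settled (suc i) i (ℕ.n<1+n i) n i<n

-- Divided powers and the series s

module DividedPowers where

  open HurwitzSeries
  open import Data.Integer.Base as ℤ using (ℤ; +_; -[1+_])
  import Data.Integer.Properties as ℤ
  open import Data.Nat.Base as ℕ using (ℕ; zero; suc; s≤s)
  import Data.Nat.Properties as ℕ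
  open import Relation.Binary.PropositionalEquality as ≡ using (_≡_)
  open import Algebra.Solver.Ring.AlmostCommutativeRing using (fromCommutativeRing; -raw-almostCommutative⟶)

  module Hℤ = Hurwitz ℤ.+-*-commutativeRing (-raw-almostCommutative⟶ (fromCommutativeRing ℤ.+-*-commutativeRing))
  open Hℤ hiding (module Solver)

  -- This is f^k/k! when f has constant term 0, obtained by integrating f′ f^(k-1)/(k-1)!.
  -- Integration is an index shift, so the coefficients are integers by construction.
  γ : ℕ → Series → Series
  γ zero    f         = # (+ 1)
  γ (suc k) f zero    = + 0
  γ (suc k) f (suc n) = (γ k f ⊛ D f) n

  ⊛-γ : ∀ f → f 0 ≡ + 0 → ∀ k → f ⊛ γ k f ≋ # (+ suc k) ⊛ γ (suc k) f
  ⊛-γ f f₀ zero = D-injective (≡.cong (ℤ._* + 1) f₀) (begin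
    D (f ⊛ # (+ 1))                      ≈⟨ D-cong (⊛-comm f (# (+ 1))) ⟩
    D (# (+ 1) ⊛ f)                      ≈⟨ D-constant-⊛ (+ 1) f ⟩
    # (+ 1) ⊛ D f                        ≈⟨ solve 1 (λ d → con (+ 1) :* d := con (+ 1) :* (con (+ 1) :* d)) refl (D f) ⟩
    # (+ 1) ⊛ (# (+ 1) ⊛ D f)     ≈⟨ D-constant-⊛ (+ 1) (γ 1 f) ⟨
    D (# (+ 1) ⊛ γ 1 f)                  ∎)
    where
    open ≋-Reasoning
    open Hℤ.Solver
  ⊛-γ f f₀ (suc k) = D-injective
    (≡.trans (≡.cong (ℤ._* + 0) f₀) (≡.sym (ℤ.*-zeroʳ (+ suc (suc k))))) (begin
    D f ⊛ g ⊕ f ⊛ (γ k f ⊛ D f)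
      ≈⟨ solve 4 (λ f d g h → d :* g :+ f :* (h :* d) := d :* g :+ (f :* h) :* d) refl f (D f) g (γ k f) ⟩
    D f ⊛ g ⊕ (f ⊛ γ k f) ⊛ D f
      ≈⟨ ⊕-congˡ (D f ⊛ g) (⊛-congʳ (⊛-γ f f₀ k)) ⟩
    D f ⊛ g ⊕ (# (+ suc k) ⊛ g) ⊛ D f
      ≈⟨ solve 3 (λ d g c → d :* g :+ (c :* g) :* d := (con (+ 1) :+ c) :* (g :* d)) refl (D f) g (# (+ suc k)) ⟩
    (# (+ 1) ⊕ # (+ suc k)) ⊛ (g ⊛ D f)
      ≈⟨ ⊛-congʳ (pointwise λ { zero → ≡.refl ; (suc n) → ≡.refl }) ⟩
    # (+ suc (suc k)) ⊛ (g ⊛ D f)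
      ≈⟨ D-constant-⊛ (+ suc (suc k)) (γ (suc (suc k)) f) ⟨
    D (# (+ suc (suc k)) ⊛ γ (suc (suc k)) f) ∎)
    where
    open ≋-Reasoning
    open Hℤ.Solver
    g = γ (suc k) f

  -- (k + 1)(k + 2)⋯(k + m)
  rising : ℕ → ℕ → ℕ
  rising k zero    = 1
  rising k (suc m) = suc (m ℕ.+ k) ℕ.* rising k m

  ^-⊛-γ : ∀ f → f 0 ≡ + 0 → ∀ m k → f ^ m ⊛ γ k f ≋ # (+ rising k m) ⊛ γ (m ℕ.+ k) f
  ^-⊛-γ f f₀ zero    k = refl
  ^-⊛-γ f f₀ (suc m) k = begin
    f ⊛ f ^ m ⊛ γ k f                              ≈⟨ solve 3 (λ a b c → a :* b :* c := a :* (b :* c)) refl f (f ^ m) (γ k f) ⟩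
    f ⊛ (f ^ m ⊛ γ k f)                            ≈⟨ ⊛-congˡ (^-⊛-γ f f₀ m k) ⟩
    f ⊛ (# r ⊛ γ (m ℕ.+ k) f)               ≈⟨ solve 3 (λ a b c → a :* (b :* c) := b :* (a :* c)) refl f (# r) (γ (m ℕ.+ k) f) ⟩
    # r ⊛ (f ⊛ γ (m ℕ.+ k) f)               ≈⟨ ⊛-congˡ (⊛-γ f f₀ (m ℕ.+ k)) ⟩
    # r ⊛ (# c ⊛ g)                  ≈⟨ solve 3 (λ a b c → a :* (b :* c) := b :* a :* c) refl (# r) (# c) g ⟩
    # c ⊛ # r ⊛ g                    ≈⟨ ⊛-congʳ (constant-* c r) ⟨
    # (c ℤ.* r) ⊛ g                         ≡⟨ ≡.cong (λ a → # a ⊛ g) (≡.sym (ℤ.pos-* (suc (m ℕ.+ k)) (rising k m))) ⟩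
    # (+ rising k (suc m)) ⊛ g              ∎
    where
    open ≋-Reasoning
    open Hℤ.Solver
    r = + rising k m
    c = + suc (m ℕ.+ k)
    g = γ (suc m ℕ.+ k) f

  γ-vanish : ∀ f k → VanishBelow k (γ k f)
  γ-vanish f (suc k) zero    _         = ≡.refl
  γ-vanish f (suc k) (suc i) (s≤s i<k) = ≡.trans (at (⊛-comm (γ k f) (D f)) i)
    (⊛-vanish (D f) {γ k f} k (γ-vanish f k) i i<k)

  γ-leading : ∀ f → f 1 ≡ + 1 → ∀ k → γ k f k ≡ + 1
  γ-leading f f₁ zero = ≡.refl
  γ-leading f f₁ (suc k) = ≡.trans (at (⊛-comm (γ k f) (D f)) k)
    (≡.trans (⊛-leading (D f) {γ k f} k (γ-vanish f k)) (≡.cong₂ ℤ._*_ f₁ (γ-leading f f₁ k)))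

  -- s = x^(-1/2), the solution of s′² = 1 - s¹⁰
  module _ where
    private
      Φ : Series → Series
      Φ f zero          = + 0
      Φ f (suc zero)    = + 1
      Φ f (suc (suc n)) = -[1+ 4 ] ℤ.* (f ^ 9) n

      causal : ∀ n {f g} → (∀ i → i ℕ.< n → f i ≡ g i) → Φ f n ≡ Φ g n
      causal zero          p = ≡.refl
      causal (suc zero)    p = ≡.refl
      causal (suc (suc n)) p = ≡.cong (-[1+ 4 ] ℤ.*_) (^-local 9 n (λ i i≤n → p i (s≤s (ℕ.m≤n⇒m≤1+n i≤n))))

      open FixedPoint Φ causal

    -- From here on only the initial values and the differential equation are visible; unfolding the
    -- iteration would expand ninth powers.
    abstract
      s : Series
      s = fixed

      s₀ : s 0 ≡ + 0
      s₀ = isFixed 0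

      s₁ : s 1 ≡ + 1
      s₁ = isFixed 1

      s″ : D (D s) ≋ # -[1+ 4 ] ⊛ s ^ 9
      s″ = pointwise λ n → ≡.trans (isFixed (suc (suc n))) (≡.sym (constant-⊛ -[1+ 4 ] (s ^ 9) n))

  -- First integral of s″ = -5s⁹: the derivative 2s′s″ + 10s⁹s′ is 0, and the value at u = 0 is 1.
  s′² : D s ^ 2 ⊕ s ^ 10 ≋ # (+ 1)
  s′² = D-injective initial (begin
    D (D s ^ 2) ⊕ D (s ^ 10)
      ≈⟨ ⊕-cong (D-^ (D s) 1) (D-^ s 9) ⟩
    # (+ 2) ⊛ (D s ^ 1 ⊛ D (D s)) ⊕ # (+ 10) ⊛ (s ^ 9 ⊛ D s)
      ≈⟨ ⊕-congʳ (# (+ 10) ⊛ (s ^ 9 ⊛ D s)) (⊛-congˡ (⊛-congˡ s″)) ⟩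
    # (+ 2) ⊛ (D s ^ 1 ⊛ (# -[1+ 4 ] ⊛ s ^ 9)) ⊕ # (+ 10) ⊛ (s ^ 9 ⊛ D s)
      ≈⟨ solve 2 (λ s d → con (+ 2) :* (d :^ 1 :* (con -[1+ 4 ] :* s :^ 9)) :+ con (+ 10) :* (s :^ 9 :* d)
                       := con (+ 0)) refl s (D s) ⟩
    # (+ 0)
      ≈⟨ pointwise (λ { zero → ≡.refl ; (suc n) → ≡.refl }) ⟩
    D (# (+ 1)) ∎)
    where
    open ≋-Reasoning
    open Hℤ.Solver
    initial : (D s ^ 2 ⊕ s ^ 10) 0 ≡ + 1
    initial rewrite s₁ | s₀ = ≡.refl

-- Truncated expansion of 1/s′ in powers of s; the integral remainders for x and y

module InverseExpansion where

  open HurwitzSeries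
  open DividedPowers
  open import Data.Integer.Base as ℤ using (ℤ; +_; -[1+_])
  import Data.Integer.Properties as ℤ
  import Data.Nat.Solver
  open import Data.Nat.Base as ℕ using (ℕ; zero; suc; s≤s)
  import Data.Nat.Properties as ℕ
  open import Relation.Binary.PropositionalEquality as ≡ using (_≡_)
  open Hℤ hiding (module Solver)

  -- (10k)! times the coefficient of s^(10k) in (1 - s¹⁰)^(-1/2)
  J : ℕ → ℕ
  J zero    = 1
  J (suc k) = 5 ℕ.* (2 ℕ.* k ℕ.+ 1) ℕ.* (rising (k ℕ.* 10) 9 ℕ.* J k)

  -- the truncation of (1 - s¹⁰)^(-1/2), the inverse of s′
  E : ℕ → Series
  E zero    = # (+ 1)
  E (suc K) = E K ⊕ # (+ J (suc K)) ⊛ γ (suc K ℕ.* 10) s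

  -- Telescoping. With m = 10K + 10, the new term of `E` contributes J times s″ s^m/m! + s′²
  -- s^(m-1)/(m-1)!. In s′² = 1 - s¹⁰ the 1 cancels the previous error; the rest is -(m + 5) s⁹
  -- s^m/m!, because s · s^(m-1)/(m-1)! = m s^m/m!. Since m + 5 = 5(2(K + 1) + 1), and `rising`
  -- turns s⁹ s^m/m! into a divided power, the recursion of `J` is exactly what makes the error keep
  -- its form.
  D-s′E : ∀ K → D (D s ⊛ E K) ≋ ⊖ (# (+ J (suc K)) ⊛ γ (9 ℕ.+ K ℕ.* 10) s)
  D-s′E zero = begin
    D (D s ⊛ # (+ 1))
      ≈⟨ D-cong (⊛-comm (D s) (# (+ 1))) ⟩
    D (# (+ 1) ⊛ D s)
      ≈⟨ D-constant-⊛ (+ 1) (D s) ⟩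
    # (+ 1) ⊛ D (D s)
      ≈⟨ ⊛-congˡ s″ ⟩
    # (+ 1) ⊛ (# -[1+ 4 ] ⊛ s ^ 9)
      ≈⟨ solve 1 (λ p → con (+ 1) :* (con -[1+ 4 ] :* p) := con -[1+ 4 ] :* (p :* con (+ 1))) refl (s ^ 9) ⟩
    # -[1+ 4 ] ⊛ (s ^ 9 ⊛ γ 0 s)
      ≈⟨ ⊛-congˡ (^-⊛-γ s s₀ 9 0) ⟩
    # -[1+ 4 ] ⊛ (# (+ rising 0 9) ⊛ γ 9 s)
      ≈⟨ solve 1 (λ g → con -[1+ 4 ] :* (con (+ 362880) :* g) := :- (con (+ 1814400) :* g)) refl (γ 9 s) ⟩
    ⊖ (# (+ J 1) ⊛ γ 9 s) ∎
    where
    open ≋-Reasoning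
    open Hℤ.Solver
  D-s′E (suc K) = begin
    D (D s ⊛ (E K ⊕ # c ⊛ γ (10 ℕ.+ j) s))
      ≈⟨ D-cong (solve 4 (λ d e c g → d :* (e :+ c :* g) := d :* e :+ c :* (d :* g)) refl (D s) (E K) (# c) G₁) ⟩
    D (D s ⊛ E K) ⊕ D (# c ⊛ (D s ⊛ G₁))
      ≈⟨ ⊕-cong (D-s′E K) (D-constant-⊛ c (D s ⊛ G₁)) ⟩
    ⊖ (# c ⊛ G) ⊕ # c ⊛ (D (D s) ⊛ G₁ ⊕ D s ⊛ (G ⊛ D s))
      ≈⟨ ⊕-congˡ (⊖ (# c ⊛ G)) (⊛-congˡ (⊕-congʳ (D s ⊛ (G ⊛ D s)) (⊛-congʳ s″))) ⟩
    ⊖ (# c ⊛ G) ⊕ # c ⊛ ((# -[1+ 4 ] ⊛ s ^ 9) ⊛ G₁ ⊕ D s ⊛ (G ⊛ D s))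
      ≈⟨ solve 5 (λ s d c g h → :- (c :* g) :+ c :* ((con -[1+ 4 ] :* s :^ 9) :* h :+ d :* (g :* d))
                   := :- (c :* g) :+ c :* ((con -[1+ 4 ] :* s :^ 9) :* h :+ (g :* (d :^ 2 :+ s :^ 10) :- s :^ 9 :* (s :* g))))
           refl s (D s) (# c) G G₁ ⟩
    ⊖ (# c ⊛ G) ⊕ # c ⊛ ((# -[1+ 4 ] ⊛ s ^ 9) ⊛ G₁ ⊕ (G ⊛ (D s ^ 2 ⊕ s ^ 10) ⊕ ⊖ (s ^ 9 ⊛ (s ⊛ G))))
      ≈⟨ ⊕-congˡ (⊖ (# c ⊛ G)) (⊛-congˡ (⊕-congˡ ((# -[1+ 4 ] ⊛ s ^ 9) ⊛ G₁)
           (⊕-cong (⊛-congˡ {G} s′²) (⊖-cong (⊛-congˡ {s ^ 9} (⊛-γ s s₀ (9 ℕ.+ j))))))) ⟩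
    ⊖ (# c ⊛ G) ⊕ # c ⊛ ((# -[1+ 4 ] ⊛ s ^ 9) ⊛ G₁ ⊕ (G ⊛ # (+ 1) ⊕ ⊖ (s ^ 9 ⊛ (# t ⊛ G₁))))
      ≈⟨ solve 5 (λ p c g h t → :- (c :* g) :+ c :* ((con -[1+ 4 ] :* p) :* h :+ (g :* con (+ 1) :- p :* (t :* h)))
                   := :- ((con (+ 5) :+ t) :* c :* (p :* h)))
           refl (s ^ 9) (# c) G G₁ (# t) ⟩
    ⊖ ((# (+ 5) ⊕ # t) ⊛ # c ⊛ (s ^ 9 ⊛ G₁))
      ≈⟨ ⊖-cong (⊛-cong (⊛-congʳ (sym (constant-+ (+ 5) t))) (^-⊛-γ s s₀ 9 (10 ℕ.+ j))) ⟩
    ⊖ (# (+ 5 ℤ.+ t) ⊛ # c ⊛ (# ρ ⊛ G₂))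
      ≈⟨ ⊖-cong (solve 4 (λ a c r g → a :* c :* (r :* g) := a :* (r :* c) :* g) refl (# (+ 5 ℤ.+ t)) (# c) (# ρ) G₂) ⟩
    ⊖ (# (+ 5 ℤ.+ t) ⊛ (# ρ ⊛ # c) ⊛ G₂)
      ≈⟨ ⊖-cong (⊛-congʳ (trans (⊛-congˡ (sym (constant-* ρ c))) (sym (constant-* (+ 5 ℤ.+ t) (ρ ℤ.* c))))) ⟩
    ⊖ (# ((+ 5 ℤ.+ t) ℤ.* (ρ ℤ.* c)) ⊛ G₂)
      ≡⟨ ≡.cong (λ a → ⊖ (# a ⊛ G₂)) coefficient ⟩
    ⊖ (# (+ J (suc (suc K))) ⊛ G₂) ∎
    where
    open ≋-Reasoning
    open Hℤ.Solver
    j = K ℕ.* 10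
    c = + J (suc K)
    t = + (10 ℕ.+ j)
    ρ = + rising (10 ℕ.+ j) 9
    G = γ (9 ℕ.+ j) s
    G₁ = γ (10 ℕ.+ j) s
    G₂ = γ (19 ℕ.+ j) s
    factor : ∀ K → 15 ℕ.+ K ℕ.* 10 ≡ 5 ℕ.* (2 ℕ.* suc K ℕ.+ 1)
    factor = S.solve 1 (λ K → S.con 15 S.:+ K S.:* S.con 10 S.:= S.con 5 S.:* (S.con 2 S.:* (S.con 1 S.:+ K) S.:+ S.con 1)) ≡.refl
      where module S = Data.Nat.Solver.+-*-Solver
    coefficient : (+ 5 ℤ.+ t) ℤ.* (ρ ℤ.* c) ≡ + J (suc (suc K))
    coefficient = ≡.trans (≡.cong₂ ℤ._*_ (≡.cong +_ (factor K)) (≡.sym (ℤ.pos-* (rising (10 ℕ.+ j) 9) (J (suc K)))))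
      (≡.sym (ℤ.pos-* (5 ℕ.* (2 ℕ.* suc K ℕ.+ 1)) (rising (10 ℕ.+ j) 9 ℕ.* J (suc K))))

  s′E-vanish : ∀ K i → i ℕ.< 9 ℕ.+ K ℕ.* 10 → (D s ⊛ E K) (suc i) ≡ + 0
  s′E-vanish K i i< = ≡.trans (at (D-s′E K) i) (≡.cong ℤ.-_
    (⊛-vanish (# (+ J (suc K))) {γ (9 ℕ.+ K ℕ.* 10) s} _ (γ-vanish s (9 ℕ.+ K ℕ.* 10)) i i<))

  E₀ : ∀ K → E K 0 ≡ + 1
  E₀ zero    = ≡.refl
  E₀ (suc K) = ≡.cong₂ ℤ._+_ (E₀ K) (ℤ.*-zeroʳ (+ J (suc K)))

  -- Inverses of series with constant term 1, from v′ = - v² r′.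
  module Inverse (r : Series) (r₀ : r 0 ≡ + 1) where
    private
      Φ : Series → Series
      Φ v zero    = + 1
      Φ v (suc n) = ℤ.- (v ⊛ v ⊛ D r) n

      causal : ∀ n {f g} → (∀ i → i ℕ.< n → f i ≡ g i) → Φ f n ≡ Φ g n
      causal zero    p = ≡.refl
      causal (suc n) p = ≡.cong ℤ.-_ (⊛-local n
        (λ i i≤n → ⊛-local i (λ j j≤i → p j (s≤s (ℕ.≤-trans j≤i i≤n))) (λ j j≤i → p j (s≤s (ℕ.≤-trans j≤i i≤n))))
        (λ _ _ → ≡.refl))

      open FixedPoint Φ causal

    abstract
      inverse : Series
      inverse = fixed

      inverse₀ : inverse 0 ≡ + 1
      inverse₀ = isFixed 0

      D-inverse : D inverse ≋ ⊖ (inverse ⊛ inverse ⊛ D r)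
      D-inverse = pointwise λ n → isFixed (suc n)

    -- The defect e = v r - 1 vanishes at u = 0 and satisfies e′ = -(v r′) e by v′ = -v² r′;
    -- uniqueness for this linear equation gives e = 0.
    inverse-⊛ : inverse ⊛ r ≋ # (+ 1)
    inverse-⊛ = begin
      v ⊛ r                  ≈⟨ solve 1 (λ z → z := con (+ 1) :+ (z :- con (+ 1))) refl (v ⊛ r) ⟩
      # (+ 1) ⊕ e            ≈⟨ ⊕-congˡ (# (+ 1)) (pointwise (linear-ode {# (+ 1)} {⊖ (v ⊛ D r)} {e} (λ a p → ≡.trans (≡.sym (ℤ.*-identityˡ a)) p) e₀ ode)) ⟩
      # (+ 1) ⊕ (λ _ → + 0)  ≈⟨ pointwise (λ n → ℤ.+-identityʳ _) ⟩
      # (+ 1)                ∎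
      where
      open ≋-Reasoning
      open Hℤ.Solver
      v = inverse
      e = v ⊛ r ⊕ ⊖ (# (+ 1))
      e₀ : e 0 ≡ + 0
      e₀ rewrite inverse₀ | r₀ = ≡.refl
      ode : # (+ 1) ⊛ D e ≋ ⊖ (v ⊛ D r) ⊛ e
      ode = begin
        # (+ 1) ⊛ (D v ⊛ r ⊕ v ⊛ D r ⊕ (λ _ → + 0))
          ≈⟨ ⊛-congˡ (⊕-cong (⊕-congʳ (v ⊛ D r) (⊛-congʳ {g = r} D-inverse)) (pointwise λ { zero → ≡.refl ; (suc n) → ≡.refl })) ⟩
        # (+ 1) ⊛ (⊖ (v ⊛ v ⊛ D r) ⊛ r ⊕ v ⊛ D r ⊕ # (+ 0))
          ≈⟨ solve 3 (λ v r r′ → con (+ 1) :* (:- (v :* v :* r′) :* r :+ v :* r′ :+ con (+ 0))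
                       := :- (v :* r′) :* (v :* r :- con (+ 1))) refl v r (D r) ⟩
        ⊖ (v ⊛ D r) ⊛ e ∎

  -- (1 + s′)/2; the coefficient is 5 · 9!/2.
  half : Series
  half zero    = + 1
  half (suc n) = -[1+ 907199 ] ℤ.* γ 9 s n

  2half : # (+ 2) ⊛ half ≋ # (+ 1) ⊕ D s
  2half = D-injective (≡.cong (ℤ._+_ (+ 1)) (≡.sym s₁)) (begin
    D (# (+ 2) ⊛ half)                     ≈⟨ D-constant-⊛ (+ 2) half ⟩
    # (+ 2) ⊛ D half                       ≈⟨ ⊛-congˡ (pointwise λ n → ≡.sym (constant-⊛ -[1+ 907199 ] (γ 9 s) n)) ⟩
    # (+ 2) ⊛ (# -[1+ 907199 ] ⊛ γ 9 s) ≈⟨ solve 1 (λ g → con (+ 2) :* (con -[1+ 907199 ] :* g) := con -[1+ 4 ] :* (con (+ 362880) :* g)) refl (γ 9 s) ⟩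
    # -[1+ 4 ] ⊛ (# (+ 362880) ⊛ γ 9 s) ≈⟨ ⊛-congˡ (^-⊛-γ s s₀ 9 0) ⟨
    # -[1+ 4 ] ⊛ (s ^ 9 ⊛ # (+ 1))      ≈⟨ solve 1 (λ p → con -[1+ 4 ] :* (p :* con (+ 1)) := con -[1+ 4 ] :* p) refl (s ^ 9) ⟩
    # -[1+ 4 ] ⊛ s ^ 9                  ≈⟨ s″ ⟨
    D (D s)                             ≈⟨ pointwise (λ n → ≡.sym (ℤ.+-identityˡ _)) ⟩
    D (# (+ 1) ⊕ D s)                   ∎)
    where
    open ≋-Reasoning
    open Hℤ.Solver

  open Inverse half ≡.refl using () renaming (inverse to half⁻¹; inverse-⊛ to half⁻¹-⊛)

  -- s¹⁰/half = 2 (1 - s′), because s¹⁰ = (1 - s′)(1 + s′)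
  s¹⁰half⁻¹ : s ^ 10 ⊛ half⁻¹ ≋ # (+ 2) ⊛ (# (+ 1) ⊕ ⊖ D s)
  s¹⁰half⁻¹ = begin
    s ^ 10 ⊛ half⁻¹
      ≈⟨ solve 3 (λ s d q → s :^ 10 :* q := ((d :^ 2 :+ s :^ 10) :- d :^ 2) :* q) refl s (D s) half⁻¹ ⟩
    ((D s ^ 2 ⊕ s ^ 10) ⊕ ⊖ (D s ^ 2)) ⊛ half⁻¹
      ≈⟨ ⊛-congʳ (⊕-congʳ (⊖ (D s ^ 2)) s′²) ⟩
    (# (+ 1) ⊕ ⊖ (D s ^ 2)) ⊛ half⁻¹
      ≈⟨ solve 2 (λ d q → (con (+ 1) :- d :^ 2) :* q := (con (+ 1) :+ d) :* ((con (+ 1) :- d) :* q)) refl (D s) half⁻¹ ⟩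
    (# (+ 1) ⊕ D s) ⊛ ((# (+ 1) ⊕ ⊖ D s) ⊛ half⁻¹)
      ≈⟨ ⊛-congʳ 2half ⟨
    # (+ 2) ⊛ half ⊛ ((# (+ 1) ⊕ ⊖ D s) ⊛ half⁻¹)
      ≈⟨ solve 3 (λ r d q → con (+ 2) :* r :* ((con (+ 1) :- d) :* q) := con (+ 2) :* ((q :* r) :* (con (+ 1) :- d))) refl half (D s) half⁻¹ ⟩
    # (+ 2) ⊛ ((half⁻¹ ⊛ half) ⊛ (# (+ 1) ⊕ ⊖ D s))
      ≈⟨ ⊛-congˡ (⊛-congʳ half⁻¹-⊛) ⟩
    # (+ 2) ⊛ (# (+ 1) ⊛ (# (+ 1) ⊕ ⊖ D s))
      ≈⟨ solve 1 (λ d → con (+ 2) :* (con (+ 1) :* (con (+ 1) :- d)) := con (+ 2) :* (con (+ 1) :- d)) refl (D s) ⟩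
    # (+ 2) ⊛ (# (+ 1) ⊕ ⊖ D s) ∎
    where
    open ≋-Reasoning
    open Hℤ.Solver

  -- (1 - s′)/s² = (8!/2) (s⁸/8!)/half and (6 (1 - s′)/s⁴ + 21 s⁶ s′)/24
  xRem yRem : Series
  xRem = # (+ 20160) ⊛ (γ 8 s ⊛ half⁻¹)
  yRem = # (+ 90) ⊛ (γ 6 s ⊛ half⁻¹) ⊕ # (+ 630) ⊛ (γ 6 s ⊛ D s)

  -- As 2 · 20160 = 8!, the left side is s¹⁰/half, which already equals 2(1 - s′). The factor 2
  -- stays and is cancelled later over ℚ.
  2s²xRem : # (+ 2) ⊛ (s ^ 2 ⊛ xRem) ≋ # (+ 2) ⊛ (# (+ 1) ⊕ ⊖ D s)
  2s²xRem = begin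
    # (+ 2) ⊛ (s ^ 2 ⊛ (# (+ 20160) ⊛ (γ 8 s ⊛ half⁻¹)))
      ≈⟨ solve 3 (λ s g q → con (+ 2) :* (s :^ 2 :* (con (+ 20160) :* (g :* q))) := s :^ 2 :* (con (+ 40320) :* g) :* q) refl s (γ 8 s) half⁻¹ ⟩
    s ^ 2 ⊛ (# (+ 40320) ⊛ γ 8 s) ⊛ half⁻¹
      ≈⟨ ⊛-congʳ (⊛-congˡ {s ^ 2} (^-⊛-γ s s₀ 8 0)) ⟨
    s ^ 2 ⊛ (s ^ 8 ⊛ # (+ 1)) ⊛ half⁻¹
      ≈⟨ solve 2 (λ s q → s :^ 2 :* (s :^ 8 :* con (+ 1)) :* q := s :^ 10 :* q) refl s half⁻¹ ⟩
    s ^ 10 ⊛ half⁻¹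
      ≈⟨ s¹⁰half⁻¹ ⟩
    # (+ 2) ⊛ (# (+ 1) ⊕ ⊖ D s) ∎
    where
    open ≋-Reasoning
    open Hℤ.Solver

  -- Since 24 · 90 = 3 · 6! and 24 · 630 = 21 · 6!, the left side is s¹⁰(3/half + 21s′). The right
  -- side is s⁴ times 6s⁻⁴ + (1/s)‴.
  24s⁴yRem : # (+ 24) ⊛ (s ^ 4 ⊛ yRem) ≋ # (+ 6) ⊛ (# (+ 1) ⊕ ⊖ D s) ⊕ # (+ 21) ⊛ (s ^ 10 ⊛ D s)
  24s⁴yRem = begin
    # (+ 24) ⊛ (s ^ 4 ⊛ (# (+ 90) ⊛ (γ 6 s ⊛ half⁻¹) ⊕ # (+ 630) ⊛ (γ 6 s ⊛ D s)))
      ≈⟨ solve 4 (λ s d g q → con (+ 24) :* (s :^ 4 :* (con (+ 90) :* (g :* q) :+ con (+ 630) :* (g :* d)))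
                   := s :^ 4 :* (con (+ 720) :* g) :* (con (+ 3) :* q :+ con (+ 21) :* d)) refl s (D s) (γ 6 s) half⁻¹ ⟩
    s ^ 4 ⊛ (# (+ 720) ⊛ γ 6 s) ⊛ (# (+ 3) ⊛ half⁻¹ ⊕ # (+ 21) ⊛ D s)
      ≈⟨ ⊛-congʳ (⊛-congˡ {s ^ 4} (^-⊛-γ s s₀ 6 0)) ⟨
    s ^ 4 ⊛ (s ^ 6 ⊛ # (+ 1)) ⊛ (# (+ 3) ⊛ half⁻¹ ⊕ # (+ 21) ⊛ D s)
      ≈⟨ solve 3 (λ s d q → s :^ 4 :* (s :^ 6 :* con (+ 1)) :* (con (+ 3) :* q :+ con (+ 21) :* d)
                   := con (+ 3) :* (s :^ 10 :* q) :+ con (+ 21) :* (s :^ 10 :* d)) refl s (D s) half⁻¹ ⟩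
    # (+ 3) ⊛ (s ^ 10 ⊛ half⁻¹) ⊕ # (+ 21) ⊛ (s ^ 10 ⊛ D s)
      ≈⟨ ⊕-congʳ (# (+ 21) ⊛ (s ^ 10 ⊛ D s)) (⊛-congˡ s¹⁰half⁻¹) ⟩
    # (+ 3) ⊛ (# (+ 2) ⊛ (# (+ 1) ⊕ ⊖ D s)) ⊕ # (+ 21) ⊛ (s ^ 10 ⊛ D s)
      ≈⟨ solve 2 (λ s d → con (+ 3) :* (con (+ 2) :* (con (+ 1) :- d)) :+ con (+ 21) :* (s :^ 10 :* d)
                   := con (+ 6) :* (con (+ 1) :- d) :+ con (+ 21) :* (s :^ 10 :* d)) refl s (D s) ⟩
    # (+ 6) ⊛ (# (+ 1) ⊕ ⊖ D s) ⊕ # (+ 21) ⊛ (s ^ 10 ⊛ D s) ∎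
    where
    open ≋-Reasoning
    open Hℤ.Solver

-- The Leibniz rule for higher derivatives

module HigherDerivatives where

  open HurwitzSeries
  open DividedPowers
  open import Data.Integer.Base as ℤ using (ℤ; +_)
  import Data.Integer.Properties as ℤ
  import Data.Integer.Divisibility.Signed as ℤ
  open import Data.Integer.Solver using (module +-*-Solver)
  open import Data.Nat.Base as ℕ using (ℕ; zero; suc; _!)
  open import Data.Nat.Combinatorics using (_C_; nCk≡n!/k![n-k]!; k![n∸k]!∣n!; nCk+nC[k+1]≡[n+1]C[k+1]; nCn≡1)
  open import Data.Nat.DivMod using (m/n*n≡m)
  import Data.Nat.Divisibility as ℕ
  import Data.Nat.Primality as ℕ
  import Data.Nat.Properties as ℕ
  open import Function.Base using (_∘_)
  open import Relation.Binary.PropositionalEquality as ≡ using (_≡_)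

  C-factorial : ∀ i j → ((i ℕ.+ j) C i) ℕ.* (i ! ℕ.* j !) ≡ (i ℕ.+ j) !
  C-factorial i j = begin
    ((i ℕ.+ j) C i) ℕ.* (i ! ℕ.* j !)
      ≡⟨ ≡.cong (λ l → ((i ℕ.+ j) C i) ℕ.* (i ! ℕ.* l !)) (≡.sym (ℕ.m+n∸m≡n i j)) ⟩
    ((i ℕ.+ j) C i) ℕ.* (i ! ℕ.* (i ℕ.+ j ℕ.∸ i) !)
      ≡⟨ ≡.cong (ℕ._* (i ! ℕ.* (i ℕ.+ j ℕ.∸ i) !)) (nCk≡n!/k![n-k]! (ℕ.m≤m+n i j)) ⟩
    _
      ≡⟨ m/n*n≡m {{i ℕ.!* (i ℕ.+ j ℕ.∸ i) !≢0}} (k![n∸k]!∣n! (ℕ.m≤m+n i j)) ⟩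
    (i ℕ.+ j) ! ∎
    where open ≡.≡-Reasoning

  C-pascal : ∀ i j → (suc i ℕ.+ suc j) C suc i ≡ ((i ℕ.+ suc j) C i) ℕ.+ ((suc i ℕ.+ j) C suc i)
  C-pascal i j = ≡.trans (≡.sym (nCk+nC[k+1]≡[n+1]C[k+1] (i ℕ.+ suc j) i))
    (≡.cong (λ n → ((i ℕ.+ suc j) C i) ℕ.+ (n C suc i)) (ℕ.+-suc i j))

  -- Σ_{i+j=k} F i j
  antidiagonal : ℕ → (ℕ → ℕ → ℤ) → ℤ
  antidiagonal zero    F = F 0 0
  antidiagonal (suc k) F = F 0 (suc k) ℤ.+ antidiagonal k (F ∘ suc)

  antidiagonal-cong : ∀ k {F G} → (∀ i j → F i j ≡ G i j) → antidiagonal k F ≡ antidiagonal k G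
  antidiagonal-cong zero    p = p 0 0
  antidiagonal-cong (suc k) p = ≡.cong₂ ℤ._+_ (p 0 (suc k)) (antidiagonal-cong k (p ∘ suc))

  antidiagonal-+ : ∀ k F G → antidiagonal k (λ i j → F i j ℤ.+ G i j) ≡ antidiagonal k F ℤ.+ antidiagonal k G
  antidiagonal-+ zero    F G = ≡.refl
  antidiagonal-+ (suc k) F G = ≡.trans (≡.cong (ℤ._+_ (F 0 (suc k) ℤ.+ G 0 (suc k))) (antidiagonal-+ k (F ∘ suc) (G ∘ suc)))
    (solve 4 (λ a b c d → (a :+ b) :+ (c :+ d) := (a :+ c) :+ (b :+ d)) ≡.refl
      (F 0 (suc k)) (G 0 (suc k)) (antidiagonal k (F ∘ suc)) (antidiagonal k (G ∘ suc)))
    where open +-*-Solver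

  antidiagonal-last : ∀ k F → antidiagonal (suc k) F ≡ antidiagonal k (λ i j → F i (suc j)) ℤ.+ F (suc k) 0
  antidiagonal-last zero    F = ≡.refl
  antidiagonal-last (suc k) F = ≡.trans (≡.cong (ℤ._+_ (F 0 (suc (suc k)))) (antidiagonal-last k (F ∘ suc)))
    (≡.sym (ℤ.+-assoc (F 0 (suc (suc k))) _ _))

  -- Pascal's rule, summed. It applies to the interior terms; the two end terms have coefficient 1
  -- on both sides.
  antidiagonal-C : ∀ k (φ : ℕ → ℕ → ℤ) → antidiagonal (suc k) (λ i j → + ((i ℕ.+ j) C i) ℤ.* φ i j) ≡
    antidiagonal k (λ i j → + ((i ℕ.+ j) C i) ℤ.* φ (suc i) j) ℤ.+
    antidiagonal k (λ i j → + ((i ℕ.+ j) C i) ℤ.* φ i (suc j))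
  antidiagonal-C zero φ = solve 2 (λ a b → con (+ 1) :* a :+ con (+ 1) :* b := con (+ 1) :* b :+ con (+ 1) :* a)
    ≡.refl (φ 0 1) (φ 1 0)
    where open +-*-Solver
  antidiagonal-C (suc k) φ = begin
    b₀ ℤ.+ antidiagonal (suc k) (λ i j → F (suc i) j)
      ≡⟨ ≡.cong (ℤ._+_ b₀) (antidiagonal-last k (λ i j → F (suc i) j)) ⟩
    b₀ ℤ.+ (antidiagonal k (λ i j → F (suc i) (suc j)) ℤ.+ F (suc (suc k)) 0)
      ≡⟨ ≡.cong (λ x → b₀ ℤ.+ (x ℤ.+ F (suc (suc k)) 0))
           (≡.trans (antidiagonal-cong k pascal) (antidiagonal-+ k (λ i j → G (suc i) j) (λ i j → H i (suc j)))) ⟩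
    b₀ ℤ.+ ((antidiagonal k (λ i j → G (suc i) j) ℤ.+ antidiagonal k (λ i j → H i (suc j))) ℤ.+ F (suc (suc k)) 0)
      ≡⟨ solve 4 (λ a b c d → a :+ ((b :+ c) :+ d) := (c :+ d) :+ (a :+ b)) ≡.refl b₀
           (antidiagonal k (λ i j → G (suc i) j)) (antidiagonal k (λ i j → H i (suc j))) (F (suc (suc k)) 0) ⟩
    (antidiagonal k (λ i j → H i (suc j)) ℤ.+ F (suc (suc k)) 0) ℤ.+ (b₀ ℤ.+ antidiagonal k (λ i j → G (suc i) j))
      ≡⟨ ≡.cong (λ c → (antidiagonal k (λ i j → H i (suc j)) ℤ.+ + c ℤ.* φ (suc (suc k)) 0) ℤ.+ (b₀ ℤ.+ antidiagonal k (λ i j → G (suc i) j)))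
           (ends k) ⟩
    (antidiagonal k (λ i j → H i (suc j)) ℤ.+ H (suc k) 0) ℤ.+ antidiagonal (suc k) G
      ≡⟨ ≡.cong (ℤ._+ antidiagonal (suc k) G) (≡.sym (antidiagonal-last k H)) ⟩
    antidiagonal (suc k) H ℤ.+ antidiagonal (suc k) G ∎
    where
    open ≡.≡-Reasoning
    open +-*-Solver
    F G H : ℕ → ℕ → ℤ
    F i j = + ((i ℕ.+ j) C i) ℤ.* φ i j
    G i j = + ((i ℕ.+ j) C i) ℤ.* φ i (suc j)
    H i j = + ((i ℕ.+ j) C i) ℤ.* φ (suc i) j
    b₀ = F 0 (suc (suc k))
    pascal : ∀ i j → F (suc i) (suc j) ≡ G (suc i) j ℤ.+ H i (suc j)
    pascal i j = ≡.trans (≡.cong (λ c → + c ℤ.* φ (suc i) (suc j)) (C-pascal i j))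
      (≡.trans (≡.cong (ℤ._* φ (suc i) (suc j)) (ℤ.pos-+ ((i ℕ.+ suc j) C i) ((suc i ℕ.+ j) C suc i)))
      (solve 3 (λ a b c → (a :+ b) :* c := b :* c :+ a :* c) ≡.refl
         (+ ((i ℕ.+ suc j) C i)) (+ ((suc i ℕ.+ j) C suc i)) (φ (suc i) (suc j))))
    ends : ∀ k → (suc (suc k) ℕ.+ 0) C suc (suc k) ≡ (suc k ℕ.+ 0) C suc k
    ends k rewrite ℕ.+-identityʳ k = ≡.trans (nCn≡1 (suc (suc k))) (≡.sym (nCn≡1 (suc k)))

  higher-leibniz : ∀ k (f g : Hℤ.Series) n → (f Hℤ.⊛ g) (k ℕ.+ n) ≡
    antidiagonal k (λ i j → + ((i ℕ.+ j) C i) ℤ.* ((f ∘ (i ℕ.+_)) Hℤ.⊛ (g ∘ (j ℕ.+_))) n)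
  higher-leibniz zero    f g n = ≡.sym (ℤ.*-identityˡ ((f Hℤ.⊛ g) n))
  higher-leibniz (suc k) f g n = begin
    ((f ∘ suc) Hℤ.⊛ g) (k ℕ.+ n) ℤ.+ (f Hℤ.⊛ (g ∘ suc)) (k ℕ.+ n)
      ≡⟨ ≡.cong₂ ℤ._+_ (higher-leibniz k (f ∘ suc) g n) (higher-leibniz k f (g ∘ suc) n) ⟩
    antidiagonal k (λ i j → + ((i ℕ.+ j) C i) ℤ.* φ (suc i) j) ℤ.+
    antidiagonal k (λ i j → + ((i ℕ.+ j) C i) ℤ.* φ i (suc j))
      ≡⟨ antidiagonal-C k φ ⟨
    antidiagonal (suc k) (λ i j → + ((i ℕ.+ j) C i) ℤ.* φ i j) ∎
    where
    open ≡.≡-Reasoning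
    φ : ℕ → ℕ → ℤ
    φ i j = ((f ∘ (i ℕ.+_)) Hℤ.⊛ (g ∘ (j ℕ.+_))) n

-- Congruences, the p-fold derivative and Wilson's theorem

module ModPrime where

  open HurwitzSeries
  open DividedPowers
  open InverseExpansion
  open HigherDerivatives
  open import Algebra.Bundles using (CommutativeRing)
  open import Algebra.Solver.Ring.AlmostCommutativeRing using (fromCommutativeRing; _-Raw-AlmostCommutative⟶_)
  open import Data.Empty using (⊥-elim)
  open import Data.Integer.Base as ℤ using (ℤ; +_; -[1+_])
  import Data.Integer.Properties as ℤ
  open import Data.Integer.Divisibility.Signed as ℤ using (divides)
  open import Data.Integer.Solver using (module +-*-Solver)
  open import Data.Nat.Base as ℕ using (ℕ; zero; suc; z≤n; s≤s; _!)
  open import Data.Nat.Combinatorics using (_C_; nCn≡1)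
  import Data.Nat.Divisibility as ℕ
  open import Data.Nat.Primality as ℕ using (Prime; euclidsLemma)
  import Data.Nat.Properties as ℕ
  open import Data.Product.Base using (_,_)
  open import Data.Sum.Base using (_⊎_; inj₁; inj₂)
  open import Function.Base using (_∘_; id)
  open import Level using (0ℓ)
  open import Relation.Binary.PropositionalEquality as ≡ using (_≡_)
  open import Relation.Nullary.Negation using (¬_; contradiction)

  infix 4 _≡_[mod_]
  -- Wrapped in a record so that a and b are recovered by unification; the divisibility of their
  -- difference would not determine them.
  record _≡_[mod_] (a b : ℤ) (p : ℕ) : Set where
    constructor mod
    field divides-difference : + p ℤ.∣ a ℤ.- b
  open _≡_[mod_]

  ≡⇒mod : ∀ {p a b} → a ≡ b → a ≡ b [mod p ]
  ≡⇒mod {p} {a} ≡.refl = mod (divides (+ 0) (ℤ.+-inverseʳ a))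

  ∣⇒mod : ∀ {p a} → + p ℤ.∣ a → a ≡ + 0 [mod p ]
  ∣⇒mod {p} {a} d = mod (≡.subst (+ p ℤ.∣_) (≡.sym (ℤ.+-identityʳ a)) d)

  mod⇒∣ : ∀ {p a} → a ≡ + 0 [mod p ] → + p ℤ.∣ a
  mod⇒∣ {p} {a} (mod d) = ≡.subst (+ p ℤ.∣_) (ℤ.+-identityʳ a) d

  -- The carrier stays ℤ and only the equality changes, so an integral series is itself a series
  -- modulo p.
  ℤ/ : ℕ → CommutativeRing 0ℓ 0ℓ
  ℤ/ p = record
    { Carrier = ℤ
    ; _≈_     = _≡_[mod p ]
    ; _+_     = ℤ._+_
    ; _*_     = ℤ._*_
    ; -_      = ℤ.-_
    ; 0#      = + 0
    ; 1#      = + 1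
    ; isCommutativeRing = record
      { isRing = record
        { +-isAbelianGroup = record
          { isGroup = record
            { isMonoid = record
              { isSemigroup = record
                { isMagma = record
                  { isEquivalence = record
                    { refl  = ≡⇒mod ≡.refl
                    ; sym   = λ { {a} {b} (mod d) → mod (∣-cast
                        (solve 2 (λ a b → :- (a :- b) := b :- a) ≡.refl a b) (ℤ.∣m⇒∣-m d)) }
                    ; trans = λ { {a} {b} {c} (mod d) (mod e) → mod (∣-cast
                        (solve 3 (λ a b c → (a :- b) :+ (b :- c) := a :- c) ≡.refl a b c) (ℤ.∣m∣n⇒∣m+n d e)) }
                    }
                  ; ∙-cong = λ { {a} {b} {c} {d} (mod e) (mod f) → mod (∣-cast
                      (solve 4 (λ a b c d → (a :- b) :+ (c :- d) := (a :+ c) :- (b :+ d)) ≡.refl a b c d) (ℤ.∣m∣n⇒∣m+n e f)) }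
                  }
                ; assoc = λ a b c → ≡⇒mod (ℤ.+-assoc a b c)
                }
              ; identity = (λ a → ≡⇒mod (ℤ.+-identityˡ a)) , (λ a → ≡⇒mod (ℤ.+-identityʳ a))
              }
            ; inverse = (λ a → ≡⇒mod (ℤ.+-inverseˡ a)) , (λ a → ≡⇒mod (ℤ.+-inverseʳ a))
            ; ⁻¹-cong = λ { {a} {b} (mod d) → mod (∣-cast
                (solve 2 (λ a b → :- (a :- b) := :- a :- :- b) ≡.refl a b) (ℤ.∣m⇒∣-m d)) }
            }
          ; comm = λ a b → ≡⇒mod (ℤ.+-comm a b)
          }
        ; *-cong = λ { {a} {b} {c} {d} (mod e) (mod f) → mod (∣-cast
            (solve 4 (λ a b c d → (a :- b) :* c :+ b :* (c :- d) := a :* c :- b :* d) ≡.refl a b c d)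
            (ℤ.∣m∣n⇒∣m+n (ℤ.∣m⇒∣m*n c e) (ℤ.∣n⇒∣m*n b f))) }
        ; *-assoc    = λ a b c → ≡⇒mod (ℤ.*-assoc a b c)
        ; *-identity = (λ a → ≡⇒mod (ℤ.*-identityˡ a)) , (λ a → ≡⇒mod (ℤ.*-identityʳ a))
        ; distrib    = (λ a b c → ≡⇒mod (ℤ.*-distribˡ-+ a b c)) , (λ a b c → ≡⇒mod (ℤ.*-distribʳ-+ a b c))
        }
      ; *-comm = λ a b → ≡⇒mod (ℤ.*-comm a b)
      }
    }
    where
    open +-*-Solver
    ∣-cast : ∀ {a b} → a ≡ b → + p ℤ.∣ a → + p ℤ.∣ b
    ∣-cast ≡.refl d = d

  mod-sym : ∀ {p a b} → a ≡ b [mod p ] → b ≡ a [mod p ]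
  mod-sym {p} = CommutativeRing.sym (ℤ/ p)

  mod-trans : ∀ {p a b c} → a ≡ b [mod p ] → b ≡ c [mod p ] → a ≡ c [mod p ]
  mod-trans {p} = CommutativeRing.trans (ℤ/ p)

  mod-+-congˡ : ∀ {p} a {b c} → b ≡ c [mod p ] → a ℤ.+ b ≡ a ℤ.+ c [mod p ]
  mod-+-congˡ {p} a = CommutativeRing.+-congˡ (ℤ/ p) {a}

  mod-+-congʳ : ∀ {p} a {b c} → b ≡ c [mod p ] → b ℤ.+ a ≡ c ℤ.+ a [mod p ]
  mod-+-congʳ {p} a = CommutativeRing.+-congʳ (ℤ/ p) {a}

  mod-*-congˡ : ∀ {p} a {b c} → b ≡ c [mod p ] → a ℤ.* b ≡ a ℤ.* c [mod p ]
  mod-*-congˡ {p} a = CommutativeRing.*-congˡ (ℤ/ p) {a}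

  mod-*-congʳ : ∀ {p} a {b c} → b ≡ c [mod p ] → b ℤ.* a ≡ c ℤ.* a [mod p ]
  mod-*-congʳ {p} a = CommutativeRing.*-congʳ (ℤ/ p) {a}

  ℤ⟶ℤ/ : ∀ p → CommutativeRing.rawRing ℤ.+-*-commutativeRing -Raw-AlmostCommutative⟶ fromCommutativeRing (ℤ/ p)
  ℤ⟶ℤ/ p = record
    { ⟦_⟧    = id
    ; +-homo = λ _ _ → ≡⇒mod ≡.refl
    ; *-homo = λ _ _ → ≡⇒mod ≡.refl
    ; -‿homo = λ _ → ≡⇒mod ≡.refl
    ; 0-homo = ≡⇒mod ≡.refl
    ; 1-homo = ≡⇒mod ≡.refl
    }

  ∣*⇒∣ : ∀ {p} → Prime p → ∀ a b → + p ℤ.∣ a ℤ.* b → + p ℤ.∣ a ⊎ + p ℤ.∣ b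
  ∣*⇒∣ {p} pr a b d with euclidsLemma ℤ.∣ a ∣ ℤ.∣ b ∣ pr (≡.subst (p ℕ.∣_) (ℤ.abs-* a b) (ℤ.∣⇒∣ᵤ d))
  ... | inj₁ e = inj₁ (ℤ.∣ᵤ⇒∣ e)
  ... | inj₂ e = inj₂ (ℤ.∣ᵤ⇒∣ e)

  prime∤! : ∀ {p} → Prime p → ∀ i → i ℕ.< p → ¬ (p ℕ.∣ i !)
  prime∤! pr zero    i<p d = contradiction (ℕ.∣⇒≤ d) (ℕ.<⇒≱ (ℕ.nonTrivial⇒n>1 _ {{ℕ.prime⇒nonTrivial pr}}))
  prime∤! pr (suc i) i<p d with euclidsLemma (suc i) (i !) pr d
  ... | inj₁ e = ℕ.<⇒≱ i<p (ℕ.∣⇒≤ e)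
  ... | inj₂ e = prime∤! pr i (ℕ.<-trans (ℕ.n<1+n i) i<p) e

  -- p divides p! = binom(p, i + 1) (i + 1)! (j + 1)!, but neither of the two factorials, whose
  -- arguments are less than p.
  prime∣C : ∀ i j → Prime (suc i ℕ.+ suc j) → (suc i ℕ.+ suc j) ℕ.∣ (suc i ℕ.+ suc j) C suc i
  prime∣C i j pr with euclidsLemma ((suc i ℕ.+ suc j) C suc i) (suc i ! ℕ.* suc j !) pr
    (≡.subst ((suc i ℕ.+ suc j) ℕ.∣_) (≡.sym (C-factorial (suc i) (suc j))) (ℕ.m∣m*n ((i ℕ.+ suc j) !)))
  ... | inj₁ d = d
  ... | inj₂ d with euclidsLemma (suc i !) (suc j !) pr d
  ...   | inj₁ e = ⊥-elim (prime∤! pr (suc i) (ℕ.m<m+n (suc i) (s≤s z≤n)) e)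
  ...   | inj₂ e = ⊥-elim (prime∤! pr (suc j) (ℕ.m<n+m (suc j) (s≤s z≤n)) e)

  antidiagonal-∣ : ∀ {d} k {F} → (∀ i j → i ℕ.+ j ≡ k → d ℤ.∣ F i j) → d ℤ.∣ antidiagonal k F
  antidiagonal-∣ zero    p = p 0 0 ≡.refl
  antidiagonal-∣ (suc k) p = ℤ.∣m∣n⇒∣m+n (p 0 (suc k) ≡.refl) (antidiagonal-∣ k (λ i j e → p (suc i) j (≡.cong suc e)))

  rising-! : ∀ k m → rising k m ℕ.* k ! ≡ (m ℕ.+ k) !
  rising-! k zero    = ℕ.*-identityˡ (k !)
  rising-! k (suc m) = ≡.trans (ℕ.*-assoc (suc (m ℕ.+ k)) (rising k m) (k !)) (≡.cong (suc (m ℕ.+ k) ℕ.*_) (rising-! k m))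

  rising-0 : ∀ m → rising 0 m ≡ m !
  rising-0 m = ≡.trans (≡.sym (ℕ.*-identityʳ (rising 0 m))) (≡.trans (rising-! 0 m) (≡.cong _! (ℕ.+-identityʳ m)))

  ^-γ : ∀ f → f 0 ≡ + 0 → ∀ k → f Hℤ.^ k Hℤ.≋ Hℤ.constant (+ (k !)) Hℤ.⊛ γ k f
  ^-γ f f₀ k = begin
    f ^ k                              ≈⟨ solve 1 (λ a → a := a :* con (+ 1)) refl (f ^ k) ⟩
    f ^ k ⊛ γ 0 f                      ≈⟨ ^-⊛-γ f f₀ k 0 ⟩
    # (+ rising 0 k) ⊛ γ (k ℕ.+ 0) f   ≡⟨ ≡.cong₂ (λ a b → # (+ a) ⊛ γ b f) (rising-0 k) (ℕ.+-identityʳ k) ⟩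
    # (+ (k !)) ⊛ γ k f                ∎
    where
    open Hℤ hiding (module Solver)
    open Hℤ.Solver
    open ≋-Reasoning

  -- The powers of -1, with period two built in, so that indices differing by 10 give the same value
  -- by computation.
  alternating : ℕ → ℤ
  alternating zero          = + 1
  alternating (suc zero)    = -[1+ 0 ]
  alternating (suc (suc n)) = alternating n

  -- 1 - e⁻ᵘ
  exponential : Hℤ.Series
  exponential zero    = + 0
  exponential (suc n) = alternating n

  D-exponential : Hℤ.D exponential Hℤ.≋ Hℤ.# (+ 1) Hℤ.⊕ Hℤ.⊖ exponential
  D-exponential = Hℤ.pointwise λ { zero → ≡.refl ; (suc n) → ≡.trans (alternate n) (≡.sym (ℤ.+-identityˡ _)) }
    where
    alternate : ∀ n → alternating (suc n) ≡ ℤ.- alternating n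
    alternate zero    = ≡.refl
    alternate (suc n) = ≡.sym (≡.trans (≡.cong ℤ.-_ (alternate n)) (ℤ.neg-involutive _))

  -- Σ_{j ≤ K} (1 - e⁻ᵘ)ʲ
  geometric : ℕ → Hℤ.Series
  geometric zero    = Hℤ.# (+ 1)
  geometric (suc K) = geometric K Hℤ.⊕ Hℤ.# (+ (suc K !)) Hℤ.⊛ γ (suc K) exponential

  -- As f = 1 - e⁻ᵘ satisfies f′ = 1 - f, this is (1 - f)(1 + f + ⋯ + f^K) = 1 - f^(K+1), with
  -- powers written as factorials times divided powers.
  geometric-sum : ∀ K → Hℤ.D exponential Hℤ.⊛ geometric K Hℤ.≋
                  Hℤ.# (+ 1) Hℤ.⊕ Hℤ.⊖ (Hℤ.# (+ (suc K !)) Hℤ.⊛ γ (suc K) exponential)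
  geometric-sum zero = begin
    D f ⊛ # (+ 1)                  ≈⟨ ⊛-congʳ D-exponential ⟩
    (# (+ 1) ⊕ ⊖ f) ⊛ # (+ 1)      ≈⟨ solve 1 (λ f → (con (+ 1) :- f) :* con (+ 1) := con (+ 1) :- f :* con (+ 1)) refl f ⟩
    # (+ 1) ⊕ ⊖ (f ⊛ γ 0 f)        ≈⟨ ⊕-congˡ (# (+ 1)) (⊖-cong (⊛-γ f ≡.refl 0)) ⟩
    # (+ 1) ⊕ ⊖ (# (+ 1) ⊛ γ 1 f)  ∎
    where
    open Hℤ hiding (module Solver)
    open Hℤ.Solver
    open ≋-Reasoning
    f = exponential
  geometric-sum (suc K) = begin
    D f ⊛ (geometric K ⊕ # c ⊛ G)
      ≈⟨ solve 4 (λ d w c g → d :* (w :+ c :* g) := d :* w :+ d :* (c :* g)) refl (D f) (geometric K) (# c) G ⟩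
    D f ⊛ geometric K ⊕ D f ⊛ (# c ⊛ G)
      ≈⟨ ⊕-cong (geometric-sum K) (⊛-congʳ D-exponential) ⟩
    (# (+ 1) ⊕ ⊖ (# c ⊛ G)) ⊕ (# (+ 1) ⊕ ⊖ f) ⊛ (# c ⊛ G)
      ≈⟨ solve 3 (λ f c g → (con (+ 1) :- c :* g) :+ (con (+ 1) :- f) :* (c :* g) := con (+ 1) :- c :* (f :* g)) refl f (# c) G ⟩
    # (+ 1) ⊕ ⊖ (# c ⊛ (f ⊛ G))
      ≈⟨ ⊕-congˡ (# (+ 1)) (⊖-cong (⊛-congˡ (⊛-γ f ≡.refl (suc K)))) ⟩
    # (+ 1) ⊕ ⊖ (# c ⊛ (# t ⊛ G₁))
      ≈⟨ ⊕-congˡ (# (+ 1)) (⊖-cong (solve 3 (λ c t g → c :* (t :* g) := (t :* c) :* g) refl (# c) (# t) G₁)) ⟩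
    # (+ 1) ⊕ ⊖ ((# t ⊛ # c) ⊛ G₁)
      ≈⟨ ⊕-congˡ (# (+ 1)) (⊖-cong (⊛-congʳ (sym (constant-* t c)))) ⟩
    # (+ 1) ⊕ ⊖ (# (t ℤ.* c) ⊛ G₁)
      ≡⟨ ≡.cong (λ a → # (+ 1) ⊕ ⊖ (# a ⊛ G₁)) (≡.sym (ℤ.pos-* (suc (suc K)) (suc K !))) ⟩
    # (+ 1) ⊕ ⊖ (# (+ (suc (suc K) !)) ⊛ G₁) ∎
    where
    open Hℤ hiding (module Solver)
    open Hℤ.Solver
    open ≋-Reasoning
    f = exponential
    c = + (suc K !)
    t = + suc (suc K)
    G = γ (suc K) f
    G₁ = γ (suc (suc K)) f

  module Frobenius (p-2 : ℕ) (pr : Prime (suc (suc p-2))) where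

    p : ℕ
    p = suc (suc p-2)

    module Hₚ = Hurwitz (ℤ/ p) (ℤ⟶ℤ/ p)
    open Hₚ hiding (module Solver)

    reduce : ∀ {f g} → f Hℤ.≋ g → f ≋ g
    reduce e = pointwise λ n → ≡⇒mod (Hℤ.at e n)

    cancel : ∀ a b → ¬ (p ℕ.∣ ℤ.∣ a ∣) → a ℤ.* b ≡ + 0 [mod p ] → b ≡ + 0 [mod p ]
    cancel a b p∤a e with ∣*⇒∣ pr a b (mod⇒∣ e)
    ... | inj₁ d = ⊥-elim (p∤a (ℤ.∣⇒∣ᵤ d))
    ... | inj₂ d = ∣⇒mod d

    Dᵖ : Series → Series
    Dᵖ f n = f (p ℕ.+ n)

    -- In the p-fold Leibniz rule the interior binomial coefficients are divisible by p; only the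
    -- two end terms survive.
    Dᵖ-⊛ : ∀ f g → Dᵖ (f ⊛ g) ≋ Dᵖ f ⊛ g ⊕ f ⊛ Dᵖ g
    Dᵖ-⊛ f g = pointwise λ n → mod (≡.subst (+ p ℤ.∣_) (≡.sym (difference n)) (middle n))
      where
      F : ℕ → ℕ → ℕ → ℤ
      F n i j = + ((i ℕ.+ j) C i) ℤ.* ((f ∘ (i ℕ.+_)) ⊛ (g ∘ (j ℕ.+_))) n
      middle : ∀ n → + p ℤ.∣ antidiagonal p-2 (λ i j → F n (suc i) (suc j))
      middle n = antidiagonal-∣ p-2 λ i j e → ℤ.∣m⇒∣m*n {+ p} {+ ((suc i ℕ.+ suc j) C suc i)}
        (((f ∘ (suc i ℕ.+_)) ⊛ (g ∘ (suc j ℕ.+_))) n) (ℤ.∣ᵤ⇒∣ (≡.subst (λ q → Prime q → q ℕ.∣ (suc i ℕ.+ suc j) C suc i)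
          (≡.trans (≡.cong suc (ℕ.+-suc i j)) (≡.cong (suc ∘ suc) e)) (prime∣C i j) pr))
      last : ∀ n → F n p 0 ≡ (Dᵖ f ⊛ g) n
      last n rewrite ℕ.+-identityʳ p-2 | nCn≡1 p = ℤ.*-identityˡ ((Dᵖ f ⊛ g) n)
      difference : ∀ n → (f ⊛ g) (p ℕ.+ n) ℤ.- (Dᵖ f ⊛ g ⊕ f ⊛ Dᵖ g) n ≡ antidiagonal p-2 (λ i j → F n (suc i) (suc j))
      difference n = begin
        (f ⊛ g) (p ℕ.+ n) ℤ.- S
          ≡⟨ ≡.cong (ℤ._- S) (higher-leibniz p f g n) ⟩
        (F n 0 p ℤ.+ antidiagonal (suc p-2) (λ i j → F n (suc i) j)) ℤ.- S
          ≡⟨ ≡.cong (λ a → F n 0 p ℤ.+ a ℤ.- S) (antidiagonal-last p-2 (λ i j → F n (suc i) j)) ⟩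
        (F n 0 p ℤ.+ (M ℤ.+ F n p 0)) ℤ.- S
          ≡⟨ ≡.cong₂ (λ a b → (a ℤ.+ (M ℤ.+ b)) ℤ.- S) (ℤ.*-identityˡ ((f ⊛ Dᵖ g) n)) (last n) ⟩
        ((f ⊛ Dᵖ g) n ℤ.+ (M ℤ.+ (Dᵖ f ⊛ g) n)) ℤ.- S
          ≡⟨ solve 3 (λ a m b → (a :+ (m :+ b)) :- (b :+ a) := m) ≡.refl ((f ⊛ Dᵖ g) n) M ((Dᵖ f ⊛ g) n) ⟩
        M ∎
        where
        open ≡.≡-Reasoning
        open +-*-Solver
        S = (Dᵖ f ⊛ g ⊕ f ⊛ Dᵖ g) n
        M = antidiagonal p-2 (λ i j → F n (suc i) (suc j))

    Dᵖ-^ : ∀ f k → Dᵖ (f ^ suc k) ≋ # (+ suc k) ⊛ (f ^ k ⊛ Dᵖ f)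
    Dᵖ-^ = derivation-^ Dᵖ Dᵖ-⊛ refl

    -- p divides the p-th coefficient of f^j, j ≥ 2, hence of f^j/j!, j < p.
    γ-p : ∀ f → f 0 ≡ + 0 → ∀ j → suc (suc j) ℕ.< p → γ (suc (suc j)) f p ≡ + 0 [mod p ]
    γ-p f f₀ j j<p = cancel (+ (k !)) (γ k f p) (prime∤! pr k j<p) (begin
      + (k !) ℤ.* γ k f p                    ≡⟨ Hℤ.constant-⊛ (+ (k !)) (γ k f) p ⟨
      (Hℤ.constant (+ (k !)) Hℤ.⊛ γ k f) p   ≡⟨ Hℤ.at (^-γ f f₀ k) p ⟨
      (f Hℤ.^ k) p                           ≡⟨ ≡.cong (λ n → (f Hℤ.^ k) (suc (suc n))) (≡.sym (ℕ.+-identityʳ p-2)) ⟩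
      Dᵖ (f ^ k) 0                           ≈⟨ at (Dᵖ-^ f (suc j)) 0 ⟩
      + k ℤ.* ((f 0 ℤ.* (f ^ j) 0) ℤ.* Dᵖ f 0)   ≡⟨ ≡.cong (λ a → + k ℤ.* ((a ℤ.* (f ^ j) 0) ℤ.* Dᵖ f 0)) f₀ ⟩
      + k ℤ.* (+ 0 ℤ.* Dᵖ f 0)               ≡⟨ ℤ.*-zeroʳ (+ k) ⟩
      + 0                                    ∎)
      where
      open ≈-Reasoning
      k = suc (suc j)

    D-γ : ∀ f j n → (Hℤ.D f Hℤ.⊛ γ j f) n ≡ γ (suc j) f (suc n)
    D-γ f j n = Hℤ.at (Hℤ.⊛-comm (Hℤ.D f) (γ j f)) n

    -- The coefficient of f′ f^(j+1)/(j+1)! at p - 1 is that of f^(j+2)/(j+2)! at p, which is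
    -- divisible by p. So at this index the intermediate terms of an expansion in f drop out. This
    -- is used for 1 - e⁻ᵘ and for s.
    add-term : ∀ f → f 0 ≡ + 0 → ∀ W c j → suc (suc j) ℕ.< p →
               (D f ⊛ (W ⊕ # c ⊛ γ (suc j) f)) (suc p-2) ≡ (D f ⊛ W) (suc p-2) [mod p ]
    add-term f f₀ W c j j<p = begin
      (D f ⊛ (W ⊕ # c ⊛ γ (suc j) f)) (suc p-2)
        ≈⟨ at (solve 4 (λ d w c g → d :* (w :+ c :* g) := d :* w :+ c :* (d :* g)) refl (D f) W (# c) (γ (suc j) f)) (suc p-2) ⟩
      (D f ⊛ W) (suc p-2) ℤ.+ (# c ⊛ (D f ⊛ γ (suc j) f)) (suc p-2)
        ≈⟨ mod-+-congˡ ((D f ⊛ W) (suc p-2)) (constant-⊛ c (D f ⊛ γ (suc j) f) (suc p-2)) ⟩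
      (D f ⊛ W) (suc p-2) ℤ.+ c ℤ.* (D f ⊛ γ (suc j) f) (suc p-2)
        ≈⟨ mod-+-congˡ ((D f ⊛ W) (suc p-2)) (mod-*-congˡ c (mod-trans (≡⇒mod (D-γ f (suc j) (suc p-2))) (γ-p f f₀ j j<p))) ⟩
      (D f ⊛ W) (suc p-2) ℤ.+ c ℤ.* + 0
        ≡⟨ ≡.trans (≡.cong (ℤ._+_ ((D f ⊛ W) (suc p-2))) (ℤ.*-zeroʳ c)) (ℤ.+-identityʳ ((D f ⊛ W) (suc p-2))) ⟩
      (D f ⊛ W) (suc p-2) ∎
      where
      open ≈-Reasoning
      open Hₚ.Solver

    -- The divided power f^p/p! escapes the vanishing: its coefficient at p is 1.
    add-last-term : ∀ f → f 1 ≡ + 1 → ∀ W c →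
      (D f ⊛ (W ⊕ # c ⊛ γ (suc p-2) f)) (suc p-2) ≡ (D f ⊛ W) (suc p-2) ℤ.+ c [mod p ]
    add-last-term f f₁ W c = begin
      (D f ⊛ (W ⊕ # c ⊛ G)) (suc p-2)
        ≈⟨ at (solve 4 (λ d w c g → d :* (w :+ c :* g) := d :* w :+ c :* (d :* g)) refl (D f) W (# c) G) (suc p-2) ⟩
      (D f ⊛ W) (suc p-2) ℤ.+ (# c ⊛ (D f ⊛ G)) (suc p-2)
        ≈⟨ mod-+-congˡ ((D f ⊛ W) (suc p-2)) (constant-⊛ c (D f ⊛ G) (suc p-2)) ⟩
      (D f ⊛ W) (suc p-2) ℤ.+ c ℤ.* (D f ⊛ G) (suc p-2)
        ≡⟨ ≡.cong (λ a → (D f ⊛ W) (suc p-2) ℤ.+ c ℤ.* a) (≡.trans (D-γ f (suc p-2) (suc p-2)) (γ-leading f f₁ p)) ⟩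
      (D f ⊛ W) (suc p-2) ℤ.+ c ℤ.* + 1
        ≡⟨ ≡.cong (ℤ._+_ ((D f ⊛ W) (suc p-2))) (ℤ.*-identityʳ c) ⟩
      (D f ⊛ W) (suc p-2) ℤ.+ c ∎
      where
      open ≈-Reasoning
      open Hₚ.Solver
      G = γ (suc p-2) f

    -- Compare coefficients at p - 1 in the geometric sum for f = 1 - e⁻ᵘ up to f^(p-1). Modulo p
    -- the left side gives f p + (p - 1)!, with f p = 1 by the parity hypothesis; the right side 1 -
    -- f^p gives 0.
    wilson : alternating (suc p-2) ≡ + 1 → + (suc p-2 !) ≡ -[1+ 0 ] [mod p ]
    wilson even = begin
      + (suc p-2 !)                                             ≡⟨ solve 1 (λ a → a := con -[1+ 0 ] :+ (con (+ 1) :+ a)) ≡.refl (+ (suc p-2 !)) ⟩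
      -[1+ 0 ] ℤ.+ (+ 1 ℤ.+ + (suc p-2 !))                      ≡⟨ ≡.cong (λ a → -[1+ 0 ] ℤ.+ (a ℤ.+ + (suc p-2 !))) (≡.sym even) ⟩
      -[1+ 0 ] ℤ.+ (f p ℤ.+ + (suc p-2 !))                      ≈⟨ mod-+-congˡ -[1+ 0 ] (mod-+-congʳ (+ (suc p-2 !)) (mod-sym (partial p-2 (ℕ.n<1+n p-2)))) ⟩
      -[1+ 0 ] ℤ.+ ((D f ⊛ geometric p-2) (suc p-2) ℤ.+ + (suc p-2 !)) ≈⟨ mod-+-congˡ -[1+ 0 ] (add-last-term f ≡.refl (geometric p-2) (+ (suc p-2 !))) ⟨
      -[1+ 0 ] ℤ.+ (D f ⊛ geometric (suc p-2)) (suc p-2)        ≡⟨ ≡.cong (ℤ._+_ -[1+ 0 ]) (Hℤ.at (geometric-sum (suc p-2)) (suc p-2)) ⟩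
      -[1+ 0 ] ℤ.+ (+ 0 ℤ.- (Hℤ.# (+ (p !)) Hℤ.⊛ γ p f) (suc p-2))  ≡⟨ ≡.cong (λ a → -[1+ 0 ] ℤ.+ (+ 0 ℤ.- a))
                                                                      (Hℤ.⊛-vanish (Hℤ.# (+ (p !))) {γ p f} p (γ-vanish f p) (suc p-2) (ℕ.n<1+n _)) ⟩
      -[1+ 0 ] ∎
      where
      open ≈-Reasoning
      open +-*-Solver
      f = exponential
      partial : ∀ K → K ℕ.< suc p-2 → (D f ⊛ geometric K) (suc p-2) ≡ f p [mod p ]
      partial zero    K< = ≡⇒mod (≡.trans (Hℤ.at (Hℤ.⊛-comm (D f) (Hℤ.# (+ 1))) (suc p-2))
        (≡.trans (Hℤ.constant-⊛ (+ 1) (D f) (suc p-2)) (ℤ.*-identityˡ (f p))))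
      partial (suc K) K< = mod-trans (add-term f ≡.refl (geometric K) (+ (suc K !)) K (s≤s K<))
        (partial K (ℕ.<-trans (ℕ.n<1+n K) K<))

-- The factor between the p-fold derivative of s and s′, and its value modulo p

module HasseInvariants where

  open import Defs using (A)
  open HurwitzSeries
  open DividedPowers
  open InverseExpansion
  open HigherDerivatives
  open ModPrime
  open import Algebra.Bundles using (CommutativeRing)
  open import Data.Integer.Base as ℤ using (ℤ; +_; -[1+_])
  import Data.Integer.Properties as ℤ
  open import Data.Integer.Divisibility.Signed as ℤ using (divides)
  open import Data.Integer.Solver using (module +-*-Solver)
  import Data.Nat.Solver
  open import Data.Nat.Base as ℕ using (ℕ; zero; suc; s≤s; _!)
  open import Data.Nat.Combinatorics using (_C_)
  open import Data.Nat.DivMod using (m*n/n≡m)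
  import Data.Nat.Divisibility as ℕ
  open import Data.Nat.Primality as ℕ using (Prime)
  import Data.Nat.Properties as ℕ
  open import Relation.Binary.PropositionalEquality as ≡ using (_≡_)
  open import Relation.Nullary.Negation using (¬_)

  C-step : ∀ i j → ((i ℕ.+ suc j) C suc i) ℕ.* suc i ≡ ((i ℕ.+ suc j) C i) ℕ.* suc j
  C-step i j = ℕ.*-cancelʳ-≡ _ _ (i ! ℕ.* j !) {{i ℕ.!* j !≢0}} (begin
    c′ ℕ.* suc i ℕ.* (i ! ℕ.* j !)
      ≡⟨ solve 4 (λ c i a b → c :* i :* (a :* b) := c :* ((i :* a) :* b)) ≡.refl c′ (suc i) (i !) (j !) ⟩
    c′ ℕ.* (suc i ! ℕ.* j !)
      ≡⟨ ≡.cong (λ n → (n C suc i) ℕ.* (suc i ! ℕ.* j !)) (ℕ.+-suc i j) ⟩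
    ((suc i ℕ.+ j) C suc i) ℕ.* (suc i ! ℕ.* j !)
      ≡⟨ C-factorial (suc i) j ⟩
    (suc i ℕ.+ j) !
      ≡⟨ ≡.cong _! (≡.sym (ℕ.+-suc i j)) ⟩
    (i ℕ.+ suc j) !
      ≡⟨ C-factorial i (suc j) ⟨
    c ℕ.* (i ! ℕ.* suc j !)
      ≡⟨ solve 4 (λ c j a b → c :* (a :* (j :* b)) := c :* j :* (a :* b)) ≡.refl c (suc j) (i !) (j !) ⟩
    c ℕ.* suc j ℕ.* (i ! ℕ.* j !) ∎)
    where
    open ≡.≡-Reasoning
    open Data.Nat.Solver.+-*-Solver
    c  = (i ℕ.+ suc j) C i
    c′ = (i ℕ.+ suc j) C suc i

  sign : ℕ → ℤ
  sign i = -[1+ 0 ] ℤ.^ i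

  -- Modulo p = 10K + 1 = 2h + 1 the binomial coefficient of -1/2 over i is that of h.
  J-mod : ∀ h i j → i ℕ.+ j ≡ h →
          + J i ≡ sign i ℤ.* + (h C i) ℤ.* + ((i ℕ.* 10) !) [mod 1 ℕ.+ 2 ℕ.* h ]
  J-mod h zero    j e = ≡⇒mod ≡.refl
  J-mod h (suc i) j e = mod-trans
    (mod-trans (≡⇒mod J-suc) (mod-*-congˡ (+ a) (mod-*-congˡ (+ ρ) (J-mod h i (suc j) e′))))
    (mod (divides (+ ρ ℤ.* sign i ℤ.* + F ℤ.* (+ 5 ℤ.* + c)) difference))
    where
    open ≡.≡-Reasoning
    a = 5 ℕ.* (2 ℕ.* i ℕ.+ 1)
    b = 10 ℕ.+ i ℕ.* 10
    ρ = rising (i ℕ.* 10) 9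
    F = (i ℕ.* 10) !
    c = h C i
    c′ = h C suc i
    e′ : i ℕ.+ suc j ≡ h
    e′ = ≡.trans (ℕ.+-suc i j) e
    J-suc : + J (suc i) ≡ + a ℤ.* (+ ρ ℤ.* + J i)
    J-suc = ≡.trans (ℤ.pos-* a (ρ ℕ.* J i)) (≡.cong (ℤ._*_ (+ a)) (ℤ.pos-* ρ (J i)))
    F-suc : + ((suc i ℕ.* 10) !) ≡ + b ℤ.* (+ ρ ℤ.* + F)
    F-suc = ≡.trans (ℤ.pos-* b ((9 ℕ.+ i ℕ.* 10) !)) (≡.cong (ℤ._*_ (+ b))
      (≡.trans (≡.cong +_ (≡.sym (rising-! (i ℕ.* 10) 9))) (ℤ.pos-* ρ F)))
    -- By c′ (i + 1) = c (h - i) the two terms are 5c(2i + 1) and 10c(h - i), whose sum contains the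
    -- modulus 1 + 2h.
    key : a ℕ.* c ℕ.+ b ℕ.* c′ ≡ 5 ℕ.* c ℕ.* (1 ℕ.+ 2 ℕ.* h)
    key = begin
      a ℕ.* c ℕ.+ b ℕ.* c′
        ≡⟨ solve 3 (λ i c d → con 5 :* (con 2 :* i :+ con 1) :* c :+ (con 10 :+ i :* con 10) :* d
                           := con 5 :* (con 2 :* i :+ con 1) :* c :+ con 10 :* (d :* (con 1 :+ i))) ≡.refl i c c′ ⟩
      a ℕ.* c ℕ.+ 10 ℕ.* (c′ ℕ.* suc i)
        ≡⟨ ≡.cong (λ x → a ℕ.* c ℕ.+ 10 ℕ.* x) (≡.subst (λ h → (h C suc i) ℕ.* suc i ≡ (h C i) ℕ.* suc j) e′ (C-step i j)) ⟩
      a ℕ.* c ℕ.+ 10 ℕ.* (c ℕ.* suc j)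
        ≡⟨ solve 3 (λ i j c → con 5 :* (con 2 :* i :+ con 1) :* c :+ con 10 :* (c :* (con 1 :+ j))
                           := con 5 :* c :* (con 1 :+ con 2 :* (i :+ (con 1 :+ j)))) ≡.refl i j c ⟩
      5 ℕ.* c ℕ.* (1 ℕ.+ 2 ℕ.* (i ℕ.+ suc j))
        ≡⟨ ≡.cong (λ h → 5 ℕ.* c ℕ.* (1 ℕ.+ 2 ℕ.* h)) e′ ⟩
      5 ℕ.* c ℕ.* (1 ℕ.+ 2 ℕ.* h) ∎
      where open Data.Nat.Solver.+-*-Solver
    keyℤ : + a ℤ.* + c ℤ.+ + b ℤ.* + c′ ≡ + 5 ℤ.* + c ℤ.* + (1 ℕ.+ 2 ℕ.* h)
    keyℤ = begin
      + a ℤ.* + c ℤ.+ + b ℤ.* + c′     ≡⟨ ≡.cong₂ ℤ._+_ (≡.sym (ℤ.pos-* a c)) (≡.sym (ℤ.pos-* b c′)) ⟩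
      + (a ℕ.* c ℕ.+ b ℕ.* c′)         ≡⟨ ≡.cong +_ key ⟩
      + (5 ℕ.* c ℕ.* (1 ℕ.+ 2 ℕ.* h))  ≡⟨ ℤ.pos-* (5 ℕ.* c) (1 ℕ.+ 2 ℕ.* h) ⟩
      + (5 ℕ.* c) ℤ.* + (1 ℕ.+ 2 ℕ.* h) ≡⟨ ≡.cong (ℤ._* + (1 ℕ.+ 2 ℕ.* h)) (ℤ.pos-* 5 c) ⟩
      + 5 ℤ.* + c ℤ.* + (1 ℕ.+ 2 ℕ.* h) ∎
    difference : + a ℤ.* (+ ρ ℤ.* (sign i ℤ.* + c ℤ.* + F)) ℤ.- sign (suc i) ℤ.* + c′ ℤ.* + ((suc i ℕ.* 10) !)
               ≡ + ρ ℤ.* sign i ℤ.* + F ℤ.* (+ 5 ℤ.* + c) ℤ.* + (1 ℕ.+ 2 ℕ.* h)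
    difference = begin
      + a ℤ.* (+ ρ ℤ.* (sign i ℤ.* + c ℤ.* + F)) ℤ.- sign (suc i) ℤ.* + c′ ℤ.* + ((suc i ℕ.* 10) !)
        ≡⟨ ≡.cong (λ x → + a ℤ.* (+ ρ ℤ.* (sign i ℤ.* + c ℤ.* + F)) ℤ.- sign (suc i) ℤ.* + c′ ℤ.* x) F-suc ⟩
      + a ℤ.* (+ ρ ℤ.* (sign i ℤ.* + c ℤ.* + F)) ℤ.- -[1+ 0 ] ℤ.* sign i ℤ.* + c′ ℤ.* (+ b ℤ.* (+ ρ ℤ.* + F))
        ≡⟨ solve 7 (λ a b c d r s f → a :* (r :* (s :* c :* f)) :- con -[1+ 0 ] :* s :* d :* (b :* (r :* f))
                     := r :* s :* f :* (a :* c :+ b :* d)) ≡.refl (+ a) (+ b) (+ c) (+ c′) (+ ρ) (sign i) (+ F) ⟩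
      + ρ ℤ.* sign i ℤ.* + F ℤ.* (+ a ℤ.* + c ℤ.+ + b ℤ.* + c′)
        ≡⟨ ≡.cong (ℤ._*_ (+ ρ ℤ.* sign i ℤ.* + F)) keyℤ ⟩
      + ρ ℤ.* sign i ℤ.* + F ℤ.* (+ 5 ℤ.* + c ℤ.* + (1 ℕ.+ 2 ℕ.* h))
        ≡⟨ ℤ.*-assoc (+ ρ ℤ.* sign i ℤ.* + F) (+ 5 ℤ.* + c) (+ (1 ℕ.+ 2 ℕ.* h)) ⟨
      + ρ ℤ.* sign i ℤ.* + F ℤ.* (+ 5 ℤ.* + c) ℤ.* + (1 ℕ.+ 2 ℕ.* h) ∎
      where open +-*-Solver

  -- p = 10K + 1; p - 2 is kept abstract because a coefficient of a product at an
  -- index 10 + n unfolds into 2¹⁰ terms.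
  module HasseInvariant (p-2 K-1 : ℕ) (p-2≡ : p-2 ≡ 9 ℕ.+ K-1 ℕ.* 10) (pr : Prime (suc (suc p-2))) where

    open Frobenius p-2 pr public
    open Hₚ hiding (module Solver)

    K : ℕ
    K = suc K-1

    -- `Dᵖ s` and `D s` have constant terms s p and 1, so this is the only possible factor between
    -- them.
    κ : ℤ
    κ = s p

    -- Differentiating s′² + s¹⁰ = 1 by D and by Dᵖ gives the same linear equation for s′ and Dᵖ s.
    Dᵖs : Dᵖ s ≋ # κ ⊛ D s
    Dᵖs = begin
      Dᵖ s                              ≈⟨ solve 2 (λ a b → a := b :+ (a :- b)) refl (Dᵖ s) (# κ ⊛ D s) ⟩
      # κ ⊛ D s ⊕ e                     ≈⟨ ⊕-congˡ (# κ ⊛ D s) (pointwise (linear-ode {# (+ 2) ⊛ D s} {⊖ (# (+ 10) ⊛ s ^ 9)} {e} cancel-2 e₀ ode)) ⟩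
      # κ ⊛ D s ⊕ (λ _ → + 0)           ≈⟨ pointwise (λ n → ≡⇒mod (ℤ.+-identityʳ _)) ⟩
      # κ ⊛ D s                         ∎
      where
      open ≋-Reasoning
      open Hₚ.Solver
      e = Dᵖ s ⊕ ⊖ (# κ ⊛ D s)
      p∤2 : ¬ (p ℕ.∣ 2)
      p∤2 d with ≡.subst (λ q → suc (suc q) ℕ.≤ 2) p-2≡ (ℕ.∣⇒≤ d)
      ... | s≤s (s≤s ())
      cancel-2 : ∀ a → (+ 2 ℤ.* D s 0) ℤ.* a ≡ + 0 [mod p ] → a ≡ + 0 [mod p ]
      cancel-2 a z = cancel (+ 2) a p∤2
        (≡.subst (λ b → + 2 ℤ.* b ℤ.* a ≡ + 0 [mod p ]) s₁ z)
      e₀ : e 0 ≡ + 0 [mod p ]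
      e₀ = ≡⇒mod (≡.trans (≡.cong₂ (λ n a → s n ℤ.- κ ℤ.* a) (ℕ.+-identityʳ p) s₁)
        (≡.trans (≡.cong (λ a → κ ℤ.- a) (ℤ.*-identityʳ κ)) (ℤ.+-inverseʳ κ)))
      zero-series : (λ _ → + 0) ≋ # (+ 0)
      zero-series = pointwise λ { zero → ≡⇒mod ≡.refl ; (suc n) → ≡⇒mod ≡.refl }
      s′²ₚ : D s ^ 2 ⊕ s ^ 10 ≋ # (+ 1)
      s′²ₚ = reduce s′²
      by-Dᵖ : # (+ 2) ⊛ (D s ^ 1 ⊛ Dᵖ (D s)) ⊕ # (+ 10) ⊛ (s ^ 9 ⊛ Dᵖ s) ≋ # (+ 0)
      by-Dᵖ = begin
        # (+ 2) ⊛ (D s ^ 1 ⊛ Dᵖ (D s)) ⊕ # (+ 10) ⊛ (s ^ 9 ⊛ Dᵖ s)  ≈⟨ ⊕-cong (Dᵖ-^ (D s) 1) (Dᵖ-^ s 9) ⟨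
        Dᵖ (D s ^ 2) ⊕ Dᵖ (s ^ 10)                                ≈⟨ pointwise (λ n → at s′²ₚ (p ℕ.+ n)) ⟩
        (λ _ → + 0)                                               ≈⟨ zero-series ⟩
        # (+ 0)                                                   ∎
      by-D : # (+ 2) ⊛ (D s ^ 1 ⊛ D (D s)) ⊕ # (+ 10) ⊛ (s ^ 9 ⊛ D s) ≋ # (+ 0)
      by-D = begin
        # (+ 2) ⊛ (D s ^ 1 ⊛ D (D s)) ⊕ # (+ 10) ⊛ (s ^ 9 ⊛ D s)  ≈⟨ ⊕-cong (D-^ (D s) 1) (D-^ s 9) ⟨
        D (D s ^ 2) ⊕ D (s ^ 10)                                  ≈⟨ D-cong s′²ₚ ⟩
        (λ _ → + 0)                                               ≈⟨ zero-series ⟩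
        # (+ 0)                                                   ∎
      De : D e ≋ Dᵖ (D s) ⊕ ⊖ (# κ ⊛ D (D s))
      De = ⊕-cong (pointwise λ n → ≡⇒mod (≡.cong s (ℕ.+-suc p n))) (⊖-cong (D-constant-⊛ κ (D s)))
      -- The left side is `by-Dᵖ` minus κ times `by-D`, except that the terms with s⁹ are missing;
      -- these combine to 10 s⁹ e.
      ode : (# (+ 2) ⊛ D s) ⊛ D e ≋ (⊖ (# (+ 10) ⊛ s ^ 9)) ⊛ e
      ode = begin
        (# (+ 2) ⊛ D s) ⊛ D e
          ≈⟨ ⊛-congˡ De ⟩
        (# (+ 2) ⊛ D s) ⊛ (Dᵖ (D s) ⊕ ⊖ (# κ ⊛ D (D s)))
          ≈⟨ solve 6 (λ n d δd dd k δs → (con (+ 2) :* d) :* (δd :- k :* dd)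
                := ((con (+ 2) :* (d :^ 1 :* δd) :+ con (+ 10) :* (n :* δs))
                   :- k :* (con (+ 2) :* (d :^ 1 :* dd) :+ con (+ 10) :* (n :* d)))
                   :+ :- (con (+ 10) :* n) :* (δs :- k :* d))
               refl (s ^ 9) (D s) (Dᵖ (D s)) (D (D s)) (# κ) (Dᵖ s) ⟩
        ((# (+ 2) ⊛ (D s ^ 1 ⊛ Dᵖ (D s)) ⊕ # (+ 10) ⊛ (s ^ 9 ⊛ Dᵖ s))
          ⊕ ⊖ (# κ ⊛ (# (+ 2) ⊛ (D s ^ 1 ⊛ D (D s)) ⊕ # (+ 10) ⊛ (s ^ 9 ⊛ D s))))
          ⊕ ⊖ (# (+ 10) ⊛ s ^ 9) ⊛ e
          ≈⟨ ⊕-congʳ (⊖ (# (+ 10) ⊛ s ^ 9) ⊛ e) (⊕-cong by-Dᵖ (⊖-cong (⊛-congˡ {# κ} by-D))) ⟩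
        (# (+ 0) ⊕ ⊖ (# κ ⊛ # (+ 0))) ⊕ ⊖ (# (+ 10) ⊛ s ^ 9) ⊛ e
          ≈⟨ solve 2 (λ k x → (con (+ 0) :- k :* con (+ 0)) :+ x := x) refl (# κ) (⊖ (# (+ 10) ⊛ s ^ 9) ⊛ e) ⟩
        ⊖ (# (+ 10) ⊛ s ^ 9) ⊛ e ∎

    Dᵖs^ : ∀ k → Dᵖ (s ^ k) ≋ # κ ⊛ D (s ^ k)
    Dᵖs^ zero    = pointwise λ n → mod-sym (mod-trans (constant-⊛ κ (λ _ → + 0) n) (≡⇒mod (ℤ.*-zeroʳ κ)))
    Dᵖs^ (suc k) = begin
      Dᵖ (s ^ suc k)                        ≈⟨ Dᵖ-^ s k ⟩
      # (+ suc k) ⊛ (s ^ k ⊛ Dᵖ s)          ≈⟨ ⊛-congˡ (⊛-congˡ Dᵖs) ⟩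
      # (+ suc k) ⊛ (s ^ k ⊛ (# κ ⊛ D s))   ≈⟨ solve 4 (λ a b c d → a :* (b :* (c :* d)) := c :* (a :* (b :* d))) refl (# (+ suc k)) (s ^ k) (# κ) (D s) ⟩
      # κ ⊛ (# (+ suc k) ⊛ (s ^ k ⊛ D s))   ≈⟨ ⊛-congˡ (D-^ s k) ⟨
      # κ ⊛ D (s ^ suc k)                   ∎
      where
      open ≋-Reasoning
      open Hₚ.Solver

    -- For k < p the factor k! is prime to p, so it can be cancelled from the relation for s^k = k!
    -- γ k s.
    γ-shift : ∀ k → k ℕ.< p → ∀ m → γ k s (p ℕ.+ m) ≡ κ ℤ.* γ k s (suc m) [mod p ]
    γ-shift k k<p m = mod (ℤ-cancel (begin
      + (k !) ℤ.* (γ k s (p ℕ.+ m) ℤ.- κ ℤ.* γ k s (suc m))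
        ≡⟨ solve 4 (λ a x c y → a :* (x :- c :* y) := a :* x :- c :* (a :* y)) ≡.refl (+ (k !)) (γ k s (p ℕ.+ m)) κ (γ k s (suc m)) ⟩
      + (k !) ℤ.* γ k s (p ℕ.+ m) ℤ.- κ ℤ.* (+ (k !) ℤ.* γ k s (suc m))
        ≡⟨ ≡.cong₂ (λ a b → a ℤ.- κ ℤ.* b) (power-γ (p ℕ.+ m)) (power-γ (suc m)) ⟩
      (s ^ k) (p ℕ.+ m) ℤ.- κ ℤ.* D (s ^ k) m
        ≈⟨ mod-+-congʳ (ℤ.- (κ ℤ.* D (s ^ k) m)) (mod-trans (at (Dᵖs^ k) m) (constant-⊛ κ (D (s ^ k)) m)) ⟩
      κ ℤ.* D (s ^ k) m ℤ.- κ ℤ.* D (s ^ k) m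
        ≡⟨ ℤ.+-inverseʳ (κ ℤ.* D (s ^ k) m) ⟩
      + 0 ∎))
      where
      open ≈-Reasoning
      open +-*-Solver
      ℤ-cancel : ∀ {b} → + (k !) ℤ.* b ≡ + 0 [mod p ] → + p ℤ.∣ b
      ℤ-cancel {b} z = mod⇒∣ (cancel (+ (k !)) b (prime∤! pr k k<p) z)
      power-γ : ∀ n → + (k !) ℤ.* γ k s n ≡ (s ^ k) n
      power-γ n = ≡.trans (≡.sym (Hℤ.constant-⊛ (+ (k !)) (γ k s) n)) (≡.sym (Hℤ.at (^-γ s s₀ k) n))

    private
      1+p-2 : suc p-2 ≡ K ℕ.* 10
      1+p-2 = ≡.cong suc p-2≡

    -- The coefficient of s′ E K at p - 1 = 10K is 0. Modulo p it is also κ + J K: the term 1 of `E`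
    -- gives s p, the intermediate terms drop out, and the last one gives J K.
    κ≡-J : κ ≡ ℤ.- (+ J K) [mod p ]
    κ≡-J = begin
      κ                                                ≡⟨ solve 2 (λ k j → k := (k :+ j) :- j) ≡.refl κ (+ J K) ⟩
      (κ ℤ.+ + J K) ℤ.- + J K                          ≈⟨ mod-+-congʳ (ℤ.- (+ J K)) (mod-+-congʳ (+ J K) (partial K-1 ℕ.≤-refl)) ⟨
      ((D s ⊛ E K-1) (suc p-2) ℤ.+ + J K) ℤ.- + J K
                                                       ≈⟨ mod-+-congʳ (ℤ.- (+ J K)) (≡.subst (λ j → (D s ⊛ (E K-1 ⊕ # (+ J K) ⊛ γ j s)) (suc p-2) ≡ (D s ⊛ E K-1) (suc p-2) ℤ.+ + J K [mod p ]) 1+p-2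
                                                           (add-last-term s s₁ (E K-1) (+ J K))) ⟨
      (D s ⊛ E K) (suc p-2) ℤ.- + J K         ≡⟨ ≡.cong (ℤ._- + J K) (s′E-vanish K p-2 (ℕ.≤-trans (ℕ.≤-reflexive 1+p-2) (ℕ.m≤n+m (K ℕ.* 10) 9))) ⟩
      + 0 ℤ.- + J K                                    ≡⟨ ℤ.+-identityˡ (ℤ.- (+ J K)) ⟩
      ℤ.- (+ J K)                                      ∎
      where
      open ≈-Reasoning
      open +-*-Solver
      partial : ∀ L → L ℕ.≤ K-1 → (D s ⊛ E L) (suc p-2) ≡ κ [mod p ]
      partial zero    L≤ = ≡⇒mod (≡.trans (Hℤ.at (Hℤ.⊛-comm (D s) (Hℤ.# (+ 1))) (suc p-2))
        (≡.trans (Hℤ.constant-⊛ (+ 1) (D s) (suc p-2)) (ℤ.*-identityˡ κ)))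
      partial (suc L) L≤ = mod-trans
        (add-term s s₀ (E L) (+ J (suc L)) (9 ℕ.+ L ℕ.* 10)
          (s≤s (≡.subst (11 ℕ.+ L ℕ.* 10 ℕ.≤_) (≡.sym 1+p-2) (ℕ.≤-trans (ℕ.m≤n+m (11 ℕ.+ L ℕ.* 10) 9) (ℕ.*-monoˡ-≤ 10 (s≤s L≤))))))
        (partial L (ℕ.<⇒≤ L≤))

    -- -J K ≡ -(-1)^K binom(5K, K) (p - 1)! and (p - 1)! ≡ -1, where 5K = (p - 1)/2 and K = (p -
    -- 1)/10.
    κ≡A : κ ≡ A p [mod p ]
    κ≡A = begin
      κ                                            ≈⟨ κ≡-J ⟩
      ℤ.- (+ J K)                                  ≈⟨ neg-cong (≡.subst (λ q → + J K ≡ sign K ℤ.* + (h C K) ℤ.* + ((K ℕ.* 10) !) [mod q ]) 1+2h (J-mod h K (4 ℕ.* K) ≡.refl)) ⟩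
      ℤ.- (sign K ℤ.* + (h C K) ℤ.* + ((K ℕ.* 10) !)) ≈⟨ neg-cong (mod-*-congˡ (sign K ℤ.* + (h C K)) K*10!≡-1) ⟩
      ℤ.- (sign K ℤ.* + (h C K) ℤ.* -[1+ 0 ])      ≡⟨ solve 1 (λ a → :- (a :* con -[1+ 0 ]) := a) ≡.refl (sign K ℤ.* + (h C K)) ⟩
      sign K ℤ.* + (h C K)                         ≡⟨ ≡.cong₂ (λ a b → sign a ℤ.* + (b C a)) (≡.trans (≡.cong (ℕ._/ 10) 1+p-2) (m*n/n≡m K 10)) half≡h ⟨
      A p                                          ∎
      where
      open ≈-Reasoning
      open +-*-Solver
      h = 5 ℕ.* K
      neg-cong : ∀ {a b} → a ≡ b [mod p ] → ℤ.- a ≡ ℤ.- b [mod p ]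
      neg-cong = CommutativeRing.-‿cong (ℤ/ p)
      1+2h : 1 ℕ.+ 2 ℕ.* (5 ℕ.* K) ≡ p
      1+2h = ≡.cong suc (≡.trans (≡.sym (ℕ.*-assoc 2 5 K)) (≡.trans (ℕ.*-comm 10 K) (≡.sym 1+p-2)))
      half≡h : suc p-2 ℕ./ 2 ≡ h
      half≡h = ≡.trans (≡.cong (ℕ._/ 2) (≡.trans 1+p-2 (≡.trans (≡.sym (ℕ.*-assoc K 5 2)) (≡.cong (ℕ._* 2) (ℕ.*-comm K 5))))) (m*n/n≡m h 2)
      even : ∀ k → alternating (k ℕ.* 10) ≡ + 1
      even zero    = ≡.refl
      even (suc k) = even k
      K*10!≡-1 : + ((K ℕ.* 10) !) ≡ -[1+ 0 ] [mod p ]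
      K*10!≡-1 = ≡.subst (λ n → + (n !) ≡ -[1+ 0 ] [mod p ]) 1+p-2
        (wilson (≡.trans (≡.cong alternating 1+p-2) (even K)))

-- Divisibility of J by 24 and by composite numbers 10k + 1

module CoefficientFactors where

  open HurwitzSeries
  open DividedPowers
  open InverseExpansion
  open import Data.Empty using (⊥-elim)
  open import Data.Integer.Base as ℤ using (+_)
  open import Data.Integer.Divisibility.Signed as ℤ using (divides)
  open import Data.Integer.Solver using (module +-*-Solver)
  import Data.Nat.Solver
  open import Data.Nat.Base as ℕ using (ℕ; zero; suc; z≤n; s≤s)
  import Data.Nat.DivMod as ℕ
  import Data.Nat.Divisibility as ℕ
  open import Data.Nat.Primality as ℕ using (Prime; composite; ¬prime⇒composite)
  import Data.Nat.Properties as ℕ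
  open import Data.Product.Base using (_,_; ∃-syntax)
  open import Data.Sum.Base using (_⊎_; inj₁; inj₂)
  open import Relation.Binary.Definitions using (tri<; tri≈; tri>)
  open import Relation.Binary.PropositionalEquality as ≡ using (_≡_; _≢_)
  open import Relation.Nullary.Negation using (¬_; contradiction)

  -- 1 · 3 · 5 ⋯ (2h - 1)
  oddProduct : ℕ → ℕ
  oddProduct zero    = 1
  oddProduct (suc h) = (2 ℕ.* h ℕ.+ 1) ℕ.* oddProduct h

  -- What remains of J (k + 1)/J k, with t = 10k, after the odd numbers t + 1, ..., t + 9 are
  -- removed: four even numbers and the multiplier 5(2k + 1) = t + 5.
  evenFactor : ℕ → ℕ
  evenFactor t = (2 ℕ.+ t) ℕ.* (4 ℕ.+ t) ℕ.* (6 ℕ.+ t) ℕ.* (8 ℕ.+ t) ℕ.* (5 ℕ.+ t)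

  evenPart : ℕ → ℕ
  evenPart zero    = 1
  evenPart (suc k) = evenFactor (k ℕ.* 10) ℕ.* evenPart k

  J-factors : ∀ k → J k ≡ oddProduct (k ℕ.* 5) ℕ.* evenPart k
  J-factors zero    = ≡.refl
  J-factors (suc k) = ≡.trans (≡.cong₂ ℕ._*_ five (≡.cong (rising t 9 ℕ.*_) (J-factors k)))
    (≡.trans (rearrange t (oddProduct (k ℕ.* 5)) (evenPart k)) (≡.cong (ℕ._* evenPart (suc k)) (≡.sym odds)))
    where
    open Data.Nat.Solver.+-*-Solver
    t = k ℕ.* 10
    five : 5 ℕ.* (2 ℕ.* k ℕ.+ 1) ≡ 5 ℕ.+ t
    five = solve 1 (λ k → con 5 :* (con 2 :* k :+ con 1) := con 5 :+ k :* con 10) ≡.refl k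
    odd : ∀ i → 2 ℕ.* (i ℕ.+ k ℕ.* 5) ℕ.+ 1 ≡ (1 ℕ.+ 2 ℕ.* i) ℕ.+ t
    odd i = solve 2 (λ i k → con 2 :* (i :+ k :* con 5) :+ con 1 := (con 1 :+ con 2 :* i) :+ k :* con 10) ≡.refl i k
    odds : oddProduct (suc k ℕ.* 5) ≡
           (9 ℕ.+ t) ℕ.* ((7 ℕ.+ t) ℕ.* ((5 ℕ.+ t) ℕ.* ((3 ℕ.+ t) ℕ.* ((1 ℕ.+ t) ℕ.* oddProduct (k ℕ.* 5)))))
    odds = ≡.cong₂ ℕ._*_ (odd 4) (≡.cong₂ ℕ._*_ (odd 3) (≡.cong₂ ℕ._*_ (odd 2) (≡.cong₂ ℕ._*_ (odd 1) (≡.cong (ℕ._* oddProduct (k ℕ.* 5)) (odd 0)))))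
    rearrange : ∀ t o e → (5 ℕ.+ t) ℕ.* (rising t 9 ℕ.* (o ℕ.* e)) ≡
      (9 ℕ.+ t) ℕ.* ((7 ℕ.+ t) ℕ.* ((5 ℕ.+ t) ℕ.* ((3 ℕ.+ t) ℕ.* ((1 ℕ.+ t) ℕ.* o)))) ℕ.*
      ((2 ℕ.+ t) ℕ.* (4 ℕ.+ t) ℕ.* (6 ℕ.+ t) ℕ.* (8 ℕ.+ t) ℕ.* (5 ℕ.+ t) ℕ.* e)
    rearrange t o e = solve 11 (λ a₁ a₂ a₃ a₄ a₅ a₆ a₇ a₈ a₉ o e →
      a₅ :* ((a₉ :* (a₈ :* (a₇ :* (a₆ :* (a₅ :* (a₄ :* (a₃ :* (a₂ :* (a₁ :* con 1))))))))) :* (o :* e))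
      := a₉ :* (a₇ :* (a₅ :* (a₃ :* (a₁ :* o)))) :* (a₂ :* a₄ :* a₆ :* a₈ :* a₅ :* e)) ≡.refl
      (1 ℕ.+ t) (2 ℕ.+ t) (3 ℕ.+ t) (4 ℕ.+ t) (5 ℕ.+ t) (6 ℕ.+ t) (7 ℕ.+ t) (8 ℕ.+ t) (9 ℕ.+ t) o e

  -- The first block 2 · 4 · 6 · 8 · 5 = 1920 = 80 · 24 remains a factor of every later value.
  24∣evenPart : ∀ k → 24 ℕ.∣ evenPart (suc k)
  24∣evenPart zero    = ℕ.divides 80 ≡.refl
  24∣evenPart (suc k) = ℕ.∣n⇒∣m*n (evenFactor (suc k ℕ.* 10)) (24∣evenPart k)

  odd∣oddProduct : ∀ {a h} → a ℕ.< h → 2 ℕ.* a ℕ.+ 1 ℕ.∣ oddProduct h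
  odd∣oddProduct {a} {suc h} (s≤s a≤h) with ℕ.m≤n⇒m<n∨m≡n a≤h
  ... | inj₁ a<h    = ℕ.∣n⇒∣m*n (2 ℕ.* h ℕ.+ 1) (odd∣oddProduct a<h)
  ... | inj₂ ≡.refl = ℕ.m∣m*n (oddProduct h)

  odds∣oddProduct : ∀ {a b h} → a ℕ.< b → b ℕ.< h → (2 ℕ.* a ℕ.+ 1) ℕ.* (2 ℕ.* b ℕ.+ 1) ℕ.∣ oddProduct h
  odds∣oddProduct {a} {b} {suc h} a<b (s≤s b≤h) with ℕ.m≤n⇒m<n∨m≡n b≤h
  ... | inj₁ b<h    = ℕ.∣n⇒∣m*n (2 ℕ.* h ℕ.+ 1) (odds∣oddProduct a<b b<h)
  ... | inj₂ ≡.refl = ≡.subst (ℕ._∣ oddProduct (suc h)) (ℕ.*-comm (2 ℕ.* h ℕ.+ 1) (2 ℕ.* a ℕ.+ 1))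
                        (ℕ.*-monoʳ-∣ (2 ℕ.* h ℕ.+ 1) (odd∣oddProduct a<b))

  even⊎odd : ∀ n → ∃[ a ] (n ≡ 2 ℕ.* a ⊎ n ≡ 2 ℕ.* a ℕ.+ 1)
  even⊎odd zero    = 0 , inj₁ ≡.refl
  even⊎odd (suc n) with even⊎odd n
  ... | a , inj₁ e = a , inj₂ (≡.trans (≡.cong suc e) (ℕ.+-comm 1 (2 ℕ.* a)))
  ... | a , inj₂ e = suc a , inj₁ (≡.trans (≡.cong suc e) (solve 1 (λ a → con 1 :+ (con 2 :* a :+ con 1) := con 2 :* (con 1 :+ a)) ≡.refl a))
    where open Data.Nat.Solver.+-*-Solver

  private
    half-product : ∀ a b h → (2 ℕ.* a ℕ.+ 1) ℕ.* (2 ℕ.* b ℕ.+ 1) ≡ 1 ℕ.+ 2 ℕ.* h → a ℕ.+ b ℕ.+ 2 ℕ.* (a ℕ.* b) ≡ h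
    half-product a b h e = ℕ.*-cancelˡ-≡ _ _ 2 (ℕ.suc-injective (≡.trans
      (solve 2 (λ a b → con 1 :+ con 2 :* (a :+ b :+ con 2 :* (a :* b)) := (con 2 :* a :+ con 1) :* (con 2 :* b :+ con 1)) ≡.refl a b) e))
      where open Data.Nat.Solver.+-*-Solver

    larger<h : ∀ a b h → a ℕ.+ 1 ℕ.+ b ℕ.+ 2 ℕ.* ((a ℕ.+ 1) ℕ.* b) ≡ h → b ℕ.< h
    larger<h a b h e = ≡.subst (suc b ℕ.≤_) (≡.trans
      (solve 2 (λ a b → (con 1 :+ b) :+ (a :+ con 2 :* ((a :+ con 1) :* b)) := a :+ con 1 :+ b :+ con 2 :* ((a :+ con 1) :* b)) ≡.refl a b) e)
      (ℕ.m≤m+n (suc b) _)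
      where open Data.Nat.Solver.+-*-Solver

  distinct∣oddProduct : ∀ a b h → a ℕ.< b → (2 ℕ.* suc a ℕ.+ 1) ℕ.* (2 ℕ.* suc b ℕ.+ 1) ≡ 1 ℕ.+ 2 ℕ.* h →
                        1 ℕ.+ 2 ℕ.* h ℕ.∣ oddProduct h
  distinct∣oddProduct a b h a<b e = ≡.subst (ℕ._∣ oddProduct h) e (odds∣oddProduct (s≤s a<b)
    (larger<h a (suc b) h (≡.subst (λ a → a ℕ.+ suc b ℕ.+ 2 ℕ.* (a ℕ.* suc b) ≡ h) (ℕ.+-comm 1 a) (half-product (suc a) (suc b) h e))))

  -- A divisor pair d e = 2h + 1 occurs in 1 · 3 · 5 ⋯ (2h - 1) as d and e, or as d and 3d if d = e.
  composite∣oddProduct : ∀ h → h ≢ 0 → h ≢ 4 → ¬ Prime (1 ℕ.+ 2 ℕ.* h) → 1 ℕ.+ 2 ℕ.* h ℕ.∣ oddProduct h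
  composite∣oddProduct h h≢0 h≢4 ¬prime with ¬prime⇒composite {{ℕ.n>1⇒nonTrivial (1<N h h≢0)}} ¬prime
    where
    1<N : ∀ h → h ≢ 0 → 1 ℕ.< 1 ℕ.+ 2 ℕ.* h
    1<N zero    h≢0 = contradiction ≡.refl h≢0
    1<N (suc h) _   = s≤s (s≤s z≤n)
  ... | composite {d} d<N (ℕ.divides e N≡e*d) = by-parity (even⊎odd d) (even⊎odd e)
    where
    N = 1 ℕ.+ 2 ℕ.* h
    odd : ¬ (2 ℕ.∣ N)
    odd 2∣N = contradiction (ℕ.∣⇒≤ (ℕ.∣m+n∣m⇒∣n (≡.subst (2 ℕ.∣_) (ℕ.+-comm 1 (2 ℕ.* h)) 2∣N) (ℕ.m∣m*n h))) λ { (s≤s ()) }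
    by-order : ∀ a b → (2 ℕ.* suc a ℕ.+ 1) ℕ.* (2 ℕ.* suc b ℕ.+ 1) ≡ N → N ℕ.∣ oddProduct h
    by-order a b eq with ℕ.<-cmp a b
    ... | tri< a<b _ _ = distinct∣oddProduct a b h a<b eq
    ... | tri> _ _ b<a = distinct∣oddProduct b a h b<a (≡.trans (ℕ.*-comm (2 ℕ.* suc b ℕ.+ 1) (2 ℕ.* suc a ℕ.+ 1)) eq)
    ... | tri≈ _ ≡.refl _ = square a (half-product (suc a) (suc a) h eq) eq
      where
      open Data.Nat.Solver.+-*-Solver
      square : ∀ a → suc a ℕ.+ suc a ℕ.+ 2 ℕ.* (suc a ℕ.* suc a) ≡ h → (2 ℕ.* suc a ℕ.+ 1) ℕ.* (2 ℕ.* suc a ℕ.+ 1) ≡ N → N ℕ.∣ oddProduct h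
      -- N = 9 = 3 · 3 is a true exception: 3d is then N itself, and 1 · 3 · 5 · 7 is not divisible
      -- by 9.
      square zero    4≡h eq = contradiction (≡.sym 4≡h) h≢4
      -- Here d = 2c + 5 has index c + 2 and 3d = 6c + 15 has index 3c + 7; their product is 3N.
      square (suc c) h≡  eq = ℕ.∣-trans (≡.subst (N ℕ.∣_) triple (ℕ.m∣m*n 3))
        (odds∣oddProduct {2 ℕ.+ c} {7 ℕ.+ 3 ℕ.* c} (s≤s (s≤s (s≤s (ℕ.≤-trans (ℕ.m≤n*m c 3) (ℕ.m≤n+m (3 ℕ.* c) 4)))))
          (≡.subst (8 ℕ.+ 3 ℕ.* c ℕ.≤_) (≡.trans
            (solve 1 (λ c → (con 8 :+ con 3 :* c) :+ (con 4 :+ con 7 :* c :+ con 2 :* (c :* c))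
              := (con 2 :+ c) :+ (con 2 :+ c) :+ con 2 :* ((con 2 :+ c) :* (con 2 :+ c))) ≡.refl c) h≡)
            (ℕ.m≤m+n (8 ℕ.+ 3 ℕ.* c) _)))
        where
        triple : N ℕ.* 3 ≡ (2 ℕ.* (2 ℕ.+ c) ℕ.+ 1) ℕ.* (2 ℕ.* (7 ℕ.+ 3 ℕ.* c) ℕ.+ 1)
        triple = ≡.trans (≡.cong (ℕ._* 3) (≡.sym eq))
          (solve 1 (λ c → (con 2 :* (con 2 :+ c) :+ con 1) :* (con 2 :* (con 2 :+ c) :+ con 1) :* con 3
            := (con 2 :* (con 2 :+ c) :+ con 1) :* (con 2 :* (con 7 :+ con 3 :* c) :+ con 1)) ≡.refl c)
    by-parity : ∃[ a ] (d ≡ 2 ℕ.* a ⊎ d ≡ 2 ℕ.* a ℕ.+ 1) → ∃[ a ] (e ≡ 2 ℕ.* a ⊎ e ≡ 2 ℕ.* a ℕ.+ 1) → N ℕ.∣ oddProduct h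
    by-parity (a , inj₁ ≡.refl) _ = ⊥-elim (odd (ℕ.∣-trans (ℕ.m∣m*n a) (ℕ.divides e N≡e*d)))
    by-parity _ (b , inj₁ ≡.refl) = ⊥-elim (odd (ℕ.∣-trans (ℕ.m∣m*n b) (≡.subst (2 ℕ.* b ℕ.∣_) (≡.sym N≡e*d) (ℕ.m∣m*n d))))
    by-parity (zero , inj₂ ≡.refl) _ = contradiction (ℕ.nonTrivial⇒n>1 1) λ { (s≤s ()) }
    by-parity _ (zero , inj₂ ≡.refl) = contradiction (≡.trans N≡e*d (ℕ.*-identityˡ d)) (ℕ.<⇒≢ d<N ∘ ≡.sym)
      where open import Function.Base using (_∘_)
    by-parity (suc a , inj₂ ≡.refl) (suc b , inj₂ ≡.refl) = by-order b a (≡.sym N≡e*d)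

-- Residues of the terms of u/s modulo 10k + 1

module Residues where

  open import Defs using (A; Contributes)
  open HurwitzSeries
  open DividedPowers
  open InverseExpansion
  open ModPrime
  open HasseInvariants
  open CoefficientFactors
  open import Algebra.Bundles using (CommutativeRing)
  open import Data.Integer.Base as ℤ using (ℤ; +_)
  import Data.Integer.Properties as ℤ
  open import Data.Integer.Divisibility.Signed as ℤ using (divides)
  open import Data.Integer.Solver using (module +-*-Solver)
  import Data.Nat.Solver
  open import Data.Nat.Base as ℕ using (ℕ; zero; suc)
  open import Data.Nat.DivMod as ℕ using (m*n/n≡m; m≡m%n+[m/n]*n; m%n<n; [m+kn]%n≡m%n)
  import Data.Nat.Divisibility as ℕ
  open import Data.Nat.Primality as ℕ using (Prime; prime?)
  import Data.Nat.Properties as ℕ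
  open import Data.Product.Base using (_,_)
  open import Relation.Binary.PropositionalEquality as ≡ using (_≡_; _≢_)
  open import Relation.Nullary.Decidable using (yes; no)
  open import Relation.Nullary.Negation using (¬_; contradiction)

  1+10k : ∀ k → 1 ℕ.+ 2 ℕ.* (k ℕ.* 5) ≡ suc (k ℕ.* 10)
  1+10k k = ≡.cong suc (solve 1 (λ k → con 2 :* (k :* con 5) := k :* con 10) ≡.refl k)
    where open Data.Nat.Solver.+-*-Solver

  abstract
    -- The factor 24 is taken entirely out of `evenPart`, so that `oddProduct` remains intact. J 0 =
    -- 1 is not a multiple of 24; the sum `τ` starts at k = 1.
    J/24 : ℕ → ℕ
    J/24 zero    = 0
    J/24 (suc k) = oddProduct (suc k ℕ.* 5) ℕ.* ℕ.quotient (24∣evenPart k)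

    24*J/24 : ∀ k → J (suc k) ≡ 24 ℕ.* J/24 (suc k)
    24*J/24 k = ≡.trans (J-factors (suc k)) (≡.trans (≡.cong (oddProduct (suc k ℕ.* 5) ℕ.*_) (ℕ._∣_.equality (24∣evenPart k)))
      (solve 2 (λ o q → o :* (q :* con 24) := con 24 :* (o :* q)) ≡.refl (oddProduct (suc k ℕ.* 5)) (ℕ.quotient (24∣evenPart k))))
      where open Data.Nat.Solver.+-*-Solver

    composite∣J/24 : ∀ k → ¬ Prime (suc (suc k ℕ.* 10)) → suc (suc k ℕ.* 10) ℕ.∣ J/24 (suc k)
    composite∣J/24 k ¬prime = ℕ.∣m⇒∣m*n (ℕ.quotient (24∣evenPart k)) (≡.subst (ℕ._∣ oddProduct (suc k ℕ.* 5)) (1+10k (suc k))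
      (composite∣oddProduct (suc k ℕ.* 5) (λ ()) (λ ()) (λ pr → ¬prime (≡.subst Prime (1+10k (suc k)) pr))))

  module Residue (p-2 K-1 : ℕ) (p-2≡ : p-2 ≡ 9 ℕ.+ K-1 ℕ.* 10) (pr : Prime (suc (suc p-2))) where

    open HasseInvariant p-2 K-1 p-2≡ pr

    private
      L : ℕ
      L = suc p-2

      -- As p + i = (p - 1) + (i + 1), the relation lowers an index by p - 1 at the cost of a factor
      -- κ, provided that the result is positive.
      γ-step : ∀ i → γ L s (L ℕ.+ suc i) ≡ κ ℤ.* γ L s (suc i) [mod p ]
      γ-step i = ≡.subst (λ n → γ L s n ≡ κ ℤ.* γ L s (suc i) [mod p ]) (≡.sym (ℕ.+-suc L i)) (γ-shift L (ℕ.n<1+n L) i)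

    γ-multiple : ∀ j → γ L s (suc j ℕ.* L) ≡ κ ℤ.^ j [mod p ]
    γ-multiple zero    = ≡⇒mod (≡.trans (≡.cong (γ L s) (ℕ.*-identityˡ L)) (γ-leading s s₁ L))
    γ-multiple (suc j) = mod-trans (γ-step (p-2 ℕ.+ j ℕ.* L)) (mod-*-congˡ κ (γ-multiple j))

    -- Repeated lowering by p - 1 ends at the remainder r with 0 < r < p - 1, where s^(p-1)/(p-1)!
    -- still vanishes. The condition r ≠ 0 keeps all indices positive on the way.
    γ-nonmultiple : ∀ n → ¬ (L ℕ.∣ n) → γ L s n ≡ + 0 [mod p ]
    γ-nonmultiple n L∤n = ≡.subst (λ n → γ L s n ≡ + 0 [mod p ]) (≡.sym (m≡m%n+[m/n]*n n L)) (by-quotient (n ℕ./ L))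
      where
      r : ℕ
      r = n ℕ.% L
      r≢0 : r ≢ 0
      r≢0 r≡0 = L∤n (ℕ.m%n≡0⇒n∣m n L r≡0)
      step : ∀ r q → r ≢ 0 → γ L s (r ℕ.+ q ℕ.* L) ≡ + 0 [mod p ] → γ L s (r ℕ.+ suc q ℕ.* L) ≡ + 0 [mod p ]
      step zero    q r≢0 _  = contradiction ≡.refl r≢0
      step (suc r) q _   ih = ≡.subst (λ n → γ L s n ≡ + 0 [mod p ]) (swap (suc r) L (q ℕ.* L))
        (mod-trans (γ-step (r ℕ.+ q ℕ.* L)) (mod-trans (mod-*-congˡ κ ih) (≡⇒mod (ℤ.*-zeroʳ κ))))
        where
        swap : ∀ r L m → L ℕ.+ (r ℕ.+ m) ≡ r ℕ.+ (L ℕ.+ m)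
        swap = solve 3 (λ r L m → L :+ (r :+ m) := r :+ (L :+ m)) ≡.refl
          where open Data.Nat.Solver.+-*-Solver
      by-quotient : ∀ q → γ L s (r ℕ.+ q ℕ.* L) ≡ + 0 [mod p ]
      by-quotient zero    = ≡⇒mod (≡.trans (≡.cong (γ L s) (ℕ.+-identityʳ r)) (γ-vanish s L r (m%n<n n L)))
      by-quotient (suc q) = step r q r≢0 (by-quotient q)

    -- 24 J/24 = J ≡ - κ, and κ ≡ A p
    J/24-γ : ∀ a → + p ℤ.∣ + 24 ℤ.* a ℤ.- + 1 → ∀ j →
             + p ℤ.∣ + J/24 K ℤ.* γ L s (suc j ℕ.* L) ℤ.+ a ℤ.* A p ℤ.^ suc j
    J/24-γ a inv j = mod⇒∣ (begin
      + J/24 K ℤ.* γ L s (suc j ℕ.* L) ℤ.+ a ℤ.* A p ℤ.^ suc j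
        ≈⟨ CommutativeRing.+-cong (ℤ/ p) (mod-*-congˡ (+ J/24 K) (γ-multiple j)) (mod-*-congˡ a (power-cong (suc j) (mod-sym κ≡A))) ⟩
      + J/24 K ℤ.* κ ℤ.^ j ℤ.+ a ℤ.* (κ ℤ.* κ ℤ.^ j)
        ≡⟨ solve 4 (λ b x a k → b :* x :+ a :* (k :* x) := (b :+ a :* k) :* x) ≡.refl (+ J/24 K) (κ ℤ.^ j) a κ ⟩
      (+ J/24 K ℤ.+ a ℤ.* κ) ℤ.* κ ℤ.^ j
        ≈⟨ mod-*-congʳ (κ ℤ.^ j) vanishes ⟩
      + 0 ℤ.* κ ℤ.^ j
        ≡⟨ ℤ.*-zeroˡ (κ ℤ.^ j) ⟩
      + 0 ∎)
      where
      open Hₚ.≈-Reasoning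
      open +-*-Solver
      power-cong : ∀ j {x y} → x ≡ y [mod p ] → x ℤ.^ j ≡ y ℤ.^ j [mod p ]
      power-cong zero    e = ≡⇒mod ≡.refl
      power-cong (suc j) e = CommutativeRing.*-cong (ℤ/ p) e (power-cong j e)
      24a≡1 : + 24 ℤ.* a ≡ + 1 [mod p ]
      24a≡1 = mod inv
      vanishes : + J/24 K ℤ.+ a ℤ.* κ ≡ + 0 [mod p ]
      vanishes = begin
        + J/24 K ℤ.+ a ℤ.* κ                        ≈⟨ mod-+-congˡ (+ J/24 K) (mod-*-congˡ a κ≡-J) ⟩
        + J/24 K ℤ.+ a ℤ.* (ℤ.- (+ J K))            ≡⟨ ≡.cong (λ n → + J/24 K ℤ.+ a ℤ.* (ℤ.- n)) (≡.trans (≡.cong +_ (24*J/24 K-1)) (ℤ.pos-* 24 (J/24 K))) ⟩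
        + J/24 K ℤ.+ a ℤ.* (ℤ.- (+ 24 ℤ.* + J/24 K)) ≡⟨ solve 2 (λ b a → b :+ a :* (:- (con (+ 24) :* b)) := b :- con (+ 24) :* a :* b) ≡.refl (+ J/24 K) a ⟩
        + J/24 K ℤ.- + 24 ℤ.* a ℤ.* + J/24 K        ≈⟨ mod-+-congˡ (+ J/24 K) (CommutativeRing.-‿cong (ℤ/ p) (mod-*-congʳ (+ J/24 K) 24a≡1)) ⟩
        + J/24 K ℤ.- + 1 ℤ.* + J/24 K               ≡⟨ solve 1 (λ b → b :- con (+ 1) :* b := con (+ 0)) ≡.refl (+ J/24 K) ⟩
        + 0                                         ∎

  p%5≡1 : ∀ k → suc (k ℕ.* 10) ℕ.% 5 ≡ 1
  p%5≡1 k = ≡.trans (≡.cong (λ n → suc n ℕ.% 5) (solve 1 (λ k → k :* con 10 := (k :* con 2) :* con 5) ≡.refl k)) ([m+kn]%n≡m%n 1 (k ℕ.* 2) 5)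
    where open Data.Nat.Solver.+-*-Solver

  -- A composite modulus divides `J/24`. For a prime modulus p the congruence modulo 5 is automatic,
  -- so not contributing means that p - 1 does not divide N, and then p divides the divided power's
  -- coefficient.
  integral-term : ∀ N k → ¬ Contributes N (suc (suc k ℕ.* 10)) →
                  + suc (suc k ℕ.* 10) ℤ.∣ + J/24 (suc k) ℤ.* γ (suc k ℕ.* 10) s N
  integral-term N k ¬contributes with prime? (suc (suc k ℕ.* 10))
  ... | no ¬prime = ℤ.∣m⇒∣m*n {+ suc (suc k ℕ.* 10)} {+ J/24 (suc k)} (γ (suc k ℕ.* 10) s N) (ℤ.∣ᵤ⇒∣ (composite∣J/24 k ¬prime))
  ... | yes pr    = ℤ.∣n⇒∣m*n {+ suc (suc k ℕ.* 10)} (+ J/24 (suc k)) {γ (suc k ℕ.* 10) s N} (mod⇒∣ (by-residue (9 ℕ.+ k ℕ.* 10) ≡.refl pr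
    (λ d → ¬contributes (pr , p%5≡1 (suc k) , d))))
    where
    by-residue : ∀ p-2 → p-2 ≡ 9 ℕ.+ k ℕ.* 10 → Prime (suc (suc p-2)) → ¬ (suc p-2 ℕ.∣ N) → γ (suc p-2) s N ≡ + 0 [mod suc (suc p-2) ]
    by-residue p-2 p-2≡ pr = Residue.γ-nonmultiple p-2 k p-2≡ pr N

  fractional-term : ∀ N k → N ≢ 0 → Contributes N (suc (suc k ℕ.* 10)) →
                    ∀ a → + suc (suc k ℕ.* 10) ℤ.∣ + 24 ℤ.* a ℤ.- + 1 →
                    + suc (suc k ℕ.* 10) ℤ.∣ + J/24 (suc k) ℤ.* γ (suc k ℕ.* 10) s N
                      ℤ.+ a ℤ.* A (suc (suc k ℕ.* 10)) ℤ.^ (N ℕ./ (suc k ℕ.* 10))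
  fractional-term N k N≢0 (pr , _ , L∣N) = by-residue (9 ℕ.+ k ℕ.* 10) ≡.refl pr L∣N
    where
    by-residue : ∀ p-2 → p-2 ≡ 9 ℕ.+ k ℕ.* 10 → Prime (suc (suc p-2)) → suc p-2 ℕ.∣ N →
      ∀ a → + suc (suc p-2) ℤ.∣ + 24 ℤ.* a ℤ.- + 1 →
      + suc (suc p-2) ℤ.∣ + J/24 (suc k) ℤ.* γ (suc p-2) s N ℤ.+ a ℤ.* A (suc (suc p-2)) ℤ.^ (N ℕ./ suc p-2)
    by-residue p-2 p-2≡ pr (ℕ.divides zero    N≡) a inv = contradiction N≡ N≢0
    by-residue p-2 p-2≡ pr (ℕ.divides (suc j) N≡) a inv =
      ≡.subst₂ (λ n i → + suc (suc p-2) ℤ.∣ + J/24 (suc k) ℤ.* γ (suc p-2) s n ℤ.+ a ℤ.* A (suc (suc p-2)) ℤ.^ i)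
        (≡.sym N≡) (≡.trans (≡.sym (m*n/n≡m (suc j) (suc p-2))) (≡.cong (ℕ._/ suc p-2) (≡.sym N≡)))
        (Residue.J/24-γ p-2 k p-2≡ pr a inv j)

-- Passage to rational coefficients

module RationalSeries where

  open HurwitzSeries
  open DividedPowers
  open InverseExpansion
  open import Algebra.Bundles using (CommutativeRing)
  open import Algebra.Solver.Ring.AlmostCommutativeRing using (fromCommutativeRing; _-Raw-AlmostCommutative⟶_)
  open import Data.Integer.Base as ℤ using (ℤ; +_; -[1+_])
  import Data.Integer.Properties as ℤ
  open import Data.Nat.Base as ℕ using (ℕ; zero; suc; NonZero)
  import Data.Nat.Properties as ℕ
  open import Data.Rational.Base as ℚ using (ℚ; 0ℚ; 1ℚ)
  import Data.Rational.Properties as ℚ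
  open import Data.Rational.Unnormalised.Base as ℚᵘ using (mkℚᵘ; *≡*)
  import Data.Rational.Unnormalised.Properties as ℚᵘ
  import Data.Rational.Solver
  open import Relation.Binary.PropositionalEquality as ≡ using (_≡_)

  ι : ℤ → ℚ
  ι a = a ℚ./ 1

  private
    toℚᵘ-/ : ∀ a n → ℚ.toℚᵘ (a ℚ./ suc n) ℚᵘ.≃ mkℚᵘ a n
    toℚᵘ-/ a n = ℚ.toℚᵘ-fromℚᵘ (mkℚᵘ a n)

  ι-+ : ∀ a b → ι (a ℤ.+ b) ≡ ι a ℚ.+ ι b
  ι-+ a b = ℚ.toℚᵘ-injective (begin
    ℚ.toℚᵘ (ι (a ℤ.+ b))            ≈⟨ toℚᵘ-/ (a ℤ.+ b) 0 ⟩
    mkℚᵘ (a ℤ.+ b) 0                ≈⟨ *≡* (≡.cong (ℤ._* + 1) (≡.sym (≡.cong₂ ℤ._+_ (ℤ.*-identityʳ a) (ℤ.*-identityʳ b)))) ⟩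
    mkℚᵘ a 0 ℚᵘ.+ mkℚᵘ b 0          ≈⟨ ℚᵘ.+-cong (toℚᵘ-/ a 0) (toℚᵘ-/ b 0) ⟨
    ℚ.toℚᵘ (ι a) ℚᵘ.+ ℚ.toℚᵘ (ι b)  ≈⟨ ℚ.toℚᵘ-homo-+ (ι a) (ι b) ⟨
    ℚ.toℚᵘ (ι a ℚ.+ ι b)            ∎)
    where open ℚᵘ.≃-Reasoning

  ι-* : ∀ a b → ι (a ℤ.* b) ≡ ι a ℚ.* ι b
  ι-* a b = ℚ.toℚᵘ-injective (begin
    ℚ.toℚᵘ (ι (a ℤ.* b))            ≈⟨ toℚᵘ-/ (a ℤ.* b) 0 ⟩
    mkℚᵘ a 0 ℚᵘ.* mkℚᵘ b 0          ≈⟨ ℚᵘ.*-cong (toℚᵘ-/ a 0) (toℚᵘ-/ b 0) ⟨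
    ℚ.toℚᵘ (ι a) ℚᵘ.* ℚ.toℚᵘ (ι b)  ≈⟨ ℚ.toℚᵘ-homo-* (ι a) (ι b) ⟨
    ℚ.toℚᵘ (ι a ℚ.* ι b)            ∎)
    where open ℚᵘ.≃-Reasoning

  ι-neg : ∀ a → ι (ℤ.- a) ≡ ℚ.- ι a
  ι-neg a = ℚ.toℚᵘ-injective (begin
    ℚ.toℚᵘ (ι (ℤ.- a))   ≈⟨ toℚᵘ-/ (ℤ.- a) 0 ⟩
    ℚᵘ.- mkℚᵘ a 0        ≈⟨ ℚᵘ.-‿cong (toℚᵘ-/ a 0) ⟨
    ℚᵘ.- ℚ.toℚᵘ (ι a)    ≈⟨ ℚ.toℚᵘ-homo‿- (ι a) ⟨
    ℚ.toℚᵘ (ℚ.- ι a)     ∎)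
    where open ℚᵘ.≃-Reasoning

  ι-*-/ : ∀ a d .{{_ : NonZero d}} → ι (+ d) ℚ.* (a ℚ./ d) ≡ ι a
  ι-*-/ a d@(suc n) = ℚ.toℚᵘ-injective (begin
    ℚ.toℚᵘ (ι (+ d) ℚ.* (a ℚ./ d))            ≈⟨ ℚ.toℚᵘ-homo-* (ι (+ d)) (a ℚ./ d) ⟩
    ℚ.toℚᵘ (ι (+ d)) ℚᵘ.* ℚ.toℚᵘ (a ℚ./ d)    ≈⟨ ℚᵘ.*-cong (toℚᵘ-/ (+ d) 0) (toℚᵘ-/ a n) ⟩
    mkℚᵘ (+ d) 0 ℚᵘ.* mkℚᵘ a n                ≈⟨ *≡* (≡.trans (ℤ.*-identityʳ (+ d ℤ.* a)) (≡.trans (ℤ.*-comm (+ d) a) (≡.cong (λ m → a ℤ.* + suc m) (≡.sym (ℕ.+-identityʳ n))))) ⟩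
    mkℚᵘ a 0                                  ≈⟨ toℚᵘ-/ a 0 ⟨
    ℚ.toℚᵘ (ι a)                              ∎)
    where open ℚᵘ.≃-Reasoning

  ι-cancel : ∀ d .{{_ : NonZero d}} {a b} → ι (+ d) ℚ.* a ≡ ι (+ d) ℚ.* b → a ≡ b
  ι-cancel d {a} {b} e = ≡.trans (≡.sym (undo a)) (≡.trans (≡.cong ((+ 1 ℚ./ d) ℚ.*_) e) (undo b))
    where
    undo : ∀ a → (+ 1 ℚ./ d) ℚ.* (ι (+ d) ℚ.* a) ≡ a
    undo a = begin
      (+ 1 ℚ./ d) ℚ.* (ι (+ d) ℚ.* a)   ≡⟨ ℚ.*-assoc (+ 1 ℚ./ d) (ι (+ d)) a ⟨
      (+ 1 ℚ./ d) ℚ.* ι (+ d) ℚ.* a     ≡⟨ ≡.cong (ℚ._* a) (≡.trans (ℚ.*-comm (+ 1 ℚ./ d) (ι (+ d))) (ι-*-/ (+ 1) d)) ⟩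
      1ℚ ℚ.* a                          ≡⟨ ℚ.*-identityˡ a ⟩
      a                                 ∎
      where open ≡.≡-Reasoning

  ℤ⟶ℚ : CommutativeRing.rawRing ℤ.+-*-commutativeRing -Raw-AlmostCommutative⟶ fromCommutativeRing ℚ.+-*-commutativeRing
  ℤ⟶ℚ = record
    { ⟦_⟧    = ι
    ; +-homo = ι-+
    ; *-homo = ι-*
    ; -‿homo = ι-neg
    ; 0-homo = ≡.refl
    ; 1-homo = ≡.refl
    }

  module Hℚ = Hurwitz ℚ.+-*-commutativeRing ℤ⟶ℚ
  open Hℚ hiding (module Solver)

  lift : Hℤ.Series → Series
  lift f n = ι (f n)

  lift-≋ : ∀ {f g} → f Hℤ.≋ g → lift f ≋ lift g
  lift-≋ p = pointwise λ n → ≡.cong ι (Hℤ.at p n)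

  lift-⊛ : ∀ f g → lift (f Hℤ.⊛ g) ≋ lift f ⊛ lift g
  lift-⊛ f g = pointwise (lift-⊛ₙ f g)
    where
    lift-⊛ₙ : ∀ f g n → lift (f Hℤ.⊛ g) n ≡ (lift f ⊛ lift g) n
    lift-⊛ₙ f g zero    = ι-* (f 0) (g 0)
    lift-⊛ₙ f g (suc n) = ≡.trans (ι-+ ((Hℤ.D f Hℤ.⊛ g) n) ((f Hℤ.⊛ Hℤ.D g) n))
      (≡.cong₂ ℚ._+_ (lift-⊛ₙ (Hℤ.D f) g n) (lift-⊛ₙ f (Hℤ.D g) n))

  lift-⊕ : ∀ f g → lift (f Hℤ.⊕ g) ≋ lift f ⊕ lift g
  lift-⊕ f g = pointwise λ n → ι-+ (f n) (g n)

  lift-⊖ : ∀ f → lift (Hℤ.⊖ f) ≋ ⊖ lift f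
  lift-⊖ f = pointwise λ n → ι-neg (f n)

  lift-# : ∀ a → lift (Hℤ.# a) ≋ # a
  lift-# a = pointwise λ { zero → ≡.refl ; (suc n) → ≡.refl }

  lift-^ : ∀ f k → lift (f Hℤ.^ k) ≋ lift f ^ k
  lift-^ f zero    = lift-# (+ 1)
  lift-^ f (suc k) = trans (lift-⊛ f (f Hℤ.^ k)) (⊛-congˡ (lift-^ f k))

  U : Series
  U zero    = 0ℚ
  U (suc n) = (# (+ 1)) n

  -- In this basis u · uⁿ/n! = (n + 1) u^(n+1)/(n+1)!.
  U-⊛ : ∀ f n → (U ⊛ f) (suc n) ≡ ι (+ suc n) ℚ.* f n
  U-⊛ f zero = ≡.trans (≡.cong₂ ℚ._+_ (constant-⊛ 1ℚ f 0) (ℚ.*-zeroˡ (f 1))) (ℚ.+-identityʳ (1ℚ ℚ.* f 0))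
  U-⊛ f (suc n) = begin
    (# (+ 1) ⊛ f) (suc n) ℚ.+ (U ⊛ D f) (suc n)   ≡⟨ ≡.cong₂ ℚ._+_ (constant-⊛ 1ℚ f (suc n)) (U-⊛ (D f) n) ⟩
    1ℚ ℚ.* f (suc n) ℚ.+ ι (+ suc n) ℚ.* f (suc n) ≡⟨ ℚ.*-distribʳ-+ (f (suc n)) 1ℚ (ι (+ suc n)) ⟨
    (1ℚ ℚ.+ ι (+ suc n)) ℚ.* f (suc n)             ≡⟨ ≡.cong (ℚ._* f (suc n)) (ι-+ (+ 1) (+ suc n)) ⟨
    ι (+ suc (suc n)) ℚ.* f (suc n)                ∎
    where open ≡.≡-Reasoning

  U-⊛-D : ∀ f n → (U ⊛ D f) n ≡ ι (+ n) ℚ.* f n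
  U-⊛-D f zero    = ≡.trans (ℚ.*-zeroˡ (f 1)) (≡.sym (ℚ.*-zeroˡ (f 0)))
  U-⊛-D f (suc n) = U-⊛ (D f) n

  S : Series
  S = lift s

  S′² : D S ^ 2 ⊕ S ^ 10 ≋ # (+ 1)
  S′² = begin
    D S ^ 2 ⊕ S ^ 10                              ≈⟨ ⊕-cong (lift-^ (Hℤ.D s) 2) (lift-^ s 10) ⟨
    lift (Hℤ.D s Hℤ.^ 2) ⊕ lift (s Hℤ.^ 10)       ≈⟨ lift-⊕ (Hℤ.D s Hℤ.^ 2) (s Hℤ.^ 10) ⟨
    lift (Hℤ.D s Hℤ.^ 2 Hℤ.⊕ s Hℤ.^ 10)           ≈⟨ lift-≋ s′² ⟩
    lift (Hℤ.# (+ 1))                             ≈⟨ lift-# (+ 1) ⟩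
    # (+ 1)                                       ∎
    where open ≋-Reasoning

  S″ : D (D S) ≋ # -[1+ 4 ] ⊛ S ^ 9
  S″ = trans (lift-≋ s″) (trans (lift-⊛ (Hℤ.# -[1+ 4 ]) (s Hℤ.^ 9)) (⊛-cong (lift-# -[1+ 4 ]) (lift-^ s 9)))

  G K : Series
  G = lift xRem
  K = lift yRem

  lift-1-s′ : lift (Hℤ.# (+ 1) Hℤ.⊕ Hℤ.⊖ Hℤ.D s) ≋ # (+ 1) ⊕ ⊖ D S
  lift-1-s′ = trans (lift-⊕ (Hℤ.# (+ 1)) (Hℤ.⊖ Hℤ.D s)) (⊕-cong (lift-# (+ 1)) (lift-⊖ (Hℤ.D s)))

  2S²G : # (+ 2) ⊛ (S ^ 2 ⊛ G) ≋ # (+ 2) ⊛ (# (+ 1) ⊕ ⊖ D S)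
  2S²G = begin
    # (+ 2) ⊛ (S ^ 2 ⊛ G)
      ≈⟨ ⊛-cong (lift-# (+ 2)) (trans (lift-⊛ (s Hℤ.^ 2) xRem) (⊛-congʳ (lift-^ s 2))) ⟨
    lift (Hℤ.# (+ 2)) ⊛ lift (s Hℤ.^ 2 Hℤ.⊛ xRem)
      ≈⟨ lift-⊛ (Hℤ.# (+ 2)) (s Hℤ.^ 2 Hℤ.⊛ xRem) ⟨
    lift (Hℤ.# (+ 2) Hℤ.⊛ (s Hℤ.^ 2 Hℤ.⊛ xRem))
      ≈⟨ lift-≋ 2s²xRem ⟩
    lift (Hℤ.# (+ 2) Hℤ.⊛ (Hℤ.# (+ 1) Hℤ.⊕ Hℤ.⊖ Hℤ.D s))
      ≈⟨ lift-⊛ (Hℤ.# (+ 2)) (Hℤ.# (+ 1) Hℤ.⊕ Hℤ.⊖ Hℤ.D s) ⟩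
    lift (Hℤ.# (+ 2)) ⊛ lift (Hℤ.# (+ 1) Hℤ.⊕ Hℤ.⊖ Hℤ.D s)
      ≈⟨ ⊛-cong (lift-# (+ 2)) lift-1-s′ ⟩
    # (+ 2) ⊛ (# (+ 1) ⊕ ⊖ D S) ∎
    where
    open ≋-Reasoning

  24S⁴K : # (+ 24) ⊛ (S ^ 4 ⊛ K) ≋ # (+ 6) ⊛ (# (+ 1) ⊕ ⊖ D S) ⊕ # (+ 21) ⊛ (S ^ 10 ⊛ D S)
  24S⁴K = begin
    # (+ 24) ⊛ (S ^ 4 ⊛ K)
      ≈⟨ ⊛-cong (lift-# (+ 24)) (trans (lift-⊛ (s Hℤ.^ 4) yRem) (⊛-congʳ (lift-^ s 4))) ⟨
    lift (Hℤ.# (+ 24)) ⊛ lift (s Hℤ.^ 4 Hℤ.⊛ yRem)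
      ≈⟨ lift-⊛ (Hℤ.# (+ 24)) (s Hℤ.^ 4 Hℤ.⊛ yRem) ⟨
    lift (Hℤ.# (+ 24) Hℤ.⊛ (s Hℤ.^ 4 Hℤ.⊛ yRem))
      ≈⟨ lift-≋ 24s⁴yRem ⟩
    lift (a Hℤ.⊕ b)
      ≈⟨ lift-⊕ a b ⟩
    lift a ⊕ lift b
      ≈⟨ ⊕-cong (trans (lift-⊛ (Hℤ.# (+ 6)) (Hℤ.# (+ 1) Hℤ.⊕ Hℤ.⊖ Hℤ.D s)) (⊛-cong (lift-# (+ 6)) lift-1-s′))
                (trans (lift-⊛ (Hℤ.# (+ 21)) (s Hℤ.^ 10 Hℤ.⊛ Hℤ.D s)) (⊛-cong (lift-# (+ 21))
                  (trans (lift-⊛ (s Hℤ.^ 10) (Hℤ.D s)) (⊛-congʳ (lift-^ s 10))))) ⟩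
    # (+ 6) ⊛ (# (+ 1) ⊕ ⊖ D S) ⊕ # (+ 21) ⊛ (S ^ 10 ⊛ D S) ∎
    where
    open ≋-Reasoning
    a = Hℤ.# (+ 6) Hℤ.⊛ (Hℤ.# (+ 1) Hℤ.⊕ Hℤ.⊖ Hℤ.D s)
    b = Hℤ.# (+ 21) Hℤ.⊛ (s Hℤ.^ 10 Hℤ.⊛ Hℤ.D s)

  -- s/u
  w : Series
  w n = S (suc n) ℚ.* (+ 1 ℚ./ suc n)

  S≋Uw : S ≋ U ⊛ w
  S≋Uw = pointwise λ
    { zero    → ≡.trans (≡.cong ι s₀) (≡.sym (ℚ.*-zeroˡ (w 0)))
    ; (suc n) → ≡.sym (≡.trans (U-⊛ w n) (undo (S (suc n)) n))
    }
    where
    undo : ∀ a n → ι (+ suc n) ℚ.* (a ℚ.* (+ 1 ℚ./ suc n)) ≡ a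
    undo a n = begin
      ι (+ suc n) ℚ.* (a ℚ.* (+ 1 ℚ./ suc n))  ≡⟨ solve 3 (λ i a j → i :* (a :* j) := a :* (i :* j)) ≡.refl (ι (+ suc n)) a (+ 1 ℚ./ suc n) ⟩
      a ℚ.* (ι (+ suc n) ℚ.* (+ 1 ℚ./ suc n))  ≡⟨ ≡.cong (a ℚ.*_) (ι-*-/ (+ 1) (suc n)) ⟩
      a ℚ.* 1ℚ                                 ≡⟨ ℚ.*-identityʳ a ⟩
      a                                        ∎
      where
      open ≡.≡-Reasoning
      open Data.Rational.Solver.+-*-Solver

  w₀ : w 0 ≡ 1ℚ
  w₀ rewrite s₁ = ≡.refl

  DS≋ : D S ≋ w ⊕ U ⊛ D w
  DS≋ = trans (D-cong S≋Uw) (⊕-congʳ (U ⊛ D w) (solve 1 (λ w → con (+ 1) :* w := w) refl w))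
    where open Hℚ.Solver

-- The relations between x, y and s

module ExpansionAtInfinity where

  open HurwitzSeries
  open DividedPowers
  open RationalSeries
  open import Data.Integer.Base as ℤ using (ℤ; +_; -[1+_])
  import Data.Integer.Properties as ℤ
  open import Data.Nat.Base as ℕ using (ℕ; zero; suc)
  import Data.Nat.Properties as ℕ
  open import Data.Rational.Base as ℚ using (ℚ; 0ℚ; 1ℚ)
  import Data.Rational.Properties as ℚ
  import Data.Rational.Solver
  open import Relation.Binary.PropositionalEquality as ≡ using (_≡_)
  open Hℚ hiding (module Solver)

  -- The equation says 4(n + 1)a = 0: the only exponent at which a lowest term could start is -1.
  indicial : ∀ n a → ι -[1+ 3 ] ℚ.* (ι (+ n) ℚ.* a) ≡ ι (+ 4) ℚ.* a → a ≡ 0ℚ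
  indicial n a eq = ι-cancel (4 ℕ.* suc n) (begin
    ι (+ (4 ℕ.* suc n)) ℚ.* a
      ≡⟨ ≡.cong (ℚ._* a) (≡.trans (≡.cong ι (ℤ.pos-* 4 (suc n))) (≡.trans (ι-* (+ 4) (+ suc n)) (≡.cong (ι (+ 4) ℚ.*_) (ι-+ (+ 1) (+ n))))) ⟩
    ι (+ 4) ℚ.* (1ℚ ℚ.+ ι (+ n)) ℚ.* a
      ≡⟨ solve 2 (λ n a → con (ι (+ 4)) :* (con 1ℚ :+ n) :* a := con (ι (+ 4)) :* a :- con (ι -[1+ 3 ]) :* (n :* a)) ≡.refl (ι (+ n)) a ⟩
    ι (+ 4) ℚ.* a ℚ.- ι -[1+ 3 ] ℚ.* (ι (+ n) ℚ.* a)
      ≡⟨ ≡.cong (λ b → ι (+ 4) ℚ.* a ℚ.- b) eq ⟩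
    ι (+ 4) ℚ.* a ℚ.- ι (+ 4) ℚ.* a
      ≡⟨ ℚ.+-inverseʳ (ι (+ 4) ℚ.* a) ⟩
    0ℚ
      ≡⟨ ℚ.*-zeroʳ (ι (+ (4 ℕ.* suc n))) ⟨
    ι (+ (4 ℕ.* suc n)) ℚ.* 0ℚ ∎)
    where
    open ≡.≡-Reasoning
    open Data.Rational.Solver.+-*-Solver

  -- X = u²x and Y = u⁵y
  module Expansion (X Y : Series) (X₀ : X 0 ≡ 1ℚ)
    (curve : Y ^ 2 ⊕ U ^ 10 ≋ X ^ 5)
    (parameter : X ⊛ (U ⊛ D X ⊕ ⊖ (# (+ 2) ⊛ X)) ≋ # (+ 2) ⊛ Y) where

    open ≋-Reasoning
    open Hℚ.Solver

    private
      -- z = s²x; the differential equation forces z = 1.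
      z B A P Q e : Series
      z = X ⊛ w ^ 2
      B = U ⊛ D X ⊕ ⊖ (# (+ 2) ⊛ X)
      A = S ⊛ D z ⊕ ⊖ (# (+ 2) ⊛ (z ⊛ D S))
      P = z ^ 2 ⊛ (S ⊛ D z ⊕ ⊖ (# (+ 4) ⊛ (z ⊛ D S)))
      Q = # (+ 4) ⊛ z ^ 4 ⊕ # (+ 4) ⊛ (S ^ 10 ⊛ ((# (+ 1) ⊕ z) ⊛ (# (+ 1) ⊕ z ^ 2)))
      e = z ⊕ ⊖ (# (+ 1))

      -- From x = z/s² one has A = s³x′, and from x = X/u² one has B = u³x′; the quotient is (s/u)³.
      A≋ : A ≋ w ^ 3 ⊛ B
      A≋ = begin
        S ⊛ (D X ⊛ w ^ 2 ⊕ X ⊛ D (w ^ 2)) ⊕ ⊖ (# (+ 2) ⊛ (z ⊛ D S))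
          ≈⟨ ⊕-cong (⊛-cong S≋Uw (⊕-congˡ (D X ⊛ w ^ 2) (⊛-congˡ (D-^ w 1)))) (⊖-cong (⊛-congˡ (⊛-congˡ {z} DS≋))) ⟩
        (U ⊛ w) ⊛ (D X ⊛ w ^ 2 ⊕ X ⊛ (# (+ 2) ⊛ (w ^ 1 ⊛ D w))) ⊕ ⊖ (# (+ 2) ⊛ (z ⊛ (w ⊕ U ⊛ D w)))
          ≈⟨ solve 5 (λ U x x′ w w′ →
               (U :* w) :* (x′ :* w :^ 2 :+ x :* (con (+ 2) :* (w :^ 1 :* w′))) :- con (+ 2) :* ((x :* w :^ 2) :* (w :+ U :* w′))
               := w :^ 3 :* (U :* x′ :- con (+ 2) :* x)) refl U X (D X) w (D w) ⟩
        w ^ 3 ⊛ B ∎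

      -- This is x²x′² = 4x⁵ - 4 multiplied by s¹⁰, with y eliminated from the two given equations.
      z²A² : z ^ 2 ⊛ A ^ 2 ≋ # (+ 4) ⊛ z ^ 5 ⊕ ⊖ (# (+ 4) ⊛ S ^ 10)
      z²A² = begin
        z ^ 2 ⊛ A ^ 2
          ≈⟨ ⊛-congˡ (⊛-cong A≋ (⊛-congʳ A≋)) ⟩
        z ^ 2 ⊛ (w ^ 3 ⊛ B) ^ 2
          ≈⟨ solve 3 (λ x w b → (x :* w :^ 2) :^ 2 :* (w :^ 3 :* b) :^ 2 := w :^ 10 :* (x :* b) :^ 2) refl X w B ⟩
        w ^ 10 ⊛ (X ⊛ B) ^ 2
          ≈⟨ ⊛-congˡ (⊛-cong parameter (⊛-congʳ parameter)) ⟩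
        w ^ 10 ⊛ (# (+ 2) ⊛ Y) ^ 2
          ≈⟨ solve 3 (λ U w y → w :^ 10 :* (con (+ 2) :* y) :^ 2
               := con (+ 4) :* (w :^ 10 :* (y :^ 2 :+ U :^ 10)) :- con (+ 4) :* (U :* w) :^ 10) refl U w Y ⟩
        # (+ 4) ⊛ (w ^ 10 ⊛ (Y ^ 2 ⊕ U ^ 10)) ⊕ ⊖ (# (+ 4) ⊛ (U ⊛ w) ^ 10)
          ≈⟨ ⊕-cong (⊛-congˡ (⊛-congˡ {w ^ 10} curve)) (⊖-cong (⊛-congˡ (pow-cong 10 (sym S≋Uw)))) ⟩
        # (+ 4) ⊛ (w ^ 10 ⊛ X ^ 5) ⊕ ⊖ (# (+ 4) ⊛ S ^ 10)
          ≈⟨ ⊕-congʳ (⊖ (# (+ 4) ⊛ S ^ 10)) (solve 2 (λ x w → con (+ 4) :* (w :^ 10 :* x :^ 5) := con (+ 4) :* (x :* w :^ 2) :^ 5) refl X w) ⟩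
        # (+ 4) ⊛ z ^ 5 ⊕ ⊖ (# (+ 4) ⊛ S ^ 10) ∎
        where
        pow-cong : ∀ k {f g} → f ≋ g → f ^ k ≋ g ^ k
        pow-cong zero    p = refl
        pow-cong (suc k) p = ⊛-cong p (pow-cong k p)

      -- Expanding z²A² and replacing s′² by 1 - s¹⁰ leaves s z′ P = 4z⁴(z - 1) + 4s¹⁰(z⁴ - 1). The
      -- constant solution z = 1 splits off as the factor z - 1, and s = u w turns s z′ into w · u
      -- e′.
      e-equation : (w ⊛ P) ⊛ (U ⊛ D e) ≋ Q ⊛ e
      e-equation = begin
        (w ⊛ P) ⊛ (U ⊛ D e)
          ≈⟨ ⊛-congˡ (⊛-congˡ {U} De) ⟩
        (w ⊛ P) ⊛ (U ⊛ D z)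
          ≈⟨ solve 4 (λ U w p d → (w :* p) :* (U :* d) := (U :* w) :* d :* p) refl U w P (D z) ⟩
        (U ⊛ w) ⊛ D z ⊛ P
          ≈⟨ ⊛-congʳ (⊛-congʳ S≋Uw) ⟨
        S ⊛ D z ⊛ P
          ≈⟨ solve 4 (λ s s′ z z′ → s :* z′ :* (z :^ 2 :* (s :* z′ :- con (+ 4) :* (z :* s′)))
               := z :^ 2 :* (s :* z′ :- con (+ 2) :* (z :* s′)) :^ 2 :- con (+ 4) :* (z :^ 4 :* (s′ :^ 2 :+ s :^ 10)) :+ con (+ 4) :* (z :^ 4 :* s :^ 10))
               refl S (D S) z (D z) ⟩
        z ^ 2 ⊛ A ^ 2 ⊕ ⊖ (# (+ 4) ⊛ (z ^ 4 ⊛ (D S ^ 2 ⊕ S ^ 10))) ⊕ # (+ 4) ⊛ (z ^ 4 ⊛ S ^ 10)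
          ≈⟨ ⊕-congʳ (# (+ 4) ⊛ (z ^ 4 ⊛ S ^ 10)) (⊕-cong z²A² (⊖-cong (⊛-congˡ (⊛-congˡ {z ^ 4} S′²)))) ⟩
        # (+ 4) ⊛ z ^ 5 ⊕ ⊖ (# (+ 4) ⊛ S ^ 10) ⊕ ⊖ (# (+ 4) ⊛ (z ^ 4 ⊛ # (+ 1))) ⊕ # (+ 4) ⊛ (z ^ 4 ⊛ S ^ 10)
          ≈⟨ solve 2 (λ s z → con (+ 4) :* z :^ 5 :- con (+ 4) :* s :- con (+ 4) :* (z :^ 4 :* con (+ 1)) :+ con (+ 4) :* (z :^ 4 :* s)
               := (con (+ 4) :* z :^ 4 :+ con (+ 4) :* (s :* ((con (+ 1) :+ z) :* (con (+ 1) :+ z :^ 2)))) :* (z :- con (+ 1)))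
               refl (S ^ 10) z ⟩
        Q ⊛ e ∎
        where
        De : D e ≋ D z
        De = pointwise λ n → ℚ.+-identityʳ (D z n)

      z₀ : z 0 ≡ 1ℚ
      z₀ = ≡.cong₂ (λ a b → a ℚ.* (b ℚ.* (b ℚ.* 1ℚ))) X₀ w₀

      S₀ : S 0 ≡ 0ℚ
      S₀ = ≡.cong ι s₀

      S′₀ : D S 0 ≡ 1ℚ
      S′₀ = ≡.cong ι s₁

      wP₀ : (w ⊛ P) 0 ≡ ι -[1+ 3 ]
      wP₀ = ≡.cong₂ ℚ._*_ w₀ (≡.cong₂ ℚ._*_ (≡.cong (λ z → z ℚ.* (z ℚ.* 1ℚ)) z₀)
        (≡.cong₂ (λ a b → a ℚ.+ ℚ.- b) (≡.trans (≡.cong (ℚ._* D z 0) S₀) (ℚ.*-zeroˡ (D z 0)))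
          (≡.cong₂ (λ a b → ι (+ 4) ℚ.* (a ℚ.* b)) z₀ S′₀)))

      Q₀ : Q 0 ≡ ι (+ 4)
      Q₀ = ≡.cong₂ (λ z s → ι (+ 4) ℚ.* (z ℚ.* (z ℚ.* (z ℚ.* (z ℚ.* 1ℚ)))) ℚ.+
             ι (+ 4) ℚ.* (s ℚ.* (s ℚ.* (s ℚ.* (s ℚ.* (s ℚ.* (s ℚ.* (s ℚ.* (s ℚ.* (s ℚ.* (s ℚ.* 1ℚ))))))))) ℚ.*
               ((1ℚ ℚ.+ z) ℚ.* (1ℚ ℚ.+ z ℚ.* (z ℚ.* 1ℚ))))) z₀ S₀

      -- If e vanishes below n, the two sides have coefficients -4n e(n) and 4 e(n) at n, because
      -- `w ⊛ P` and `Q` have constant terms -4 and 4.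
      e≡0 : ∀ n → e n ≡ 0ℚ
      e≡0 = vanish-all step
        where
        step : ∀ n → VanishBelow n e → e n ≡ 0ℚ
        step n below = indicial n (e n) (≡.trans (≡.sym left) (≡.trans (at e-equation n) right))
          where
          right : (Q ⊛ e) n ≡ ι (+ 4) ℚ.* e n
          right = ≡.trans (⊛-leading Q {e} n below) (≡.cong (ℚ._* e n) Q₀)
          below′ : VanishBelow n (U ⊛ D e)
          below′ i i<n = ≡.trans (U-⊛-D e i) (≡.trans (≡.cong (ι (+ i) ℚ.*_) (below i i<n)) (ℚ.*-zeroʳ (ι (+ i))))
          left : ((w ⊛ P) ⊛ (U ⊛ D e)) n ≡ ι -[1+ 3 ] ℚ.* (ι (+ n) ℚ.* e n)
          left = ≡.trans (⊛-leading (w ⊛ P) {U ⊛ D e} n below′) (≡.cong₂ ℚ._*_ wP₀ (U-⊛-D e n))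

      z≋1 : z ≋ # (+ 1)
      z≋1 = begin
        z                        ≈⟨ solve 1 (λ z → z := con (+ 1) :+ (z :- con (+ 1))) refl z ⟩
        # (+ 1) ⊕ e              ≈⟨ ⊕-congˡ (# (+ 1)) (pointwise e≡0) ⟩
        # (+ 1) ⊕ (λ _ → 0ℚ)     ≈⟨ pointwise (λ n → ℚ.+-identityʳ _) ⟩
        # (+ 1)                  ∎

    -- u/s
    v : Series
    v = X ⊛ w

    vw≋1 : v ⊛ w ≋ # (+ 1)
    vw≋1 = trans (solve 2 (λ x w → (x :* w) :* w := x :* w :^ 2) refl X w) z≋1

    X≋v² : X ≋ v ^ 2
    X≋v² = begin
      X                ≈⟨ solve 1 (λ x → x := x :* con (+ 1)) refl X ⟩
      X ⊛ # (+ 1)      ≈⟨ ⊛-congˡ z≋1 ⟨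
      X ⊛ (X ⊛ w ^ 2)  ≈⟨ solve 2 (λ x w → x :* (x :* w :^ 2) := (x :* w) :^ 2) refl X w ⟩
      v ^ 2            ∎

    vS≋U : v ⊛ S ≋ U
    vS≋U = begin
      v ⊛ S            ≈⟨ ⊛-congˡ S≋Uw ⟩
      v ⊛ (U ⊛ w)      ≈⟨ solve 3 (λ U v w → v :* (U :* w) := (v :* w) :* U) refl U v w ⟩
      (v ⊛ w) ⊛ U      ≈⟨ ⊛-congʳ vw≋1 ⟩
      # (+ 1) ⊛ U      ≈⟨ solve 1 (λ U → con (+ 1) :* U := U) refl U ⟩
      U                ∎

    -- u^(k+1) times the derivative of u^(-k) F
    L : ℕ → Series → Series
    L k F = U ⊛ D F ⊕ ⊖ (# (+ k) ⊛ F)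

    L-at : ∀ k F n → L k F n ≡ (ι (+ n) ℚ.- ι (+ k)) ℚ.* F n
    L-at k F n = ≡.trans (≡.cong₂ (λ a b → a ℚ.- b) (U-⊛-D F n) (constant-⊛ (ι (+ k)) F n))
      (QS.solve 3 (λ a b f → a QS.:* f QS.:- b QS.:* f QS.:= (a QS.:- b) QS.:* f) ≡.refl (ι (+ n)) (ι (+ k)) (F n))
      where module QS = Data.Rational.Solver.+-*-Solver

    L-cong : ∀ k {F F′} → F ≋ F′ → L k F ≋ L k F′
    L-cong k p = ⊕-cong (⊛-congˡ (D-cong p)) (⊖-cong (⊛-congˡ p))

    -- As v = u/s, this is u²(1/s)′ = -u²s′/s². The correction terms in the solver identity are
    -- multiples of v w - 1 and of its derivative.
    L₁v : L 1 v ≋ ⊖ (v ^ 2 ⊛ D S)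
    L₁v = begin
      U ⊛ D v ⊕ ⊖ (# (+ 1) ⊛ v)
        ≈⟨ solve 5 (λ U v v′ w w′ → U :* v′ :- con (+ 1) :* v
             := (:- (v :^ 2 :* (w :+ U :* w′)) :+ U :* v :* (v′ :* w :+ v :* w′)) :+ (v :- U :* v′) :* (v :* w :- con (+ 1)))
             refl U v (D v) w (D w) ⟩
      (⊖ (v ^ 2 ⊛ (w ⊕ U ⊛ D w)) ⊕ U ⊛ v ⊛ (D v ⊛ w ⊕ v ⊛ D w)) ⊕ (v ⊕ ⊖ (U ⊛ D v)) ⊛ (v ⊛ w ⊕ ⊖ (# (+ 1)))
        ≈⟨ ⊕-cong (⊕-cong (⊖-cong (⊛-congˡ (sym DS≋))) (⊛-congˡ {U ⊛ v} Dvw))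
                  (⊛-congˡ {v ⊕ ⊖ (U ⊛ D v)} (⊕-congʳ (⊖ (# (+ 1))) vw≋1)) ⟩
      (⊖ (v ^ 2 ⊛ D S) ⊕ U ⊛ v ⊛ # (+ 0)) ⊕ (v ⊕ ⊖ (U ⊛ D v)) ⊛ (# (+ 1) ⊕ ⊖ (# (+ 1)))
        ≈⟨ solve 3 (λ a b c → (a :+ b :* con (+ 0)) :+ c :* (con (+ 1) :- con (+ 1)) := a) refl (⊖ (v ^ 2 ⊛ D S)) (U ⊛ v) (v ⊕ ⊖ (U ⊛ D v)) ⟩
      ⊖ (v ^ 2 ⊛ D S) ∎
      where
      Dvw : D v ⊛ w ⊕ v ⊛ D w ≋ # (+ 0)
      Dvw = trans (D-cong vw≋1) (pointwise λ { zero → ≡.refl ; (suc n) → ≡.refl })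

    -- This is u² times x + (1/s)′ = (1 - s′)/s²: the poles cancel and the integral series `G`
    -- remains.
    C-relation : # (+ 2) ⊛ (X ⊕ L 1 v) ≋ # (+ 2) ⊛ (U ⊛ (U ⊛ G))
    C-relation = begin
      # (+ 2) ⊛ (X ⊕ L 1 v)
        ≈⟨ ⊛-congˡ (⊕-cong X≋v² L₁v) ⟩
      # (+ 2) ⊛ (v ^ 2 ⊕ ⊖ (v ^ 2 ⊛ D S))
        ≈⟨ solve 2 (λ v d → con (+ 2) :* (v :^ 2 :- v :^ 2 :* d) := v :^ 2 :* (con (+ 2) :* (con (+ 1) :- d))) refl v (D S) ⟩
      v ^ 2 ⊛ (# (+ 2) ⊛ (# (+ 1) ⊕ ⊖ D S))
        ≈⟨ ⊛-congˡ 2S²G ⟨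
      v ^ 2 ⊛ (# (+ 2) ⊛ (S ^ 2 ⊛ G))
        ≈⟨ solve 3 (λ v s g → v :^ 2 :* (con (+ 2) :* (s :^ 2 :* g)) := con (+ 2) :* ((v :* s) :* ((v :* s) :* g))) refl v S G ⟩
      # (+ 2) ⊛ ((v ⊛ S) ⊛ ((v ⊛ S) ⊛ G))
        ≈⟨ ⊛-congˡ (⊛-cong vS≋U (⊛-congʳ vS≋U)) ⟩
      # (+ 2) ⊛ (U ⊛ (U ⊛ G)) ∎

    -- s⁻⁴ = x² has the derivative 2x x′ = 4y, so y is reached through a power of 1/s.
    L₄v⁴ : L 4 (v ^ 4) ≋ # (+ 4) ⊛ Y
    L₄v⁴ = begin
      U ⊛ D (v ^ 4) ⊕ ⊖ (# (+ 4) ⊛ v ^ 4)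
        ≈⟨ ⊕-congʳ (⊖ (# (+ 4) ⊛ v ^ 4)) (⊛-congˡ (D-^ v 3)) ⟩
      U ⊛ (# (+ 4) ⊛ (v ^ 3 ⊛ D v)) ⊕ ⊖ (# (+ 4) ⊛ v ^ 4)
        ≈⟨ solve 3 (λ U v v′ → U :* (con (+ 4) :* (v :^ 3 :* v′)) :- con (+ 4) :* v :^ 4
             := con (+ 2) :* (v :^ 2 :* (U :* (con (+ 2) :* (v :^ 1 :* v′)) :- con (+ 2) :* v :^ 2))) refl U v (D v) ⟩
      # (+ 2) ⊛ (v ^ 2 ⊛ (U ⊛ (# (+ 2) ⊛ (v ^ 1 ⊛ D v)) ⊕ ⊖ (# (+ 2) ⊛ v ^ 2)))
        ≈⟨ ⊛-congˡ (⊛-cong X≋v² (⊕-cong (⊛-congˡ (trans (D-cong X≋v²) (D-^ v 1))) (⊖-cong (⊛-congˡ X≋v²)))) ⟨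
      # (+ 2) ⊛ (X ⊛ (U ⊛ D X ⊕ ⊖ (# (+ 2) ⊛ X)))
        ≈⟨ ⊛-congˡ parameter ⟩
      # (+ 2) ⊛ (# (+ 2) ⊛ Y)
        ≈⟨ solve 1 (λ y → con (+ 2) :* (con (+ 2) :* y) := con (+ 4) :* y) refl Y ⟩
      # (+ 4) ⊛ Y ∎

    -- This is u³ times (1/s)″ = 2s′²/s³ - s″/s². With s′² = 1 - s¹⁰ and s″ = -5s⁹ the regular part
    -- is -2s⁷ + 5s⁷ = 3s⁷.
    L₂L₁v : L 2 (L 1 v) ≋ # (+ 2) ⊛ v ^ 3 ⊕ # (+ 3) ⊛ (U ^ 3 ⊛ S ^ 7)
    L₂L₁v = begin
      L 2 (L 1 v)
        ≈⟨ L-cong 2 L₁v ⟩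
      U ⊛ ⊖ (D (v ^ 2) ⊛ D S ⊕ v ^ 2 ⊛ D (D S)) ⊕ ⊖ (# (+ 2) ⊛ ⊖ (v ^ 2 ⊛ D S))
        ≈⟨ ⊕-congʳ (⊖ (# (+ 2) ⊛ ⊖ (v ^ 2 ⊛ D S))) (⊛-congˡ {U} (⊖-cong (⊕-cong (⊛-congʳ {g = D S} (D-^ v 1)) (⊛-congˡ {v ^ 2} S″)))) ⟩
      U ⊛ ⊖ ((# (+ 2) ⊛ (v ^ 1 ⊛ D v)) ⊛ D S ⊕ v ^ 2 ⊛ (# -[1+ 4 ] ⊛ S ^ 9)) ⊕ ⊖ (# (+ 2) ⊛ ⊖ (v ^ 2 ⊛ D S))
        ≈⟨ solve 5 (λ U v v′ s s′ → U :* :- ((con (+ 2) :* (v :^ 1 :* v′)) :* s′ :+ v :^ 2 :* (con -[1+ 4 ] :* s :^ 9)) :- con (+ 2) :* :- (v :^ 2 :* s′)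
             := :- (con (+ 2) :* (v :* s′ :* (U :* v′ :- con (+ 1) :* v))) :+ con (+ 5) :* (U :* (v :* s) :^ 2 :* s :^ 7)) refl U v (D v) S (D S) ⟩
      ⊖ (# (+ 2) ⊛ (v ⊛ D S ⊛ L 1 v)) ⊕ # (+ 5) ⊛ (U ⊛ (v ⊛ S) ^ 2 ⊛ S ^ 7)
        ≈⟨ ⊕-congʳ (# (+ 5) ⊛ (U ⊛ (v ⊛ S) ^ 2 ⊛ S ^ 7)) (⊖-cong (⊛-congˡ {# (+ 2)} (⊛-congˡ {v ⊛ D S} L₁v))) ⟩
      ⊖ (# (+ 2) ⊛ (v ⊛ D S ⊛ ⊖ (v ^ 2 ⊛ D S))) ⊕ # (+ 5) ⊛ (U ⊛ (v ⊛ S) ^ 2 ⊛ S ^ 7)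
        ≈⟨ solve 4 (λ U v s s′ → :- (con (+ 2) :* (v :* s′ :* :- (v :^ 2 :* s′))) :+ con (+ 5) :* (U :* (v :* s) :^ 2 :* s :^ 7)
             := con (+ 2) :* (v :^ 3 :* (s′ :^ 2 :+ s :^ 10)) :- con (+ 2) :* ((v :* s) :* ((v :* s) :* (v :* s)) :* s :^ 7) :+ con (+ 5) :* (U :* ((v :* s) :* (v :* s)) :* s :^ 7)) refl U v S (D S) ⟩
      # (+ 2) ⊛ (v ^ 3 ⊛ (D S ^ 2 ⊕ S ^ 10)) ⊕ ⊖ (# (+ 2) ⊛ ((v ⊛ S) ⊛ ((v ⊛ S) ⊛ (v ⊛ S)) ⊛ S ^ 7)) ⊕ # (+ 5) ⊛ (U ⊛ ((v ⊛ S) ⊛ (v ⊛ S)) ⊛ S ^ 7)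
        ≈⟨ ⊕-cong (⊕-cong (⊛-congˡ {# (+ 2)} (⊛-congˡ {v ^ 3} S′²)) (⊖-cong (⊛-congˡ {# (+ 2)} (⊛-congʳ {g = S ^ 7} (⊛-cong vS≋U (⊛-cong vS≋U vS≋U))))))
                  (⊛-congˡ {# (+ 5)} (⊛-congʳ {g = S ^ 7} (⊛-congˡ {U} (⊛-cong vS≋U vS≋U)))) ⟩
      # (+ 2) ⊛ (v ^ 3 ⊛ # (+ 1)) ⊕ ⊖ (# (+ 2) ⊛ (U ⊛ (U ⊛ U) ⊛ S ^ 7)) ⊕ # (+ 5) ⊛ (U ⊛ (U ⊛ U) ⊛ S ^ 7)
        ≈⟨ solve 3 (λ U v s → con (+ 2) :* (v :^ 3 :* con (+ 1)) :- con (+ 2) :* (U :* (U :* U) :* s) :+ con (+ 5) :* (U :* (U :* U) :* s)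
             := con (+ 2) :* v :^ 3 :+ con (+ 3) :* (U :^ 3 :* s)) refl U v (S ^ 7) ⟩
      # (+ 2) ⊛ v ^ 3 ⊕ # (+ 3) ⊛ (U ^ 3 ⊛ S ^ 7) ∎

    L₃L₂L₁v : L 3 (L 2 (L 1 v)) ≋ ⊖ (# (+ 6) ⊛ (v ^ 4 ⊛ D S)) ⊕ # (+ 21) ⊛ (U ^ 4 ⊛ (S ^ 6 ⊛ D S))
    L₃L₂L₁v = begin
      L 3 (L 2 (L 1 v))
        ≈⟨ L-cong 3 L₂L₁v ⟩
      U ⊛ (D (# (+ 2) ⊛ v ^ 3) ⊕ D (# (+ 3) ⊛ (U ^ 3 ⊛ S ^ 7))) ⊕ ⊖ (# (+ 3) ⊛ F)
        ≈⟨ ⊕-congʳ (⊖ (# (+ 3) ⊛ F)) (⊛-congˡ {U} (⊕-cong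
             (trans (D-constant-⊛ (ι (+ 2)) (v ^ 3)) (⊛-congˡ (D-^ v 2)))
             (trans (D-constant-⊛ (ι (+ 3)) (U ^ 3 ⊛ S ^ 7)) (⊛-congˡ (⊕-cong (⊛-congʳ {g = S ^ 7} (D-^ U 2)) (⊛-congˡ {U ^ 3} (D-^ S 6))))))) ⟩
      U ⊛ (# (+ 2) ⊛ (# (+ 3) ⊛ (v ^ 2 ⊛ D v)) ⊕ # (+ 3) ⊛ ((# (+ 3) ⊛ (U ^ 2 ⊛ # (+ 1))) ⊛ S ^ 7 ⊕ U ^ 3 ⊛ (# (+ 7) ⊛ (S ^ 6 ⊛ D S)))) ⊕ ⊖ (# (+ 3) ⊛ F)
        ≈⟨ solve 5 (λ U v v′ s s′ →
             U :* (con (+ 2) :* (con (+ 3) :* (v :^ 2 :* v′)) :+ con (+ 3) :* ((con (+ 3) :* (U :^ 2 :* con (+ 1))) :* s :^ 7 :+ U :^ 3 :* (con (+ 7) :* (s :^ 6 :* s′))))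
               :- con (+ 3) :* (con (+ 2) :* v :^ 3 :+ con (+ 3) :* (U :^ 3 :* s :^ 7))
             := con (+ 6) :* (v :^ 2 :* (U :* v′ :- con (+ 1) :* v)) :+ con (+ 21) :* (U :^ 4 :* (s :^ 6 :* s′))) refl U v (D v) S (D S) ⟩
      # (+ 6) ⊛ (v ^ 2 ⊛ L 1 v) ⊕ # (+ 21) ⊛ (U ^ 4 ⊛ (S ^ 6 ⊛ D S))
        ≈⟨ ⊕-congʳ (# (+ 21) ⊛ (U ^ 4 ⊛ (S ^ 6 ⊛ D S))) (⊛-congˡ {# (+ 6)} (⊛-congˡ {v ^ 2} L₁v)) ⟩
      # (+ 6) ⊛ (v ^ 2 ⊛ ⊖ (v ^ 2 ⊛ D S)) ⊕ # (+ 21) ⊛ (U ^ 4 ⊛ (S ^ 6 ⊛ D S))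
        ≈⟨ ⊕-congʳ (# (+ 21) ⊛ (U ^ 4 ⊛ (S ^ 6 ⊛ D S))) (solve 2 (λ v d → con (+ 6) :* (v :^ 2 :* :- (v :^ 2 :* d)) := :- (con (+ 6) :* (v :^ 4 :* d))) refl v (D S)) ⟩
      ⊖ (# (+ 6) ⊛ (v ^ 4 ⊛ D S)) ⊕ # (+ 21) ⊛ (U ^ 4 ⊛ (S ^ 6 ⊛ D S)) ∎
      where
      F = # (+ 2) ⊛ v ^ 3 ⊕ # (+ 3) ⊛ (U ^ 3 ⊛ S ^ 7)

    -- Three derivatives give 1/s a pole of the same order as s⁻⁴; the polar part -6s′/s⁴ together
    -- with 6s⁻⁴ becomes 6(1 - s′)/s⁴, which is regular.
    D-relation : L 3 (L 2 (L 1 v)) ⊕ # (+ 6) ⊛ v ^ 4 ≋ # (+ 24) ⊛ (U ⊛ (U ⊛ (U ⊛ (U ⊛ K))))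
    D-relation = begin
      L 3 (L 2 (L 1 v)) ⊕ # (+ 6) ⊛ v ^ 4
        ≈⟨ ⊕-congʳ (# (+ 6) ⊛ v ^ 4) L₃L₂L₁v ⟩
      ⊖ (# (+ 6) ⊛ (v ^ 4 ⊛ D S)) ⊕ # (+ 21) ⊛ (U ^ 4 ⊛ (S ^ 6 ⊛ D S)) ⊕ # (+ 6) ⊛ v ^ 4
        ≈⟨ ⊕-congʳ (# (+ 6) ⊛ v ^ 4) (⊕-congˡ (⊖ (# (+ 6) ⊛ (v ^ 4 ⊛ D S))) (⊛-congˡ {# (+ 21)} (⊛-congʳ {g = S ^ 6 ⊛ D S} U⁴))) ⟨
      ⊖ (# (+ 6) ⊛ (v ^ 4 ⊛ D S)) ⊕ # (+ 21) ⊛ ((v ⊛ S) ^ 4 ⊛ (S ^ 6 ⊛ D S)) ⊕ # (+ 6) ⊛ v ^ 4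
        ≈⟨ solve 3 (λ v s s′ → :- (con (+ 6) :* (v :^ 4 :* s′)) :+ con (+ 21) :* ((v :* s) :^ 4 :* (s :^ 6 :* s′)) :+ con (+ 6) :* v :^ 4
             := v :^ 4 :* (con (+ 6) :* (con (+ 1) :- s′) :+ con (+ 21) :* (s :^ 10 :* s′))) refl v S (D S) ⟩
      v ^ 4 ⊛ (# (+ 6) ⊛ (# (+ 1) ⊕ ⊖ D S) ⊕ # (+ 21) ⊛ (S ^ 10 ⊛ D S))
        ≈⟨ ⊛-congˡ 24S⁴K ⟨
      v ^ 4 ⊛ (# (+ 24) ⊛ (S ^ 4 ⊛ K))
        ≈⟨ solve 3 (λ v s k → v :^ 4 :* (con (+ 24) :* (s :^ 4 :* k)) := con (+ 24) :* ((v :* s) :^ 4 :* k)) refl v S K ⟩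
      # (+ 24) ⊛ ((v ⊛ S) ^ 4 ⊛ K)
        ≈⟨ ⊛-congˡ (⊛-congʳ U⁴) ⟩
      # (+ 24) ⊛ (U ^ 4 ⊛ K)
        ≈⟨ solve 2 (λ U k → con (+ 24) :* (U :^ 4 :* k) := con (+ 24) :* (U :* (U :* (U :* (U :* k))))) refl U K ⟩
      # (+ 24) ⊛ (U ⊛ (U ⊛ (U ⊛ (U ⊛ K)))) ∎
      where
      U⁴ : (v ⊛ S) ^ 4 ≋ U ^ 4
      U⁴ = ⊛-cong vS≋U (⊛-cong vS≋U (⊛-cong vS≋U (⊛-cong vS≋U refl)))

-- Coefficients of u/s and their relation to C and D

module ExpansionCoefficients where

  open HurwitzSeries
  open DividedPowers
  open InverseExpansion
  open Residues
  open RationalSeries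
  open ExpansionAtInfinity
  open import Data.Integer.Base as ℤ using (ℤ; +_)
  import Data.Integer.Properties as ℤ
  open import Data.Nat.Base as ℕ using (ℕ; zero; suc; s≤s; NonZero)
  import Data.Nat.Properties as ℕ
  open import Data.Rational.Base as ℚ using (ℚ; 0ℚ; 1ℚ)
  import Data.Rational.Properties as ℚ
  import Data.Rational.Solver
  open import Relation.Binary.PropositionalEquality as ≡ using (_≡_)
  open Hℚ hiding (module Solver)

  -- the truncated primitive Σ_{k ≤ K} J k s^(10k+1)/(10k+1)! of s′E, which agrees with u
  Θ : ℕ → Hℤ.Series
  Θ zero    = γ 1 s
  Θ (suc K) = Θ K Hℤ.⊕ Hℤ.# (+ J (suc K)) Hℤ.⊛ γ (suc (suc K ℕ.* 10)) s

  D-Θ : ∀ K → Hℤ.D (Θ K) Hℤ.≋ Hℤ.D s Hℤ.⊛ E K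
  D-Θ zero    = Hℤ.⊛-comm (Hℤ.# (+ 1)) (Hℤ.D s)
  D-Θ (suc K) = H.trans
    (H.⊕-cong (D-Θ K) (H.D-constant-⊛ (+ J (suc K)) (γ (suc (suc K ℕ.* 10)) s)))
    (solve 4 (λ d e c g → d :* e :+ c :* (g :* d) := d :* (e :+ c :* g)) H.refl (H.D s) (E K) (H.# (+ J (suc K))) (γ (suc K ℕ.* 10) s))
    where
    module H = Hℤ
    open Hℤ.Solver

  -- Θ K is a primitive of s′ E K, which agrees with 1 up to index 9 + 10K.
  Θ≋U : ∀ K i → i ℕ.< 10 ℕ.+ K ℕ.* 10 → lift (Θ K) (suc i) ≡ U (suc i)
  Θ≋U K zero    _        = ≡.cong ι (≡.trans (Hℤ.at (D-Θ K) 0) (≡.cong₂ ℤ._*_ s₁ (E₀ K)))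
  Θ≋U K (suc i) (s≤s i<) = ≡.cong ι (≡.trans (Hℤ.at (D-Θ K) (suc i)) (s′E-vanish K i i<))

  -- the truncation of u/s
  T : ℕ → Series
  T zero    = # (+ 1)
  T (suc K) = T K ⊕ constant (+ J (suc K) ℚ./ suc (suc K ℕ.* 10)) ⊛ lift (γ (suc K ℕ.* 10) s)

  S⊛lift-γ : ∀ k → S ⊛ lift (γ k s) ≋ # (+ suc k) ⊛ lift (γ (suc k) s)
  S⊛lift-γ k = trans (sym (lift-⊛ s (γ k s))) (trans (lift-≋ (⊛-γ s s₀ k))
    (trans (lift-⊛ (Hℤ.# (+ suc k)) (γ (suc k) s)) (⊛-congʳ (lift-# (+ suc k)))))

  -- Multiplying s^(10k)/(10k)! by s gives 10k + 1 times the next divided power; this is why the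
  -- coefficients of `T` have the denominators 10k + 1.
  ST≋Θ : ∀ K → S ⊛ T K ≋ lift (Θ K)
  ST≋Θ zero = begin
    S ⊛ # (+ 1)            ≈⟨ ⊛-congˡ (lift-# (+ 1)) ⟨
    S ⊛ lift (γ 0 s)       ≈⟨ S⊛lift-γ 0 ⟩
    # (+ 1) ⊛ lift (γ 1 s) ≈⟨ solve 1 (λ g → con (+ 1) :* g := g) refl (lift (γ 1 s)) ⟩
    lift (γ 1 s)           ∎
    where
    open ≋-Reasoning
    open Hℚ.Solver
  ST≋Θ (suc K) = begin
    S ⊛ (T K ⊕ constant c ⊛ lift (γ k s))
      ≈⟨ solve 4 (λ s t c g → s :* (t :+ c :* g) := s :* t :+ c :* (s :* g)) refl S (T K) (constant c) (lift (γ k s)) ⟩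
    S ⊛ T K ⊕ constant c ⊛ (S ⊛ lift (γ k s))
      ≈⟨ ⊕-cong (ST≋Θ K) (⊛-congˡ (S⊛lift-γ k)) ⟩
    lift (Θ K) ⊕ constant c ⊛ (# (+ suc k) ⊛ lift (γ (suc k) s))
      ≈⟨ ⊕-congˡ (lift (Θ K)) (solve 3 (λ c n g → c :* (n :* g) := (n :* c) :* g) refl (constant c) (# (+ suc k)) (lift (γ (suc k) s))) ⟩
    lift (Θ K) ⊕ (# (+ suc k) ⊛ constant c) ⊛ lift (γ (suc k) s)
      ≈⟨ ⊕-congˡ (lift (Θ K)) (⊛-congʳ (trans (sym (constant-* (ι (+ suc k)) c)) (constant-cong (ι-*-/ (+ J (suc K)) (suc k))))) ⟩
    lift (Θ K) ⊕ # (+ J (suc K)) ⊛ lift (γ (suc k) s)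
      ≈⟨ ⊕-congˡ (lift (Θ K)) (trans (lift-⊛ (Hℤ.# (+ J (suc K))) (γ (suc k) s)) (⊛-congʳ (lift-# (+ J (suc K))))) ⟨
    lift (Θ K) ⊕ lift (Hℤ.# (+ J (suc K)) Hℤ.⊛ γ (suc k) s)
      ≈⟨ lift-⊕ (Θ K) (Hℤ.# (+ J (suc K)) Hℤ.⊛ γ (suc k) s) ⟨
    lift (Θ (suc K)) ∎
    where
    open ≋-Reasoning
    open Hℚ.Solver
    k = suc K ℕ.* 10
    c = + J (suc K) ℚ./ suc k

  -- Σ_{1 ≤ k ≤ K} (J k/24) (s^(10k)/(10k)!)(m)/(10k + 1)
  τ : ℕ → ℕ → ℚ
  τ m zero    = 0ℚ
  τ m (suc K) = τ m K ℚ.+ (+ J/24 (suc K) ℤ.* γ (suc K ℕ.* 10) s m) ℚ./ suc (suc K ℕ.* 10)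

  T≡24τ : ∀ m .{{_ : NonZero m}} K → T K m ≡ ι (+ 24) ℚ.* τ m K
  T≡24τ (suc m) zero = ≡.refl
  T≡24τ m (suc K) = ≡.trans (≡.cong₂ ℚ._+_ (T≡24τ m K) term) (≡.sym (ℚ.*-distribˡ-+ (ι (+ 24)) (τ m K) t))
    where
    open ≡.≡-Reasoning
    open Data.Rational.Solver.+-*-Solver
    d = suc (suc K ℕ.* 10)
    j = + J/24 (suc K)
    g = γ (suc K ℕ.* 10) s m
    t = (j ℤ.* g) ℚ./ d
    term : (constant (+ J (suc K) ℚ./ d) ⊛ lift (γ (suc K ℕ.* 10) s)) m ≡ ι (+ 24) ℚ.* t
    term = ≡.trans (constant-⊛ (+ J (suc K) ℚ./ d) (lift (γ (suc K ℕ.* 10) s)) m) (ι-cancel d (begin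
      ι (+ d) ℚ.* ((+ J (suc K) ℚ./ d) ℚ.* ι g)  ≡⟨ ℚ.*-assoc (ι (+ d)) (+ J (suc K) ℚ./ d) (ι g) ⟨
      ι (+ d) ℚ.* (+ J (suc K) ℚ./ d) ℚ.* ι g    ≡⟨ ≡.cong (ℚ._* ι g) (ι-*-/ (+ J (suc K)) d) ⟩
      ι (+ J (suc K)) ℚ.* ι g                    ≡⟨ ≡.cong (λ a → ι a ℚ.* ι g) (≡.trans (≡.cong +_ (24*J/24 K)) (ℤ.pos-* 24 (J/24 (suc K)))) ⟩
      ι (+ 24 ℤ.* j) ℚ.* ι g                     ≡⟨ ≡.cong (ℚ._* ι g) (ι-* (+ 24) j) ⟩
      ι (+ 24) ℚ.* ι j ℚ.* ι g                   ≡⟨ ≡.trans (ℚ.*-assoc (ι (+ 24)) (ι j) (ι g)) (≡.cong (ι (+ 24) ℚ.*_) (≡.sym (ι-* j g))) ⟩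
      ι (+ 24) ℚ.* ι (j ℤ.* g)                   ≡⟨ ≡.cong (ι (+ 24) ℚ.*_) (ι-*-/ (j ℤ.* g) d) ⟨
      ι (+ 24) ℚ.* (ι (+ d) ℚ.* t)               ≡⟨ solve 3 (λ a b c → a :* (b :* c) := b :* (a :* c)) ≡.refl (ι (+ 24)) (ι (+ d)) t ⟩
      ι (+ d) ℚ.* (ι (+ 24) ℚ.* t)               ∎))

  U²-⊛ : ∀ f a → (U ⊛ (U ⊛ f)) (2 ℕ.+ a) ≡ ι (+ (2 ℕ.+ a)) ℚ.* (ι (+ (1 ℕ.+ a)) ℚ.* f a)
  U²-⊛ f a = ≡.trans (U-⊛ (U ⊛ f) (suc a)) (≡.cong (ι (+ (2 ℕ.+ a)) ℚ.*_) (U-⊛ f a))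

  b-[b-a] : ∀ a b → a ≡ b ℚ.- (b ℚ.- a)
  b-[b-a] = solve 2 (λ a b → a := b :- (b :- a)) ≡.refl
    where open Data.Rational.Solver.+-*-Solver

  module Coefficients (X Y : Series) (X₀ : X 0 ≡ 1ℚ)
    (curve : Y ^ 2 ⊕ U ^ 10 ≋ X ^ 5)
    (parameter : X ⊛ (U ⊛ D X ⊕ ⊖ (# (+ 2) ⊛ X)) ≋ # (+ 2) ⊛ Y) where

    open Expansion X Y X₀ curve parameter

    -- u(w T - 1) = s T - u = Θ - u vanishes up to index 10 + 10K, hence w T - 1 vanishes below that
    -- index, and multiplying it by v = 1/w gives T - v.
    v≡T : ∀ K i → i ℕ.< 10 ℕ.+ K ℕ.* 10 → v i ≡ T K i
    v≡T K i i< = ≡.trans (≡.trans (b-[b-a] (v i) (T K i)) (≡.cong (λ a → T K i ℚ.- a) difference≡0)) (ℚ.+-identityʳ (T K i))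
      where
      F : Series
      F = w ⊛ T K ⊕ ⊖ (# (+ 1))
      UF≋ : U ⊛ F ≋ lift (Θ K) ⊕ ⊖ U
      UF≋ = trans (solve 3 (λ u w t → u :* (w :* t :- con (+ 1)) := (u :* w) :* t :- u) refl U w (T K))
        (⊕-congʳ (⊖ U) (trans (⊛-congʳ (sym S≋Uw)) (ST≋Θ K)))
        where open Hℚ.Solver
      F-vanish : VanishBelow (10 ℕ.+ K ℕ.* 10) F
      F-vanish i i< = ι-cancel (suc i) (≡.trans (≡.sym (U-⊛ F i)) (≡.trans (at UF≋ (suc i))
        (≡.trans (≡.cong (λ a → a ℚ.- U (suc i)) (Θ≋U K i i<)) (≡.trans (ℚ.+-inverseʳ (U (suc i))) (≡.sym (ℚ.*-zeroʳ (ι (+ suc i))))))))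
      vF≋ : v ⊛ F ≋ T K ⊕ ⊖ v
      vF≋ = trans (solve 3 (λ v w t → v :* (w :* t :- con (+ 1)) := (v :* w) :* t :- v) refl v w (T K))
        (⊕-congʳ (⊖ v) (trans (⊛-congʳ {g = T K} vw≋1) (solve 1 (λ t → con (+ 1) :* t := t) refl (T K))))
        where open Hℚ.Solver
      difference≡0 : T K i ℚ.- v i ≡ 0ℚ
      difference≡0 = ≡.trans (≡.sym (at vF≋ i)) (⊛-vanish v {F} (10 ℕ.+ K ℕ.* 10) F-vanish i i<)

    -- `L 1` multiplies the coefficient at m by m - 1, and u² G has the coefficient m(m - 1)G(m - 2)
    -- there. Cancelling 2(m - 1) leaves the factor m on the right.
    C-coefficient : ∀ m a c → m ≡ 2 ℕ.+ a → X m ≡ ι (+ (1 ℕ.+ a)) ℚ.* c → c ℚ.+ v m ≡ ι (+ m) ℚ.* G a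
    C-coefficient m a c m≡ X≡ = ι-cancel (1 ℕ.+ a) (ι-cancel 2 (begin
      ι (+ 2) ℚ.* (ι (+ (1 ℕ.+ a)) ℚ.* (c ℚ.+ v m))
        ≡⟨ ≡.cong (λ i → ι (+ 2) ℚ.* (i ℚ.* (c ℚ.+ v m))) (ι-+ (+ 1) (+ a)) ⟩
      ι (+ 2) ℚ.* ((1ℚ ℚ.+ q) ℚ.* (c ℚ.+ v m))
        ≡⟨ solve 3 (λ q c v → con (ι (+ 2)) :* ((con 1ℚ :+ q) :* (c :+ v)) := con (ι (+ 2)) :* ((con 1ℚ :+ q) :* c :+ ((con (ι (+ 2)) :+ q) :- con 1ℚ) :* v)) ≡.refl q c (v m) ⟩
      ι (+ 2) ℚ.* ((1ℚ ℚ.+ q) ℚ.* c ℚ.+ ((ι (+ 2) ℚ.+ q) ℚ.- 1ℚ) ℚ.* v m)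
        ≡⟨ ≡.cong₂ (λ i j → ι (+ 2) ℚ.* (i ℚ.* c ℚ.+ (j ℚ.- 1ℚ) ℚ.* v m)) (ι-+ (+ 1) (+ a)) (≡.trans (≡.cong (λ n → ι (+ n)) m≡) (ι-+ (+ 2) (+ a))) ⟨
      ι (+ 2) ℚ.* (ι (+ (1 ℕ.+ a)) ℚ.* c ℚ.+ (ι (+ m) ℚ.- 1ℚ) ℚ.* v m)
        ≡⟨ ≡.cong₂ (λ x y → ι (+ 2) ℚ.* (x ℚ.+ y)) X≡ (L-at 1 v m) ⟨
      ι (+ 2) ℚ.* (X ⊕ L 1 v) m
        ≡⟨ constant-⊛ (ι (+ 2)) (X ⊕ L 1 v) m ⟨
      (# (+ 2) ⊛ (X ⊕ L 1 v)) m
        ≡⟨ at C-relation m ⟩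
      (# (+ 2) ⊛ (U ⊛ (U ⊛ G))) m
        ≡⟨ constant-⊛ (ι (+ 2)) (U ⊛ (U ⊛ G)) m ⟩
      ι (+ 2) ℚ.* (U ⊛ (U ⊛ G)) m
        ≡⟨ ≡.cong (ι (+ 2) ℚ.*_) (≡.subst (λ n → (U ⊛ (U ⊛ G)) n ≡ ι (+ n) ℚ.* (ι (+ (1 ℕ.+ a)) ℚ.* G a)) (≡.sym m≡) (U²-⊛ G a)) ⟩
      ι (+ 2) ℚ.* (ι (+ m) ℚ.* (ι (+ (1 ℕ.+ a)) ℚ.* G a))
        ≡⟨ solve 3 (λ m i g → con (ι (+ 2)) :* (m :* (i :* g)) := con (ι (+ 2)) :* (i :* (m :* g))) ≡.refl (ι (+ m)) (ι (+ (1 ℕ.+ a))) (G a) ⟩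
      ι (+ 2) ℚ.* (ι (+ (1 ℕ.+ a)) ℚ.* (ι (+ m) ℚ.* G a)) ∎))
      where
      open ≡.≡-Reasoning
      open Data.Rational.Solver.+-*-Solver
      q = ι (+ a)

    -- `D-relation` is multiplied by m - 4, because v⁴ is known only through (m - 4)(v⁴)(m) = 4Y(m).
    -- Then d acquires 6 · 4 = 24, and the common factors m - 1, ..., m - 4, written 4 + a, ..., 1 +
    -- a, cancel.
    D-coefficient : ∀ m a d → m ≡ 5 ℕ.+ a →
      Y m ≡ ι (+ (4 ℕ.+ a)) ℚ.* (ι (+ (3 ℕ.+ a)) ℚ.* (ι (+ (2 ℕ.+ a)) ℚ.* (ι (+ (1 ℕ.+ a)) ℚ.* d))) →
      ι (+ 24) ℚ.* d ℚ.+ v m ≡ ι (+ 24) ℚ.* (ι (+ m) ℚ.* K (1 ℕ.+ a))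
    D-coefficient m a d m≡ Y≡ = ι-cancel (4 ℕ.+ a) (ι-cancel (3 ℕ.+ a) (ι-cancel (2 ℕ.+ a) (ι-cancel (1 ℕ.+ a) (begin
      i₁ ℚ.* (i₂ ℚ.* (i₃ ℚ.* (i₄ ℚ.* (ι (+ 24) ℚ.* d ℚ.+ v m))))
        ≡⟨ solve 6 (λ a b c e d v → a :* (b :* (c :* (e :* (con (ι (+ 24)) :* d :+ v))))
             := a :* (b :* (c :* (e :* v))) :+ con (ι (+ 6)) :* (con (ι (+ 4)) :* (e :* (c :* (b :* (a :* d)))))) ≡.refl i₁ i₂ i₃ i₄ d (v m) ⟩
      i₁ ℚ.* (i₂ ℚ.* (i₃ ℚ.* (i₄ ℚ.* v m))) ℚ.+ ι (+ 6) ℚ.* (ι (+ 4) ℚ.* (i₄ ℚ.* (i₃ ℚ.* (i₂ ℚ.* (i₁ ℚ.* d)))))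
        ≡⟨ ≡.cong (λ y → i₁ ℚ.* (i₂ ℚ.* (i₃ ℚ.* (i₄ ℚ.* v m))) ℚ.+ ι (+ 6) ℚ.* (ι (+ 4) ℚ.* y)) Y≡ ⟨
      i₁ ℚ.* (i₂ ℚ.* (i₃ ℚ.* (i₄ ℚ.* v m))) ℚ.+ ι (+ 6) ℚ.* (ι (+ 4) ℚ.* Y m)
        ≡⟨ ≡.cong₂ (λ x y → i₁ ℚ.* x ℚ.+ ι (+ 6) ℚ.* y) third-order fourth ⟩
      i₁ ℚ.* L 3 (L 2 (L 1 v)) m ℚ.+ ι (+ 6) ℚ.* (i₁ ℚ.* (v ^ 4) m)
        ≡⟨ solve 3 (λ a x y → a :* x :+ con (ι (+ 6)) :* (a :* y) := a :* (x :+ con (ι (+ 6)) :* y)) ≡.refl i₁ (L 3 (L 2 (L 1 v)) m) ((v ^ 4) m) ⟩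
      i₁ ℚ.* (L 3 (L 2 (L 1 v)) m ℚ.+ ι (+ 6) ℚ.* (v ^ 4) m)
        ≡⟨ ≡.cong (λ y → i₁ ℚ.* (L 3 (L 2 (L 1 v)) m ℚ.+ y)) (constant-⊛ (ι (+ 6)) (v ^ 4) m) ⟨
      i₁ ℚ.* (L 3 (L 2 (L 1 v)) ⊕ # (+ 6) ⊛ v ^ 4) m
        ≡⟨ ≡.cong (i₁ ℚ.*_) (≡.trans (at D-relation m) (constant-⊛ (ι (+ 24)) (U ⊛ (U ⊛ (U ⊛ (U ⊛ K)))) m)) ⟩
      i₁ ℚ.* (ι (+ 24) ℚ.* (U ⊛ (U ⊛ (U ⊛ (U ⊛ K)))) m)
        ≡⟨ ≡.cong (λ y → i₁ ℚ.* (ι (+ 24) ℚ.* y)) U⁴K ⟩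
      i₁ ℚ.* (ι (+ 24) ℚ.* (ι (+ m) ℚ.* (i₄ ℚ.* (i₃ ℚ.* (i₂ ℚ.* K (1 ℕ.+ a))))))
        ≡⟨ solve 6 (λ a b c e m k → a :* (con (ι (+ 24)) :* (m :* (e :* (c :* (b :* k))))) := a :* (b :* (c :* (e :* (con (ι (+ 24)) :* (m :* k)))))) ≡.refl
             i₁ i₂ i₃ i₄ (ι (+ m)) (K (1 ℕ.+ a)) ⟩
      i₁ ℚ.* (i₂ ℚ.* (i₃ ℚ.* (i₄ ℚ.* (ι (+ 24) ℚ.* (ι (+ m) ℚ.* K (1 ℕ.+ a)))))) ∎))))
      where
      open ≡.≡-Reasoning
      open Data.Rational.Solver.+-*-Solver
      i₁ = ι (+ (1 ℕ.+ a))
      i₂ = ι (+ (2 ℕ.+ a))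
      i₃ = ι (+ (3 ℕ.+ a))
      i₄ = ι (+ (4 ℕ.+ a))
      minus : ∀ k j → ι (+ (k ℕ.+ j)) ℚ.- ι (+ k) ≡ ι (+ j)
      minus k j = ≡.trans (≡.cong (ℚ._- ι (+ k)) (ι-+ (+ k) (+ j))) (solve 2 (λ k j → (k :+ j) :- k := j) ≡.refl (ι (+ k)) (ι (+ j)))
      m-minus : ∀ k j → m ≡ k ℕ.+ j → ι (+ m) ℚ.- ι (+ k) ≡ ι (+ j)
      m-minus k j m≡ = ≡.trans (≡.cong (λ n → ι (+ n) ℚ.- ι (+ k)) m≡) (minus k j)
      third-order : i₂ ℚ.* (i₃ ℚ.* (i₄ ℚ.* v m)) ≡ L 3 (L 2 (L 1 v)) m
      third-order = ≡.sym (≡.trans (L-at 3 (L 2 (L 1 v)) m) (≡.cong₂ ℚ._*_ (m-minus 3 (2 ℕ.+ a) m≡)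
        (≡.trans (L-at 2 (L 1 v) m) (≡.cong₂ ℚ._*_ (m-minus 2 (3 ℕ.+ a) m≡)
          (≡.trans (L-at 1 v m) (≡.cong (ℚ._* v m) (m-minus 1 (4 ℕ.+ a) m≡)))))))
      fourth : ι (+ 4) ℚ.* Y m ≡ i₁ ℚ.* (v ^ 4) m
      fourth = ≡.trans (≡.sym (constant-⊛ (ι (+ 4)) Y m)) (≡.trans (≡.sym (at L₄v⁴ m))
        (≡.trans (L-at 4 (v ^ 4) m) (≡.cong (ℚ._* (v ^ 4) m) (m-minus 4 (1 ℕ.+ a) m≡))))
      U⁴K : (U ⊛ (U ⊛ (U ⊛ (U ⊛ K)))) m ≡ ι (+ m) ℚ.* (i₄ ℚ.* (i₃ ℚ.* (i₂ ℚ.* K (1 ℕ.+ a))))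
      U⁴K = ≡.subst (λ n → (U ⊛ (U ⊛ (U ⊛ (U ⊛ K)))) n ≡ ι (+ n) ℚ.* (i₄ ℚ.* (i₃ ℚ.* (i₂ ℚ.* K (1 ℕ.+ a))))) (≡.sym m≡)
        (≡.trans (U²-⊛ (U ⊛ (U ⊛ K)) (3 ℕ.+ a)) (≡.cong (λ y → ι (+ (5 ℕ.+ a)) ℚ.* (i₄ ℚ.* y)) (U²-⊛ K (1 ℕ.+ a))))

-- Laurent series and their Hurwitz form

module LaurentSeries where

  import Defs
  open Defs using (Laurent; laurent; pole; coeff; _⟦_⟧; _≈_; _·_; const; deriv; ∑; hurwitzCoeff; xSeries; ySeries; IsExpansionAt∞)
  open HurwitzSeries
  open RationalSeries
  open import Data.Integer.Base as ℤ using (ℤ; +_; -[1+_])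
  import Data.Integer.Properties as ℤ
  open import Data.Integer.Solver using (module +-*-Solver)
  open import Data.List.Base using (upTo; foldr)
  open import Data.List.Properties using (map-applyUpTo)
  open import Data.Nat.Base as ℕ using (ℕ; zero; suc; _!; _∸_; _⊔_)
  open import Data.Nat.Divisibility using (_∣_; _∣?_)
  import Data.Nat.Properties as ℕ
  open import Data.Rational.Base as ℚ using (ℚ; 0ℚ; 1ℚ)
  import Data.Rational.Properties as ℚ
  import Data.Rational.Solver
  open import Function.Base using (_∘_; id)
  open import Relation.Binary.PropositionalEquality as ≡ using (_≡_)
  open import Relation.Nullary.Decidable using (dec-true)
  open Hℚ hiding (module Solver)

  -- `_⟦_⟧` branches on the shifted exponent; with that index as an argument, equations between
  -- exponents can be substituted.
  pick : (ℕ → ℚ) → ℤ → ℚ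
  pick F (+ k)    = F k
  pick F -[1+ _ ] = 0ℚ

  ⟦⟧≡pick : ∀ f e → f ⟦ e ⟧ ≡ pick (coeff f) (e ℤ.+ + pole f)
  ⟦⟧≡pick f e with e ℤ.+ + pole f
  ... | + k      = ≡.refl
  ... | -[1+ k ] = ≡.refl

  pick-cong : ∀ {F G} → (∀ k → F k ≡ G k) → ∀ i → pick F i ≡ pick G i
  pick-cong p (+ k)    = p k
  pick-cong p -[1+ _ ] = ≡.refl

  ⟦⟧-coeff : ∀ f k → f ⟦ + k ℤ.- + pole f ⟧ ≡ coeff f k
  ⟦⟧-coeff f k = ≡.trans (⟦⟧≡pick f (+ k ℤ.- + pole f)) (≡.cong (pick (coeff f))
    (solve 2 (λ k p → (k :- p) :+ p := k) ≡.refl (+ k) (+ pole f)))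
    where open +-*-Solver hiding (⟦_⟧)

  ≈-refl : ∀ {f} → f ≈ f
  ≈-refl e = ≡.refl

  ≈-sym : ∀ {f g} → f ≈ g → g ≈ f
  ≈-sym p e = ≡.sym (p e)

  ≈-trans : ∀ {f g h} → f ≈ g → g ≈ h → f ≈ h
  ≈-trans p q e = ≡.trans (p e) (q e)

  same-coeff⇒≈ : ∀ f g → pole f ≡ pole g → (∀ k → coeff f k ≡ coeff g k) → f ≈ g
  same-coeff⇒≈ f g p c e = ≡.trans (⟦⟧≡pick f e) (≡.trans (pick-cong c (e ℤ.+ + pole f))
    (≡.trans (≡.cong (λ p → pick (coeff g) (e ℤ.+ + p)) p) (≡.sym (⟦⟧≡pick g e))))

  ≈⇒same-coeff : ∀ f g → pole f ≡ pole g → f ≈ g → ∀ k → coeff f k ≡ coeff g k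
  ≈⇒same-coeff f g p f≈g k = ≡.trans (≡.sym (⟦⟧-coeff f k)) (≡.trans (f≈g (+ k ℤ.- + pole f))
    (≡.trans (≡.cong (λ p → g ⟦ + k ℤ.- + p ⟧) p) (⟦⟧-coeff g k)))

  shift : (ℕ → ℚ) → ℕ → ℚ
  shift F zero    = 0ℚ
  shift F (suc n) = F n

  -- The same series with a weaker pole bound: two representations have equal coefficient sequences
  -- only once their bounds are equal.
  raise₁ : Laurent → Laurent
  raise₁ f = laurent (suc (pole f)) (shift (coeff f))

  raise₁-≈ : ∀ f → raise₁ f ≈ f
  raise₁-≈ f e = ≡.trans (⟦⟧≡pick (raise₁ f) e) (≡.trans
    (≡.cong (pick (shift (coeff f))) (solve 2 (λ e p → e :+ (con (+ 1) :+ p) := con (+ 1) :+ (e :+ p)) ≡.refl e (+ pole f)))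
    (≡.trans (pick-shift (e ℤ.+ + pole f)) (≡.sym (⟦⟧≡pick f e))))
    where
    open +-*-Solver hiding (⟦_⟧)
    pick-shift : ∀ i → pick (shift (coeff f)) (+ 1 ℤ.+ i) ≡ pick (coeff f) i
    pick-shift (+ k)        = ≡.refl
    pick-shift -[1+ zero ]  = ≡.refl
    pick-shift -[1+ suc j ] = ≡.refl

  raise : ℕ → Laurent → Laurent
  raise zero    f = f
  raise (suc n) f = raise₁ (raise n f)

  raise-≈ : ∀ n f → raise n f ≈ f
  raise-≈ zero    f = ≈-refl {f}
  raise-≈ (suc n) f = ≈-trans {raise (suc n) f} {raise n f} {f} (raise₁-≈ (raise n f)) (raise-≈ n f)

  pole-raise : ∀ n f → pole (raise n f) ≡ n ℕ.+ pole f
  pole-raise zero    f = ≡.refl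
  pole-raise (suc n) f = ≡.cong suc (pole-raise n f)

  convolution : (ℕ → ℚ) → (ℕ → ℚ) → ℕ → ℚ
  convolution F G zero    = F 0 ℚ.* G 0
  convolution F G (suc k) = F 0 ℚ.* G (suc k) ℚ.+ convolution (F ∘ suc) G k

  coeff-· : ∀ f g k → coeff (f · g) k ≡ convolution (coeff f) (coeff g) k
  coeff-· f g = sum (coeff f) (coeff g)
    where
    sum : ∀ F G k → ∑ (upTo (suc k)) (λ i → F i ℚ.* G (k ∸ i)) ≡ convolution F G k
    sum F G zero    = ℚ.+-identityʳ (F 0 ℚ.* G 0)
    sum F G (suc k) = ≡.cong (ℚ._+_ (F 0 ℚ.* G (suc k))) (≡.trans
      (≡.cong (foldr ℚ._+_ 0ℚ) (≡.trans (map-applyUpTo suc (λ i → F i ℚ.* G (suc k ∸ i)) (suc k))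
        (≡.sym (map-applyUpTo id (λ i → F (suc i) ℚ.* G (k ∸ i)) (suc k)))))
      (sum (F ∘ suc) G k))

  convolution-cong : ∀ {F F′ G G′} → (∀ k → F k ≡ F′ k) → (∀ k → G k ≡ G′ k) → ∀ k → convolution F G k ≡ convolution F′ G′ k
  convolution-cong p q zero    = ≡.cong₂ ℚ._*_ (p 0) (q 0)
  convolution-cong p q (suc k) = ≡.cong₂ ℚ._+_ (≡.cong₂ ℚ._*_ (p 0) (q (suc k))) (convolution-cong (p ∘ suc) q k)

  convolution-shiftˡ : ∀ F G k → convolution (shift F) G k ≡ shift (convolution F G) k
  convolution-shiftˡ F G zero    = ℚ.*-zeroˡ (G 0)
  convolution-shiftˡ F G (suc k) = ≡.trans (≡.cong (ℚ._+ convolution F G k) (ℚ.*-zeroˡ (G (suc k)))) (ℚ.+-identityˡ (convolution F G k))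

  convolution-shiftʳ : ∀ F G k → convolution F (shift G) k ≡ shift (convolution F G) k
  convolution-shiftʳ F G zero          = ℚ.*-zeroʳ (F 0)
  convolution-shiftʳ F G (suc zero)    = ≡.trans (≡.cong (ℚ._+_ (F 0 ℚ.* G 0)) (ℚ.*-zeroʳ (F 1))) (ℚ.+-identityʳ (F 0 ℚ.* G 0))
  convolution-shiftʳ F G (suc (suc k)) = ≡.cong (ℚ._+_ (F 0 ℚ.* G (suc k))) (convolution-shiftʳ (F ∘ suc) G (suc k))

  raise-·ˡ : ∀ n f g → raise n f · g ≈ f · g
  raise-·ˡ zero    f g = ≈-refl {f · g}
  raise-·ˡ (suc n) f g = ≈-trans {raise (suc n) f · g} {raise₁ (raise n f · g)} {f · g}
    (same-coeff⇒≈ (raise (suc n) f · g) (raise₁ (raise n f · g)) ≡.refl same)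
    (≈-trans {raise₁ (raise n f · g)} {raise n f · g} {f · g} (raise₁-≈ (raise n f · g)) (raise-·ˡ n f g))
    where
    same : ∀ k → coeff (raise (suc n) f · g) k ≡ shift (coeff (raise n f · g)) k
    same zero    = ≡.trans (coeff-· (raise (suc n) f) g 0) (convolution-shiftˡ (coeff (raise n f)) (coeff g) 0)
    same (suc k) = ≡.trans (coeff-· (raise (suc n) f) g (suc k)) (≡.trans (convolution-shiftˡ (coeff (raise n f)) (coeff g) (suc k))
      (≡.sym (coeff-· (raise n f) g k)))

  raise-·ʳ : ∀ n f g → f · raise n g ≈ f · g
  raise-·ʳ zero    f g = ≈-refl {f · g}
  raise-·ʳ (suc n) f g = ≈-trans {f · raise (suc n) g} {raise₁ (f · raise n g)} {f · g}
    (same-coeff⇒≈ (f · raise (suc n) g) (raise₁ (f · raise n g)) (ℕ.+-suc (pole f) (pole (raise n g))) same)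
    (≈-trans {raise₁ (f · raise n g)} {f · raise n g} {f · g} (raise₁-≈ (f · raise n g)) (raise-·ʳ n f g))
    where
    same : ∀ k → coeff (f · raise (suc n) g) k ≡ shift (coeff (f · raise n g)) k
    same zero    = ≡.trans (coeff-· f (raise (suc n) g) 0) (convolution-shiftʳ (coeff f) (coeff (raise n g)) 0)
    same (suc k) = ≡.trans (coeff-· f (raise (suc n) g) (suc k)) (≡.trans (convolution-shiftʳ (coeff f) (coeff (raise n g)) (suc k))
      (≡.sym (coeff-· f (raise n g) k)))

  common-pole : ∀ f g → pole (raise (pole g) f) ≡ pole (raise (pole f) g)
  common-pole f g = ≡.trans (pole-raise (pole g) f) (≡.trans (ℕ.+-comm (pole g) (pole f)) (≡.sym (pole-raise (pole f) g)))

  common-coeff : ∀ f g → f ≈ g → ∀ k → coeff (raise (pole g) f) k ≡ coeff (raise (pole f) g) k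
  common-coeff f g f≈g = ≈⇒same-coeff f′ g′ (common-pole f g)
    (≈-trans {f′} {f} {g′} (raise-≈ (pole g) f) (≈-trans {f} {g} {g′} f≈g (≈-sym {g′} {g} (raise-≈ (pole f) g))))
    where
    f′ = raise (pole g) f
    g′ = raise (pole f) g

  -- Products are formed on representations, so each pair of equal factors is first raised to a
  -- common pole bound, where the coefficients agree one by one.
  ·-cong : ∀ f g h k → f ≈ g → h ≈ k → f · h ≈ g · k
  ·-cong f g h k f≈g h≈k = ≈-trans {f · h} {g · h} {g · k} left right
    where
    f′ = raise (pole g) f
    g′ = raise (pole f) g
    h′ = raise (pole k) h
    k′ = raise (pole h) k
    left : f · h ≈ g · h
    left = ≈-trans {f · h} {f′ · h} {g · h} (≈-sym {f′ · h} {f · h} (raise-·ˡ (pole g) f h))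
      (≈-trans {f′ · h} {g′ · h} {g · h}
        (same-coeff⇒≈ (f′ · h) (g′ · h) (≡.cong (ℕ._+ pole h) (common-pole f g))
          λ i → ≡.trans (coeff-· f′ h i) (≡.trans (convolution-cong (common-coeff f g f≈g) (λ _ → ≡.refl) i) (≡.sym (coeff-· g′ h i))))
        (raise-·ˡ (pole f) g h))
    right : g · h ≈ g · k
    right = ≈-trans {g · h} {g · h′} {g · k} (≈-sym {g · h′} {g · h} (raise-·ʳ (pole k) g h))
      (≈-trans {g · h′} {g · k′} {g · k}
        (same-coeff⇒≈ (g · h′) (g · k′) (≡.cong (pole g ℕ.+_) (common-pole h k))
          λ i → ≡.trans (coeff-· g h′ i) (≡.trans (convolution-cong {coeff g} (λ _ → ≡.refl) (common-coeff h k h≈k) i) (≡.sym (coeff-· g k′ i))))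
        (raise-·ʳ (pole h) g k))

  ^-cong : ∀ f g n → f ≈ g → f Defs.^ n ≈ g Defs.^ n
  ^-cong f g zero    f≈g = ≈-refl {const 1ℚ}
  ^-cong f g (suc n) f≈g = ·-cong f g (f Defs.^ n) (g Defs.^ n) f≈g (^-cong f g n f≈g)

  -- Expressed by exponents alone, without the pole bound, so that the derivative visibly respects
  -- `≈`.
  deriv-⟦⟧ : ∀ f e → deriv f ⟦ e ⟧ ≡ ι (e ℤ.+ + 1) ℚ.* f ⟦ e ℤ.+ + 1 ⟧
  deriv-⟦⟧ f e = begin
    deriv f ⟦ e ⟧                                           ≡⟨ ⟦⟧≡pick (deriv f) e ⟩
    pick (coeff (deriv f)) (e ℤ.+ + suc (pole f))           ≡⟨ ≡.cong (pick (coeff (deriv f))) (solve 2 (λ e p → e :+ (con (+ 1) :+ p) := (e :+ con (+ 1)) :+ p) ≡.refl e (+ pole f)) ⟩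
    pick (coeff (deriv f)) i                                ≡⟨ picks i ⟩
    ι (i ℤ.- + pole f) ℚ.* pick (coeff f) i                 ≡⟨ ≡.cong₂ (λ a b → ι a ℚ.* b) (solve 2 (λ e p → (e :+ p) :- p := e) ≡.refl (e ℤ.+ + 1) (+ pole f)) (≡.sym (⟦⟧≡pick f (e ℤ.+ + 1))) ⟩
    ι (e ℤ.+ + 1) ℚ.* f ⟦ e ℤ.+ + 1 ⟧                       ∎
    where
    open ≡.≡-Reasoning
    open +-*-Solver hiding (⟦_⟧)
    i = e ℤ.+ + 1 ℤ.+ + pole f
    picks : ∀ i → pick (coeff (deriv f)) i ≡ ι (i ℤ.- + pole f) ℚ.* pick (coeff f) i
    picks (+ k)    = ≡.refl
    picks -[1+ k ] = ≡.sym (ℚ.*-zeroʳ (ι (-[1+ k ] ℤ.- + pole f)))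

  deriv-cong : ∀ f g → f ≈ g → deriv f ≈ deriv g
  deriv-cong f g f≈g e = ≡.trans (deriv-⟦⟧ f e) (≡.trans (≡.cong (ι (e ℤ.+ + 1) ℚ.*_) (f≈g (e ℤ.+ + 1))) (≡.sym (deriv-⟦⟧ g e)))

  below-pole : ∀ f p j e → pole f ℕ.≤ p → e ℤ.+ + p ≡ -[1+ j ] → f ⟦ e ⟧ ≡ 0ℚ
  below-pole f p j e f≤p e+p = ≡.trans (≡.sym (raise-≈ d f e)) (≡.trans (⟦⟧≡pick (raise d f) e)
    (≡.cong (pick (coeff (raise d f))) (≡.trans (≡.cong (λ q → e ℤ.+ + q) (≡.trans (pole-raise d f) (ℕ.m∸n+n≡m f≤p))) e+p)))
    where d = p ∸ pole f

  minus-⟦⟧ : ∀ f g e → (f Defs.- g) ⟦ e ⟧ ≡ f ⟦ e ⟧ ℚ.- g ⟦ e ⟧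
  minus-⟦⟧ f g e = ≡.trans (⟦⟧≡pick (f Defs.- g) e) (by-sign (e ℤ.+ + p) ≡.refl)
    where
    open +-*-Solver hiding (⟦_⟧)
    p = pole f ⊔ pole g
    by-sign : ∀ i → e ℤ.+ + p ≡ i → pick (coeff (f Defs.- g)) i ≡ f ⟦ e ⟧ ℚ.- g ⟦ e ⟧
    by-sign (+ k)    e+p = ≡.cong (λ d → f ⟦ d ⟧ ℚ.- g ⟦ d ⟧) (≡.trans (≡.cong (ℤ._- + p) (≡.sym e+p))
      (solve 2 (λ e p → (e :+ p) :- p := e) ≡.refl e (+ p)))
    by-sign -[1+ j ] e+p = ≡.sym (≡.cong₂ ℚ._-_ (below-pole f p j e (ℕ.m≤m⊔n (pole f) (pole g)) e+p)
      (below-pole g p j e (ℕ.m≤n⊔m (pole f) (pole g)) e+p))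

  -- The series u^(pole f) f, its coefficients scaled by factorials.
  hurwitz : Laurent → Series
  hurwitz f n = ι (+ (n !)) ℚ.* coeff f n

  private
    scaled : (ℕ → ℚ) → Series
    scaled F n = ι (+ (n !)) ℚ.* F n

    ∂ : (ℕ → ℚ) → ℕ → ℚ
    ∂ F n = ι (+ suc n) ℚ.* F (suc n)

    D-scaled : ∀ F → D (scaled F) ≋ scaled (∂ F)
    D-scaled F = pointwise λ n → ≡.trans (≡.cong (ℚ._* F (suc n)) (≡.trans (≡.cong ι (ℤ.pos-* (suc n) (n !))) (ι-* (+ suc n) (+ (n !)))))
      (solve 3 (λ a b c → a :* b :* c := b :* (a :* c)) ≡.refl (ι (+ suc n)) (ι (+ (n !))) (F (suc n)))
      where open Data.Rational.Solver.+-*-Solver hiding (⟦_⟧)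

    convolution-+ : ∀ F F′ G k → convolution (λ n → F n ℚ.+ F′ n) G k ≡ convolution F G k ℚ.+ convolution F′ G k
    convolution-+ F F′ G zero    = ℚ.*-distribʳ-+ (G 0) (F 0) (F′ 0)
    convolution-+ F F′ G (suc k) = ≡.trans (≡.cong (ℚ._+_ ((F 0 ℚ.+ F′ 0) ℚ.* G (suc k))) (convolution-+ (F ∘ suc) (F′ ∘ suc) G k))
      (solve 5 (λ a b g x y → (a :+ b) :* g :+ (x :+ y) := (a :* g :+ x) :+ (b :* g :+ y)) ≡.refl
        (F 0) (F′ 0) (G (suc k)) (convolution (F ∘ suc) G k) (convolution (F′ ∘ suc) G k))
      where open Data.Rational.Solver.+-*-Solver hiding (⟦_⟧)

    ∂-convolution : ∀ F G k → ∂ (convolution F G) k ≡ convolution (∂ F) G k ℚ.+ convolution F (∂ G) k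
    ∂-convolution F G zero = solve 4 (λ a b c d → con 1ℚ :* (a :* d :+ b :* c) := con 1ℚ :* b :* c :+ a :* (con 1ℚ :* d)) ≡.refl (F 0) (F 1) (G 0) (G 1)
      where open Data.Rational.Solver.+-*-Solver hiding (⟦_⟧)
    ∂-convolution F G (suc k) = begin
      ι (+ suc (suc k)) ℚ.* (F 0 ℚ.* G (suc (suc k)) ℚ.+ c)
        ≡⟨ ≡.cong (λ a → a ℚ.* (F 0 ℚ.* G (suc (suc k)) ℚ.+ c)) (ι-+ (+ 1) (+ suc k)) ⟩
      (1ℚ ℚ.+ n) ℚ.* (F 0 ℚ.* G (suc (suc k)) ℚ.+ c)
        ≡⟨ solve 4 (λ n f g c → (con 1ℚ :+ n) :* (f :* g :+ c) := (con 1ℚ :+ n) :* (f :* g) :+ c :+ n :* c) ≡.refl n (F 0) (G (suc (suc k))) c ⟩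
      (1ℚ ℚ.+ n) ℚ.* (F 0 ℚ.* G (suc (suc k))) ℚ.+ c ℚ.+ n ℚ.* c
        ≡⟨ ≡.cong (ℚ._+_ ((1ℚ ℚ.+ n) ℚ.* (F 0 ℚ.* G (suc (suc k))) ℚ.+ c)) (∂-convolution (F ∘ suc) G k) ⟩
      (1ℚ ℚ.+ n) ℚ.* (F 0 ℚ.* G (suc (suc k))) ℚ.+ (F 1 ℚ.* G (suc k) ℚ.+ c₂) ℚ.+ (c₁ ℚ.+ c₃)
        ≡⟨ solve 7 (λ n f g a x y z → (con 1ℚ :+ n) :* (f :* g) :+ (a :+ x) :+ (y :+ z)
             := (con 1ℚ :* a :+ (y :+ x)) :+ (f :* ((con 1ℚ :+ n) :* g) :+ z)) ≡.refl n (F 0) (G (suc (suc k))) (F 1 ℚ.* G (suc k)) c₂ c₁ c₃ ⟩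
      (1ℚ ℚ.* (F 1 ℚ.* G (suc k)) ℚ.+ (c₁ ℚ.+ c₂)) ℚ.+ (F 0 ℚ.* ((1ℚ ℚ.+ n) ℚ.* G (suc (suc k))) ℚ.+ c₃)
        ≡⟨ ≡.cong₂ (λ a b → a ℚ.+ (F 0 ℚ.* (b ℚ.* G (suc (suc k))) ℚ.+ c₃))
             (≡.cong₂ ℚ._+_ (≡.sym (ℚ.*-assoc 1ℚ (F 1) (G (suc k)))) (≡.trans (≡.sym (convolution-+ (∂ (F ∘ suc)) (F ∘ suc ∘ suc) G k)) (convolution-cong {G = G} split (λ _ → ≡.refl) k)))
             (≡.sym (ι-+ (+ 1) (+ suc k))) ⟩
      convolution (∂ F) G (suc k) ℚ.+ convolution F (∂ G) (suc k) ∎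
      where
      open ≡.≡-Reasoning
      open Data.Rational.Solver.+-*-Solver hiding (⟦_⟧)
      n = ι (+ suc k)
      c = convolution (F ∘ suc) G (suc k)
      c₁ = convolution (∂ (F ∘ suc)) G k
      c₂ = convolution (F ∘ suc ∘ suc) G k
      c₃ = convolution (F ∘ suc) (∂ G) k
      split : ∀ j → ∂ (F ∘ suc) j ℚ.+ F (suc (suc j)) ≡ ∂ F (suc j)
      split j = ≡.trans (solve 2 (λ n f → n :* f :+ f := (con 1ℚ :+ n) :* f) ≡.refl (ι (+ suc j)) (F (suc (suc j))))
        (≡.cong (ℚ._* F (suc (suc j))) (≡.sym (ι-+ (+ 1) (+ suc j))))

    -- The Cauchy product obeys the Leibniz rule for the ordinary derivative `∂`, scaling by
    -- factorials turns `∂` into the shift `D`, and `⊛` is determined by the Leibniz rule.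
    scaled-convolution : ∀ n F G → scaled (convolution F G) n ≡ (scaled F ⊛ scaled G) n
    scaled-convolution zero F G = solve 2 (λ a b → con 1ℚ :* (a :* b) := (con 1ℚ :* a) :* (con 1ℚ :* b)) ≡.refl (F 0) (G 0)
      where open Data.Rational.Solver.+-*-Solver hiding (⟦_⟧)
    scaled-convolution (suc n) F G = begin
      scaled (convolution F G) (suc n)
        ≡⟨ at (D-scaled (convolution F G)) n ⟩
      ι (+ (n !)) ℚ.* ∂ (convolution F G) n
        ≡⟨ ≡.cong (ι (+ (n !)) ℚ.*_) (∂-convolution F G n) ⟩
      ι (+ (n !)) ℚ.* (convolution (∂ F) G n ℚ.+ convolution F (∂ G) n)
        ≡⟨ ℚ.*-distribˡ-+ (ι (+ (n !))) (convolution (∂ F) G n) (convolution F (∂ G) n) ⟩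
      scaled (convolution (∂ F) G) n ℚ.+ scaled (convolution F (∂ G)) n
        ≡⟨ ≡.cong₂ ℚ._+_ (scaled-convolution n (∂ F) G) (scaled-convolution n F (∂ G)) ⟩
      (scaled (∂ F) ⊛ scaled G) n ℚ.+ (scaled F ⊛ scaled (∂ G)) n
        ≡⟨ ≡.cong₂ ℚ._+_ (at (⊛-congʳ {g = scaled G} (D-scaled F)) n) (at (⊛-congˡ {scaled F} (D-scaled G)) n) ⟨
      (D (scaled F) ⊛ scaled G) n ℚ.+ (scaled F ⊛ D (scaled G)) n ∎
      where open ≡.≡-Reasoning

  hurwitz-· : ∀ f g → hurwitz (f · g) ≋ hurwitz f ⊛ hurwitz g
  hurwitz-· f g = pointwise λ n → ≡.trans (≡.cong (ι (+ (n !)) ℚ.*_) (coeff-· f g n)) (scaled-convolution n (coeff f) (coeff g))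

  hurwitz-const : ∀ a → hurwitz (const a) ≋ constant a
  hurwitz-const a = pointwise λ { zero → ℚ.*-identityˡ a ; (suc n) → ℚ.*-zeroʳ (ι (+ (suc n !))) }

  hurwitz-^ : ∀ f n → hurwitz (f Defs.^ n) ≋ hurwitz f ^ n
  hurwitz-^ f zero    = hurwitz-const 1ℚ
  hurwitz-^ f (suc n) = trans (hurwitz-· f (f Defs.^ n)) (⊛-congˡ (hurwitz-^ f n))

  hurwitz-deriv : ∀ f → hurwitz (deriv f) ≋ U ⊛ D (hurwitz f) ⊕ ⊖ (# (+ pole f) ⊛ hurwitz f)
  hurwitz-deriv f = pointwise λ n → ≡.trans
    (≡.cong (λ a → ι (+ (n !)) ℚ.* (a ℚ.* coeff f n)) (≡.trans (ι-+ (+ n) (ℤ.- + pole f)) (≡.cong (ℚ._+_ (ι (+ n))) (ι-neg (+ pole f)))))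
    (≡.trans (solve 4 (λ a n p c → a :* ((n :- p) :* c) := n :* (a :* c) :- p :* (a :* c)) ≡.refl (ι (+ (n !))) (ι (+ n)) (ι (+ pole f)) (coeff f n))
    (≡.sym (≡.cong₂ ℚ._-_ (U-⊛-D (hurwitz f) n) (constant-⊛ (ι (+ pole f)) (hurwitz f) n))))
    where open Data.Rational.Solver.+-*-Solver hiding (⟦_⟧)

  hurwitz-raise₁ : ∀ f → hurwitz (raise₁ f) ≋ U ⊛ hurwitz f
  hurwitz-raise₁ f = pointwise λ
    { zero    → ≡.trans (ℚ.*-zeroʳ (ι (+ 1))) (≡.sym (ℚ.*-zeroˡ (hurwitz f 0)))
    ; (suc n) → ≡.trans (≡.cong (ℚ._* coeff f n) (≡.trans (≡.cong ι (ℤ.pos-* (suc n) (n !))) (ι-* (+ suc n) (+ (n !)))))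
                  (≡.trans (ℚ.*-assoc (ι (+ suc n)) (ι (+ (n !))) (coeff f n)) (≡.sym (U-⊛ (hurwitz f) n)))
    }

  hurwitz-raise-1 : ∀ n → hurwitz (raise n (const 1ℚ)) ≋ U ^ n
  hurwitz-raise-1 zero    = hurwitz-const 1ℚ
  hurwitz-raise-1 (suc n) = trans (hurwitz-raise₁ (raise n (const 1ℚ))) (⊛-congˡ (hurwitz-raise-1 n))

  hurwitz-≈ : ∀ f g → pole f ≡ pole g → f ≈ g → hurwitz f ≋ hurwitz g
  hurwitz-≈ f g p f≈g = pointwise λ n → ≡.cong (ι (+ (n !)) ℚ.*_) (≈⇒same-coeff f g p f≈g n)

  module FromLaurent (x y : Laurent) (isExpansion : IsExpansionAt∞ x y)
    (c d : ℕ → ℚ) (x≈ : x ≈ xSeries c) (y≈ : y ≈ ySeries d) where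

    open IsExpansionAt∞ isExpansion

    private
      x̂ ŷ : Laurent
      x̂ = xSeries c
      ŷ = ySeries d

    X Y : Series
    X = hurwitz x̂
    Y = hurwitz ŷ

    -- The curve equation times u¹⁰. The constant 1 is raised to the pole bound 10 of y² and x⁵,
    -- which turns it into u¹⁰.
    curveᴴ : Y ^ 2 ⊕ U ^ 10 ≋ X ^ 5
    curveᴴ = begin
      Y ^ 2 ⊕ U ^ 10
        ≈⟨ ⊕-cong (hurwitz-^ ŷ 2) (hurwitz-raise-1 10) ⟨
      hurwitz (ŷ Defs.^ 2) ⊕ hurwitz (raise 10 (const 1ℚ))
        ≈⟨ pointwise (λ n → ≡.trans (≡.sym (ℚ.*-distribˡ-+ (ι (+ (n !))) (coeff (ŷ Defs.^ 2) n) (coeff (raise 10 (const 1ℚ)) n)))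
             (≡.cong (ι (+ (n !)) ℚ.*_) (coefficients n))) ⟩
      hurwitz (x̂ Defs.^ 5)
        ≈⟨ hurwitz-^ x̂ 5 ⟩
      X ^ 5 ∎
      where
      open ≋-Reasoning
      values : ∀ e → (ŷ Defs.^ 2) ⟦ e ⟧ ≡ (x̂ Defs.^ 5) ⟦ e ⟧ ℚ.- raise 10 (const 1ℚ) ⟦ e ⟧
      values e = ≡.trans (≡.sym (^-cong y ŷ 2 y≈ e)) (≡.trans (curve e) (≡.trans (minus-⟦⟧ (x Defs.^ 5) (const 1ℚ) e)
        (≡.cong₂ ℚ._-_ (^-cong x x̂ 5 x≈ e) (≡.sym (raise-≈ 10 (const 1ℚ) e)))))
      coefficients : ∀ n → coeff (ŷ Defs.^ 2) n ℚ.+ coeff (raise 10 (const 1ℚ)) n ≡ coeff (x̂ Defs.^ 5) n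
      coefficients n = ≡.trans (≡.cong₂ ℚ._+_ (≡.trans (≡.sym (⟦⟧-coeff (ŷ Defs.^ 2) n)) (≡.trans (values (+ n ℤ.- + 10))
          (≡.cong₂ ℚ._-_ (⟦⟧-coeff (x̂ Defs.^ 5) n) (⟦⟧-coeff (raise 10 (const 1ℚ)) n)))) ≡.refl)
        (solve 2 (λ a b → (a :- b) :+ b := a) ≡.refl (coeff (x̂ Defs.^ 5) n) (coeff (raise 10 (const 1ℚ)) n))
        where open Data.Rational.Solver.+-*-Solver hiding (⟦_⟧)

    -- The equation x x′ = 2y times u⁵: the pole bounds 2 + 3 and 0 + 5 agree, so coefficients can
    -- be compared directly.
    parameterᴴ : X ⊛ (U ⊛ D X ⊕ ⊖ (# (+ 2) ⊛ X)) ≋ # (+ 2) ⊛ Y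
    parameterᴴ = begin
      X ⊛ (U ⊛ D X ⊕ ⊖ (# (+ 2) ⊛ X))             ≈⟨ ⊛-congˡ (hurwitz-deriv x̂) ⟨
      X ⊛ hurwitz (deriv x̂)                       ≈⟨ hurwitz-· x̂ (deriv x̂) ⟨
      hurwitz (x̂ · deriv x̂)                       ≈⟨ hurwitz-≈ (x̂ · deriv x̂) (const (ι (+ 2)) · ŷ) ≡.refl same ⟩
      hurwitz (const (ι (+ 2)) · ŷ)               ≈⟨ hurwitz-· (const (ι (+ 2))) ŷ ⟩
      hurwitz (const (ι (+ 2))) ⊛ Y               ≈⟨ ⊛-congʳ (hurwitz-const (ι (+ 2))) ⟩
      # (+ 2) ⊛ Y                                 ∎
      where
      open ≋-Reasoning
      same : x̂ · deriv x̂ ≈ const (ι (+ 2)) · ŷ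
      same e = ≡.trans (≡.sym (·-cong x x̂ (deriv x) (deriv x̂) x≈ (deriv-cong x x̂ x≈) e))
        (≡.trans (parameter e) (·-cong (const (ι (+ 2))) (const (ι (+ 2))) y ŷ (≈-refl {const (ι (+ 2))}) y≈ e))

    X₀ : X 0 ≡ 1ℚ
    X₀ = ≡.refl

  hurwitzCoeff-10∣ : ∀ r l c m → 10 ∣ suc m →
    hurwitzCoeff r l c (suc m) ≡ c (suc m) ℚ.* (+ 1 ℚ./ suc m) ℚ.* ((+ 1 ℚ./ ((suc m ∸ r) !)) {{(suc m ∸ r) ℕ.!≢0}})
  hurwitzCoeff-10∣ r l c m 10∣m rewrite dec-true (10 ∣? suc m) 10∣m = ≡.refl

  ι-suc! : ∀ n → ι (+ (suc n !)) ≡ ι (+ suc n) ℚ.* ι (+ (n !))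
  ι-suc! n = ≡.trans (≡.cong ι (ℤ.pos-* (suc n) (n !))) (ι-* (+ suc n) (+ (n !)))

  -- With m = a + 2, the scaling gives m! · (1/m) · 1/(m - 2)! = m - 1.
  X-coefficient : ∀ c a → 10 ∣ 2 ℕ.+ a → hurwitz (xSeries c) (2 ℕ.+ a) ≡ ι (+ (1 ℕ.+ a)) ℚ.* c (2 ℕ.+ a)
  X-coefficient c a 10∣ = begin
    ι (+ ((2 ℕ.+ a) !)) ℚ.* hurwitzCoeff 2 1ℚ c (2 ℕ.+ a)
      ≡⟨ ≡.cong₂ ℚ._*_ (≡.trans (ι-suc! (1 ℕ.+ a)) (≡.cong (ι (+ (2 ℕ.+ a)) ℚ.*_) (ι-suc! a))) (hurwitzCoeff-10∣ 2 1ℚ c (1 ℕ.+ a) 10∣) ⟩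
    ι (+ (2 ℕ.+ a)) ℚ.* (ι (+ (1 ℕ.+ a)) ℚ.* ι (+ (a !))) ℚ.* (c (2 ℕ.+ a) ℚ.* (+ 1 ℚ./ (2 ℕ.+ a)) ℚ.* r)
      ≡⟨ solve 6 (λ m i f c m′ f′ → m :* (i :* f) :* (c :* m′ :* f′) := i :* c :* ((m :* m′) :* (f :* f′))) ≡.refl
           (ι (+ (2 ℕ.+ a))) (ι (+ (1 ℕ.+ a))) (ι (+ (a !))) (c (2 ℕ.+ a)) (+ 1 ℚ./ (2 ℕ.+ a)) r ⟩
    ι (+ (1 ℕ.+ a)) ℚ.* c (2 ℕ.+ a) ℚ.* ((ι (+ (2 ℕ.+ a)) ℚ.* (+ 1 ℚ./ (2 ℕ.+ a))) ℚ.* (ι (+ (a !)) ℚ.* r))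
      ≡⟨ ≡.cong₂ (λ x y → ι (+ (1 ℕ.+ a)) ℚ.* c (2 ℕ.+ a) ℚ.* (x ℚ.* y)) (ι-*-/ (+ 1) (2 ℕ.+ a)) (ι-*-/ (+ 1) (a !) {{a ℕ.!≢0}}) ⟩
    ι (+ (1 ℕ.+ a)) ℚ.* c (2 ℕ.+ a) ℚ.* 1ℚ
      ≡⟨ ℚ.*-identityʳ (ι (+ (1 ℕ.+ a)) ℚ.* c (2 ℕ.+ a)) ⟩
    ι (+ (1 ℕ.+ a)) ℚ.* c (2 ℕ.+ a) ∎
    where
    open ≡.≡-Reasoning
    open Data.Rational.Solver.+-*-Solver hiding (⟦_⟧)
    r = (+ 1 ℚ./ (a !)) {{a ℕ.!≢0}}

  -- With m = a + 5, the scaling gives m! · (1/m) · 1/(m - 5)! = (m - 1)(m - 2)(m - 3)(m - 4).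
  Y-coefficient : ∀ d a → 10 ∣ 5 ℕ.+ a → hurwitz (ySeries d) (5 ℕ.+ a) ≡
    ι (+ (4 ℕ.+ a)) ℚ.* (ι (+ (3 ℕ.+ a)) ℚ.* (ι (+ (2 ℕ.+ a)) ℚ.* (ι (+ (1 ℕ.+ a)) ℚ.* d (5 ℕ.+ a))))
  Y-coefficient d a 10∣ = begin
    ι (+ ((5 ℕ.+ a) !)) ℚ.* hurwitzCoeff 5 (ℚ.- 1ℚ) d (5 ℕ.+ a)
      ≡⟨ ≡.cong₂ ℚ._*_ factorial (hurwitzCoeff-10∣ 5 (ℚ.- 1ℚ) d (4 ℕ.+ a) 10∣) ⟩
    ι (+ (5 ℕ.+ a)) ℚ.* (i₄ ℚ.* (i₃ ℚ.* (i₂ ℚ.* (i₁ ℚ.* ι (+ (a !)))))) ℚ.* (d (5 ℕ.+ a) ℚ.* (+ 1 ℚ./ (5 ℕ.+ a)) ℚ.* r)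
      ≡⟨ solve 9 (λ m i j k l f d m′ f′ → m :* (i :* (j :* (k :* (l :* f)))) :* (d :* m′ :* f′) := i :* (j :* (k :* (l :* d))) :* ((m :* m′) :* (f :* f′))) ≡.refl
           (ι (+ (5 ℕ.+ a))) i₄ i₃ i₂ i₁ (ι (+ (a !))) (d (5 ℕ.+ a)) (+ 1 ℚ./ (5 ℕ.+ a)) r ⟩
    i₄ ℚ.* (i₃ ℚ.* (i₂ ℚ.* (i₁ ℚ.* d (5 ℕ.+ a)))) ℚ.* ((ι (+ (5 ℕ.+ a)) ℚ.* (+ 1 ℚ./ (5 ℕ.+ a))) ℚ.* (ι (+ (a !)) ℚ.* r))
      ≡⟨ ≡.cong₂ (λ x y → i₄ ℚ.* (i₃ ℚ.* (i₂ ℚ.* (i₁ ℚ.* d (5 ℕ.+ a)))) ℚ.* (x ℚ.* y)) (ι-*-/ (+ 1) (5 ℕ.+ a)) (ι-*-/ (+ 1) (a !) {{a ℕ.!≢0}}) ⟩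
    i₄ ℚ.* (i₃ ℚ.* (i₂ ℚ.* (i₁ ℚ.* d (5 ℕ.+ a)))) ℚ.* 1ℚ
      ≡⟨ ℚ.*-identityʳ _ ⟩
    i₄ ℚ.* (i₃ ℚ.* (i₂ ℚ.* (i₁ ℚ.* d (5 ℕ.+ a)))) ∎
    where
    open ≡.≡-Reasoning
    open Data.Rational.Solver.+-*-Solver hiding (⟦_⟧)
    i₁ = ι (+ (1 ℕ.+ a))
    i₂ = ι (+ (2 ℕ.+ a))
    i₃ = ι (+ (3 ℕ.+ a))
    i₄ = ι (+ (4 ℕ.+ a))
    r = (+ 1 ℚ./ (a !)) {{a ℕ.!≢0}}
    factorial : ι (+ ((5 ℕ.+ a) !)) ≡ ι (+ (5 ℕ.+ a)) ℚ.* (i₄ ℚ.* (i₃ ℚ.* (i₂ ℚ.* (i₁ ℚ.* ι (+ (a !))))))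
    factorial = ≡.trans (ι-suc! (4 ℕ.+ a)) (≡.cong (ι (+ (5 ℕ.+ a)) ℚ.*_) (≡.trans (ι-suc! (3 ℕ.+ a)) (≡.cong (i₄ ℚ.*_)
      (≡.trans (ι-suc! (2 ℕ.+ a)) (≡.cong (i₃ ℚ.*_) (≡.trans (ι-suc! (1 ℕ.+ a)) (≡.cong (i₂ ℚ.*_) (ι-suc! a))))))))

-- Summation over the contributing primes

module FractionalParts where

  open import Defs using (Laurent; _≈_; ∑; xSeries; ySeries; IsExpansionAt∞; A; Contributes; contributes?; contributingPrimes; fractionalTerm)
  open HurwitzSeries
  open DividedPowers
  open InverseExpansion
  open Residues
  open RationalSeries
  open ExpansionAtInfinity
  open ExpansionCoefficients
  open LaurentSeries
  open import Data.Integer.Base as ℤ using (ℤ; +_; -[1+_])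
  import Data.Integer.Properties as ℤ
  open import Data.Integer.Divisibility.Signed as ℤ using (divides)
  open import Data.Integer.Solver using (module +-*-Solver)
  open import Data.List.Base using ([]; _∷_; _++_; [_]; upTo; filter)
  open import Data.List.Properties using (upTo-∷ʳ; filter-++; filter-accept; filter-reject)
  open import Data.Nat.Base as ℕ using (ℕ; zero; suc; z≤n; s≤s; NonZero)
  open import Data.Nat.DivMod using ([m+kn]%n≡m%n)
  import Data.Nat.Divisibility as ℕ
  open import Data.Nat.Primality as ℕ using (Prime; prime⇒irreducible; ¬prime[0]; ¬prime[1])
  import Data.Nat.Properties as ℕ
  import Data.Nat.Solver
  open import Data.Product.Base using (_×_; _,_; proj₁; proj₂; ∃-syntax)
  open import Data.Rational.Base as ℚ using (ℚ; 0ℚ)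
  import Data.Rational.Properties as ℚ
  import Data.Rational.Solver
  open import Data.Sum.Base using (inj₁; inj₂)
  open import Relation.Binary.PropositionalEquality as ≡ using (_≡_; _≢_)
  open import Relation.Nullary.Decidable using (yes; no)
  open import Relation.Nullary.Negation using (¬_)

  Integral : ℚ → Set
  Integral a = ∃[ h ] a ≡ ι h

  integral-+ : ∀ {a b} → Integral a → Integral b → Integral (a ℚ.+ b)
  integral-+ (h , ≡.refl) (k , ≡.refl) = h ℤ.+ k , ≡.sym (ι-+ h k)

  integral-cast : ∀ {a b} → a ≡ b → Integral a → Integral b
  integral-cast ≡.refl i = i

  ∣⇒integral : ∀ p .{{_ : NonZero p}} a → + p ℤ.∣ a → Integral (a ℚ./ p)
  ∣⇒integral p a (divides h a≡) = h , ι-cancel p (≡.trans (ι-*-/ a p) (≡.trans (≡.cong ι (≡.trans a≡ (ℤ.*-comm h (+ p)))) (ι-* (+ p) h)))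

  /-+ : ∀ a b p .{{_ : NonZero p}} → (a ℤ.+ b) ℚ./ p ≡ a ℚ./ p ℚ.+ b ℚ./ p
  /-+ a b p = ι-cancel p (≡.trans (ι-*-/ (a ℤ.+ b) p) (≡.trans (ι-+ a b) (≡.sym (≡.trans
    (ℚ.*-distribˡ-+ (ι (+ p)) (a ℚ./ p) (b ℚ./ p)) (≡.cong₂ ℚ._+_ (ι-*-/ a p) (ι-*-/ b p))))))

  /-* : ∀ a b p .{{_ : NonZero p}} → (a ℤ.* b) ℚ./ p ≡ ι a ℚ.* (b ℚ./ p)
  /-* a b p = ι-cancel p (≡.trans (ι-*-/ (a ℤ.* b) p) (≡.trans (ι-* a b) (≡.sym (≡.trans
    (solve 3 (λ p a c → p :* (a :* c) := a :* (p :* c)) ≡.refl (ι (+ p)) (ι a) (b ℚ./ p)) (≡.cong (ι a ℚ.*_) (ι-*-/ b p))))))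
    where open Data.Rational.Solver.+-*-Solver

  ∑-++ : ∀ xs ys f → ∑ (xs ++ ys) f ≡ ∑ xs f ℚ.+ ∑ ys f
  ∑-++ []       ys f = ≡.sym (ℚ.+-identityˡ (∑ ys f))
  ∑-++ (x ∷ xs) ys f = ≡.trans (≡.cong (f x ℚ.+_) (∑-++ xs ys f)) (≡.sym (ℚ.+-assoc (f x) (∑ xs f) (∑ ys f)))

  module _ (N : ℕ) (f : ℕ → ℚ) where

    primeSum : ℕ → ℚ
    primeSum j = ∑ (filter (contributes? N) (upTo j)) f

    private
      snoc : ∀ j → primeSum (suc j) ≡ primeSum j ℚ.+ ∑ (filter (contributes? N) [ j ]) f
      snoc j = ≡.trans (≡.cong (λ ks → ∑ (filter (contributes? N) ks) f) (≡.sym (upTo-∷ʳ j)))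
        (≡.trans (≡.cong (λ ks → ∑ ks f) (filter-++ (contributes? N) (upTo j) [ j ]))
          (∑-++ (filter (contributes? N) (upTo j)) (filter (contributes? N) [ j ]) f))

    primeSum-yes : ∀ j → Contributes N j → primeSum (suc j) ≡ primeSum j ℚ.+ f j
    primeSum-yes j c = ≡.trans (snoc j) (≡.cong (primeSum j ℚ.+_)
      (≡.trans (≡.cong (λ ks → ∑ ks f) (filter-accept (contributes? N) {x = j} {xs = []} c)) (ℚ.+-identityʳ (f j))))

    primeSum-no : ∀ j → ¬ Contributes N j → primeSum (suc j) ≡ primeSum j
    primeSum-no j ¬c = ≡.trans (snoc j) (≡.trans (≡.cong (primeSum j ℚ.+_)
      (≡.cong (λ ks → ∑ ks f) (filter-reject (contributes? N) {x = j} {xs = []} ¬c))) (ℚ.+-identityʳ (primeSum j)))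

    private
      residue : ∀ r k → r ℕ.% 5 ≢ 1 → ¬ Contributes N (r ℕ.+ k ℕ.* 10)
      residue r k r≢1 (_ , p≡1 , _) = r≢1 (≡.trans (≡.sym ([m+kn]%n≡m%n r (k ℕ.* 2) 5))
        (≡.trans (≡.cong (λ m → (r ℕ.+ m) ℕ.% 5) (ℕ.*-assoc k 2 5)) p≡1))

      -- 6 is the other residue modulo 10 that is 1 modulo 5, so here parity has to exclude primes.
      even : ∀ k → ¬ Contributes N (6 ℕ.+ k ℕ.* 10)
      even k (pr , _) with prime⇒irreducible pr {2} (ℕ.divides (3 ℕ.+ k ℕ.* 5) (solve 1 (λ k → con 6 :+ k :* con 10 := (con 3 :+ k :* con 5) :* con 2) ≡.refl k))
        where open Data.Nat.Solver.+-*-Solver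
      ... | inj₁ ()
      ... | inj₂ ()

    -- A contributing prime is 1 mod 5 and odd, hence 1 mod 10.
    primeSum-block : ∀ k → primeSum (11 ℕ.+ k ℕ.* 10) ≡ primeSum (2 ℕ.+ k ℕ.* 10)
    primeSum-block k =
      ≡.trans (primeSum-no (10 ℕ.+ k ℕ.* 10) (residue 10 k λ ())) (
      ≡.trans (primeSum-no (9 ℕ.+ k ℕ.* 10) (residue 9 k λ ())) (
      ≡.trans (primeSum-no (8 ℕ.+ k ℕ.* 10) (residue 8 k λ ())) (
      ≡.trans (primeSum-no (7 ℕ.+ k ℕ.* 10) (residue 7 k λ ())) (
      ≡.trans (primeSum-no (6 ℕ.+ k ℕ.* 10) (even k)) (
      ≡.trans (primeSum-no (5 ℕ.+ k ℕ.* 10) (residue 5 k λ ())) (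
      ≡.trans (primeSum-no (4 ℕ.+ k ℕ.* 10) (residue 4 k λ ())) (
      ≡.trans (primeSum-no (3 ℕ.+ k ℕ.* 10) (residue 3 k λ ()))
              (primeSum-no (2 ℕ.+ k ℕ.* 10) (residue 2 k λ ())))))))))

    primeSum-2 : primeSum 2 ≡ 0ℚ
    primeSum-2 = ≡.trans (primeSum-no 1 (λ c → ¬prime[1] (proj₁ c))) (primeSum-no 0 (λ c → ¬prime[0] (proj₁ c)))

  module _ (inv : ℕ → ℤ) (inverse : ∀ p → Prime p → p ℕ.% 5 ≡ 1 → + p ℤ.∣ + 24 ℤ.* inv p ℤ.- + 1) where

    -- The step from k to k + 1 adds one term of `τ` and the candidates 10k + 2, ..., 10k + 11, of
    -- which only the last can contribute. If it does, its fraction cancels the new term modulo ℤ;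
    -- if not, that term is an integer.
    τ+primeSum : ∀ N → N ≢ 0 → ∀ k → Integral (τ N k ℚ.+ primeSum N (λ p → fractionalTerm N (inv p) p) (2 ℕ.+ k ℕ.* 10))
    τ+primeSum N N≢0 zero    = + 0 , ≡.trans (ℚ.+-identityˡ _) (primeSum-2 N (λ p → fractionalTerm N (inv p) p))
    τ+primeSum N N≢0 (suc k) with contributes? N (suc (suc k ℕ.* 10))
    ... | yes c = integral-cast (≡.trans (solve 4 (λ a b x y → (a :+ b) :+ (x :+ y) := (a :+ x) :+ (b :+ y)) ≡.refl (τ N k) (primeSum N f (2 ℕ.+ k ℕ.* 10)) (a ℚ./ p) (b ℚ./ p))
        (≡.cong (ℚ._+_ (τ N k ℚ.+ a ℚ./ p)) (≡.sym (≡.trans (primeSum-yes N f p c) (≡.cong (ℚ._+ f p) (primeSum-block N f k))))))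
      (integral-+ (τ+primeSum N N≢0 k) (integral-cast (/-+ a b p) (∣⇒integral p (a ℤ.+ b) (fractional-term N k N≢0 c (inv p) (inverse p (proj₁ c) (proj₁ (proj₂ c)))))))
      where
      open Data.Rational.Solver.+-*-Solver
      p = suc (suc k ℕ.* 10)
      f : ℕ → ℚ
      f p = fractionalTerm N (inv p) p
      a = + J/24 (suc k) ℤ.* γ (suc k ℕ.* 10) s N
      b = inv p ℤ.* A p ℤ.^ (N ℕ./ (suc k ℕ.* 10))
    ... | no ¬c = integral-cast (≡.trans (solve 3 (λ a b x → (a :+ b) :+ x := (a :+ x) :+ b) ≡.refl (τ N k) (primeSum N f (2 ℕ.+ k ℕ.* 10)) (a ℚ./ p))
        (≡.cong (ℚ._+_ (τ N k ℚ.+ a ℚ./ p)) (≡.sym (≡.trans (primeSum-no N f p ¬c) (primeSum-block N f k)))))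
      (integral-+ (τ+primeSum N N≢0 k) (∣⇒integral p a (integral-term N k ¬c)))
      where
      open Data.Rational.Solver.+-*-Solver
      p = suc (suc k ℕ.* 10)
      f : ℕ → ℚ
      f p = fractionalTerm N (inv p) p
      a = + J/24 (suc k) ℤ.* γ (suc k ℕ.* 10) s N

    -- 24 · inv p ≡ 1 modulo p makes the difference integral prime by prime. This is how the sum for
    -- C is obtained from the sum for D.
    24-primeSum : ∀ N ps → Integral (ι (+ 24) ℚ.* ∑ (filter (contributes? N) ps) (λ p → fractionalTerm N (inv p) p)
                                     ℚ.- ∑ (filter (contributes? N) ps) (λ p → fractionalTerm N (+ 1) p))
    24-primeSum N []       = + 0 , ≡.refl
    24-primeSum N (p ∷ ps) with contributes? N p
    ... | no ¬c rewrite filter-reject (contributes? N) {x = p} {xs = ps} ¬c = 24-primeSum N ps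
    ... | yes c rewrite filter-accept (contributes? N) {x = p} {xs = ps} c = integral-cast
      (solve 4 (λ a b x y → (con (ι (+ 24)) :* a :- b) :+ (con (ι (+ 24)) :* x :- y) := con (ι (+ 24)) :* (x :+ a) :- (y :+ b)) ≡.refl
        (∑ (filter (contributes? N) ps) (λ p → fractionalTerm N (inv p) p)) (∑ (filter (contributes? N) ps) (λ p → fractionalTerm N (+ 1) p))
        (fractionalTerm N (inv p) p) (fractionalTerm N (+ 1) p))
      (integral-+ (24-primeSum N ps) (difference p (inverse p (proj₁ c) (proj₁ (proj₂ c)))))
      where
      open Data.Rational.Solver.+-*-Solver
      difference : ∀ p → + p ℤ.∣ + 24 ℤ.* inv p ℤ.- + 1 → Integral (ι (+ 24) ℚ.* fractionalTerm N (inv p) p ℚ.- fractionalTerm N (+ 1) p)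
      difference zero          _ = + 0 , ≡.refl
      difference (suc zero)    _ = + 0 , ≡.refl
      difference p@(suc q@(suc _)) d = integral-cast (≡.trans (/-+ (+ 24 ℤ.* (inv p ℤ.* B)) (-[1+ 0 ] ℤ.* (+ 1 ℤ.* B)) p)
          (≡.cong₂ ℚ._+_ (/-* (+ 24) (inv p ℤ.* B) p) (≡.trans (/-* -[1+ 0 ] (+ 1 ℤ.* B) p) (solve 1 (λ x → con (ι -[1+ 0 ]) :* x := :- x) ≡.refl ((+ 1 ℤ.* B) ℚ./ p)))))
        (∣⇒integral p (+ 24 ℤ.* (inv p ℤ.* B) ℤ.+ -[1+ 0 ] ℤ.* (+ 1 ℤ.* B)) (≡.subst (+ p ℤ.∣_)
          (Z.solve 2 (λ a b → (Z.con (+ 24) Z.:* a Z.:- Z.con (+ 1)) Z.:* b Z.:= Z.con (+ 24) Z.:* (a Z.:* b) Z.:+ Z.con -[1+ 0 ] Z.:* (Z.con (+ 1) Z.:* b)) ≡.refl (inv p) B)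
          (ℤ.∣m⇒∣m*n {+ p} {+ 24 ℤ.* inv p ℤ.- + 1} B d)))
        where
        module Z = +-*-Solver
        B = A p ℤ.^ (N ℕ./ q)

    module _ (x y : Laurent) (isExpansion : IsExpansionAt∞ x y)
      (C D : ℕ → ℚ) (x≈ : x ≈ xSeries C) (y≈ : y ≈ ySeries D) (n-1 : ℕ) where

      open FromLaurent x y isExpansion C D x≈ y≈
      open Coefficients X Y X₀ curveᴴ parameterᴴ
      open Expansion X Y X₀ curveᴴ parameterᴴ using (v)

      private
        n N a : ℕ
        n = suc n-1
        N = 10 ℕ.* n
        -- This is N - 5; the indices 3 + a and 1 + a below are N - 2 and N - 4.
        a = 5 ℕ.+ n-1 ℕ.* 10

        N≡ : N ≡ 5 ℕ.+ a
        N≡ = ℕ.*-comm 10 n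

        Σ : (ℕ → ℤ) → ℚ
        Σ inv = ∑ (contributingPrimes N) (λ p → fractionalTerm N (inv p) p)

        -- The truncation at n is exact below index 10 + 10n, in particular at N = 10n.
        v≡24τ : v N ≡ ι (+ 24) ℚ.* τ N n
        v≡24τ = ≡.trans (v≡T n N (≡.subst (ℕ._< 10 ℕ.+ n ℕ.* 10) (ℕ.*-comm n 10) (ℕ.m<n+m (n ℕ.* 10) {10} (s≤s z≤n))))
          (T≡24τ N n)

        10∣ : 10 ℕ.∣ 5 ℕ.+ a
        10∣ = ≡.subst (10 ℕ.∣_) N≡ (ℕ.m∣m*n n)

        D+τ : Integral (D N ℚ.+ τ N n)
        D+τ = + N ℤ.* yRem (1 ℕ.+ a) , ι-cancel 24 (begin
          ι (+ 24) ℚ.* (D N ℚ.+ τ N n)             ≡⟨ ℚ.*-distribˡ-+ (ι (+ 24)) (D N) (τ N n) ⟩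
          ι (+ 24) ℚ.* D N ℚ.+ ι (+ 24) ℚ.* τ N n  ≡⟨ ≡.cong (ι (+ 24) ℚ.* D N ℚ.+_) v≡24τ ⟨
          ι (+ 24) ℚ.* D N ℚ.+ v N                 ≡⟨ D-coefficient N a (D N) N≡ Y≡ ⟩
          ι (+ 24) ℚ.* (ι (+ N) ℚ.* K (1 ℕ.+ a))   ≡⟨ ≡.cong (ι (+ 24) ℚ.*_) (ι-* (+ N) (yRem (1 ℕ.+ a))) ⟨
          ι (+ 24) ℚ.* ι (+ N ℤ.* yRem (1 ℕ.+ a))  ∎)
          where
          open ≡.≡-Reasoning
          Y≡ : Y N ≡ ι (+ (4 ℕ.+ a)) ℚ.* (ι (+ (3 ℕ.+ a)) ℚ.* (ι (+ (2 ℕ.+ a)) ℚ.* (ι (+ (1 ℕ.+ a)) ℚ.* D N)))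
          Y≡ = ≡.subst (λ m → Y m ≡ ι (+ (4 ℕ.+ a)) ℚ.* (ι (+ (3 ℕ.+ a)) ℚ.* (ι (+ (2 ℕ.+ a)) ℚ.* (ι (+ (1 ℕ.+ a)) ℚ.* D m))))
            (≡.sym N≡) (Y-coefficient D a 10∣)

        C+24τ : Integral (C N ℚ.+ ι (+ 24) ℚ.* τ N n)
        C+24τ = + N ℤ.* xRem (3 ℕ.+ a) , (begin
          C N ℚ.+ ι (+ 24) ℚ.* τ N n     ≡⟨ ≡.cong (C N ℚ.+_) v≡24τ ⟨
          C N ℚ.+ v N                    ≡⟨ C-coefficient N (3 ℕ.+ a) (C N) N≡ X≡ ⟩
          ι (+ N) ℚ.* G (3 ℕ.+ a)        ≡⟨ ι-* (+ N) (xRem (3 ℕ.+ a)) ⟨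
          ι (+ N ℤ.* xRem (3 ℕ.+ a))     ∎)
          where
          open ≡.≡-Reasoning
          X≡ : X N ≡ ι (+ (4 ℕ.+ a)) ℚ.* C N
          X≡ = ≡.subst (λ m → X m ≡ ι (+ (4 ℕ.+ a)) ℚ.* C m) (≡.sym N≡) (X-coefficient C (3 ℕ.+ a) 10∣)

        τ+Σ : Integral (τ N n ℚ.+ Σ inv)
        τ+Σ = ≡.subst (λ m → Integral (τ N n ℚ.+ primeSum N (λ p → fractionalTerm N (inv p) p) (2 ℕ.+ m))) (ℕ.*-comm n 10)
          (τ+primeSum N (λ ()) n)

        integral-difference : ∀ {a b} → Integral (a ℚ.- b) → ∃[ h ] a ≡ b ℚ.+ ι h
        integral-difference {a} {b} (h , e) = h , ≡.trans (solve 2 (λ a b → a := b :+ (a :- b)) ≡.refl a b) (≡.cong (b ℚ.+_) e)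
          where open Data.Rational.Solver.+-*-Solver

        integral-minus : ∀ {a b} → Integral a → Integral b → Integral (a ℚ.- b)
        integral-minus (h , ≡.refl) (k , ≡.refl) = h ℤ.- k , ≡.sym (≡.trans (ι-+ h (ℤ.- k)) (≡.cong (ι h ℚ.+_) (ι-neg k)))

      fractional-parts : ∃[ g ] ∃[ h ]
        ( C N ≡ ∑ (contributingPrimes N) (λ p → fractionalTerm N (+ 1) p) ℚ.+ ι g
        × D N ≡ ∑ (contributingPrimes N) (λ p → fractionalTerm N (inv p) p) ℚ.+ ι h )
      fractional-parts = proj₁ C-part , proj₁ D-part , proj₂ C-part , proj₂ D-part
        where
        open Data.Rational.Solver.+-*-Solver
        24Σ : Integral (ι (+ 24) ℚ.* (τ N n ℚ.+ Σ inv))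
        24Σ with h , e ← τ+Σ = + 24 ℤ.* h , ≡.trans (≡.cong (ι (+ 24) ℚ.*_) e) (≡.sym (ι-* (+ 24) h))
        -- C + 24τ, 24(τ + Σ inv) and 24 Σ inv - Σ 1 are integral; the combination below eliminates
        -- both τ and Σ inv.
        C-part : ∃[ g ] C N ≡ Σ (λ _ → + 1) ℚ.+ ι g
        C-part = integral-difference (integral-cast
          (solve 4 (λ c t s₁ s₂ → ((c :+ con (ι (+ 24)) :* t) :- con (ι (+ 24)) :* (t :+ s₂)) :+ (con (ι (+ 24)) :* s₂ :- s₁) := c :- s₁) ≡.refl
            (C N) (τ N n) (Σ (λ _ → + 1)) (Σ inv))
          (integral-+ (integral-minus C+24τ 24Σ) (24-primeSum N (upTo (2 ℕ.+ N)))))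
        D-part : ∃[ h ] D N ≡ Σ inv ℚ.+ ι h
        D-part = integral-difference (integral-cast
          (solve 3 (λ d t s → (d :+ t) :- (t :+ s) := d :- s) ≡.refl (D N) (τ N n) (Σ inv))
          (integral-minus D+τ τ+Σ))

open import Defs
open import Data.Integer.Base as ℤ using (ℤ; +_)
open import Data.Integer.Divisibility as ℤ using (_∣_)
open import Data.Integer.Divisibility.Signed using (∣ᵤ⇒∣)
open import Data.Nat.Base as ℕ using (ℕ; suc; _!)
open import Data.Nat.Primality using (Prime)
open import Data.Product.Base using (_×_; ∃-syntax)
open import Data.Rational.Base as ℚ using (ℚ)
open import Relation.Binary.PropositionalEquality.Core using (_≡_)

theorem2p7 : (x y : Laurent) → IsExpansionAt∞ x y →
    (C D : ℕ → ℚ) → x ≈ xSeries C → y ≈ ySeries D →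
    (inv4! : ℕ → ℤ) →
    (∀ p → Prime p → p ℕ.% 5 ≡ 1 → + p ∣ (+ (4 !) ℤ.* inv4! p ℤ.- + 1)) →
    (n : ℕ) → n ℕ.≥ 1 →
    ∃[ G ] ∃[ H ]
    ( C (10 ℕ.* n) ≡ ∑ (contributingPrimes (10 ℕ.* n)) (λ p → fractionalTerm (10 ℕ.* n) (+ 1) p) ℚ.+ (G ℚ./ 1)
    × D (10 ℕ.* n) ≡ ∑ (contributingPrimes (10 ℕ.* n)) (λ p → fractionalTerm (10 ℕ.* n) (inv4! p) p) ℚ.+ (H ℚ./ 1) )
theorem2p7 x y isExpansion C D x≈ y≈ inv4! inverse (suc n-1) _ =
  FractionalParts.fractional-parts inv4! (λ p prime p≡1 → ∣ᵤ⇒∣ (inverse p prime p≡1)) x y isExpansion C D x≈ y≈ n-1
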